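{- For any $\epsilon>0$, there is a two-sided adaptive algorithm for $\epsilon$-testing Decision List with respect to the uniform distribution that makes $\tilde O(1/\epsilon)$ queries.
   Context: Boolean functions $f:\{0,1\}^n\to\{0,1\}$ are accessed through a membership-query oracle that returns $f(x)$ for a queried $x$. $f$ is $\epsilon$-far from a class $C$ (with respect to the uniform distribution) if $\Pr_{x}[f(x)\neq g(x)]\ge\epsilon$ for every $g\in C$, with $x$ uniform on $\{0,1\}^n$. A two-sided adaptive algorithm for $\epsilon$-testing $C$ is a randomized algorithm that, given $\epsilon$ and membership-query access to an arbitrary $f$ (and able to draw uniform random strings), chooses queries possibly adaptively, accepts with probability at least $2/3$ if $f\in C$, and rejects with probability at least $2/3$ if $f$ is $\epsilon$-far from every function in $C$. $\tilde O(T)$ means $O(T\cdot\mathrm{poly}(\log T))$. A decision list is a sequence $(x_{i_1},\xi_1,a_1),\dots,(x_{i_s},\xi_s,a_s)$ (any $s$) with $\xi_j,a_j\in\{0,1\}$, representing the function: if $x_{i_1}=\xi_1$ output $a_1$, else if $x_{i_2}=\xi_2$ output $a_2$, \dots, else if $x_{i_s}=\xi_s$ output $a_s$. Decision List is the class of all decision lists. -}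

module Defs where

open import Data.Nat using (ℕ; zero; suc; _+_; _*_; _^_; _≤_; _/_)
open import Data.Bool using (Bool; true; false; if_then_else_; _xor_; not)
open import Data.Fin using (Fin)
open import Data.Vec using (Vec; []; _∷_; lookup)
open import Data.List using (List; []; _∷_; map; _++_; length; filter)
open import Data.Product using (_×_; _,_; ∃)
open import Data.Bool.Properties using (T?)
open import Relation.Binary.PropositionalEquality using (_≡_)

allVecs : (n : ℕ) → List (Vec Bool n)
allVecs zero = [] ∷ []
allVecs (suc n) = map (false ∷_) (allVecs n) ++ map (true ∷_) (allVecs n)

count : {A : Set} → (A → Bool) → List A → ℕ
count P xs = length (filter (λ x → T? (P x)) xs)

BoolFun : ℕ → Set
BoolFun n = Vec Bool n → Bool

-- Hamming distance between two Boolean functions: |{x : f x ≠ g x}|.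
-- dist f g / 2^n is Pr_x[f x ≠ g x] for uniform x.
dist : {n : ℕ} → BoolFun n → BoolFun n → ℕ
dist {n} f g = count (λ x → f x xor g x) (allVecs n)

-- Decision lists: rules (i , ξ , a) meaning "if x_i = ξ output a",
-- followed by a default output (used when no rule fires).
DecisionList : ℕ → Set
DecisionList n = List (Fin n × Bool × Bool) × Bool

evalRules : {n : ℕ} → List (Fin n × Bool × Bool) → Bool → Vec Bool n → Bool
evalRules [] d x = d
evalRules ((i , ξ , a) ∷ rs) d x =
  if (lookup x i xor ξ) then evalRules rs d x else a

evalDL : {n : ℕ} → DecisionList n → BoolFun n
evalDL (rs , d) = evalRules rs d

IsDecisionList : {n : ℕ} → BoolFun n → Set
IsDecisionList {n} f = ∃ λ (L : DecisionList n) → ∀ x → f x ≡ evalDL L x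

-- f is ε-far from Decision List, with ε = p / q (p, q ≥ 1):
-- for every decision list g, Pr_x[f x ≠ g x] ≥ p / q, i.e. p * 2^n ≤ q * dist f g.
FarFromDL : {n : ℕ} → (p q : ℕ) → BoolFun n → Set
FarFromDL {n} p q f = ∀ (L : DecisionList n) → p * 2 ^ n ≤ q * dist f (evalDL L)

-- Deterministic adaptive membership-query algorithms (decision trees):
-- either output accept(true)/reject(false), or query a point and continue
-- depending on the answer.
data QTree (n : ℕ) : Set where
  leaf  : Bool → QTree n
  query : Vec Bool n → (Bool → QTree n) → QTree n

run : {n : ℕ} → QTree n → BoolFun n → Bool
run (leaf b) f = b
run (query x k) f = run (k (f x)) f

depth : {n : ℕ} → QTree n → ℕ
depth (leaf b) = 0
depth (query x k) = suc (Data.Nat._⊔_ (depth (k false)) (depth (k true)))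

-- A randomized adaptive algorithm using r uniform random bits:
-- the random string is drawn first, then a deterministic tree is run.
RandAlg : ℕ → ℕ → Set
RandAlg n r = Vec Bool r → QTree n

acceptCount : {n r : ℕ} → RandAlg n r → BoolFun n → ℕ
acceptCount {n} {r} A f = count (λ s → run (A s) f) (allVecs r)

rejectCount : {n r : ℕ} → RandAlg n r → BoolFun n → ℕ
rejectCount {n} {r} A f = count (λ s → not (run (A s) f)) (allVecs r)

-- ⌈ (b+1) / (a+1) ⌉ = ⌈ 1/ε ⌉ for ε = (a+1)/(b+1).
ceilInv : ℕ → ℕ → ℕ
ceilInv a b = (suc b + a) / suc a

{-# OPTIONS --safe #-}
-- A decision list is 2^-K-close to its first K distinct variables, so with K = O(log T), T = ⌈1/ε⌉, every query that is
-- uniformly distributed almost surely sees only K variables. Throw the coordinates at random into M = O(K²) buckets; then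
-- these variables land in different buckets. In each round, walk from random points x to a common random point w, replacing
-- bucket by bucket; a change of f along the way exposes a new relevant bucket b and a witness u such that, for a decision
-- list, y ↦ f(u with bucket b replaced by y) is a literal. Being δ-close to a literal, with δ about ε/M, is tested by
-- linearity testing of the derivative together with a test that the derivative is multiplicative. When no change of f
-- is found, accept if some decision list of length K in the exposed literals explains all the points x; the exposed functions
-- are near literals, so for f far from decision lists a union bound over all such decision lists makes this unlikely.
module Submission where

open import Defs
open import Data.Nat
open import Data.Nat.Properties
open import Data.Nat.DivMod using (m≡m%n+[m/n]*n; m%n<n)
open import Data.Nat.Logarithm using (⌊log₂_⌋; ⌊log₂⌋-mono-≤; ⌊log₂[2^n]⌋≡n)
open import Data.Nat.Tactic.RingSolver using (solve-∀)
open import Data.Bool using (Bool; true; false; if_then_else_; _xor_; not; _∧_; _∨_)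
import Data.Bool.Properties as Boolₚ
open import Data.Bool.ListAction using (any)
open import Data.Bool.Solver using (module xor-∧-Solver)
open import Data.Fin using (Fin; zero; suc)
import Data.Fin.Properties as Finₚ
open import Data.Maybe using (Maybe; just; nothing; is-nothing; maybe)
open import Data.Vec using (Vec; []; _∷_; lookup; zipWith; tabulate; replicate; updateAt)
open import Data.Vec.Properties using (≡-dec; lookup∘updateAt; lookup∘updateAt′; lookup∘tabulate; tabulate∘lookup)
import Data.Vec.Relation.Unary.All as VecAll
open import Data.List using (List; []; _∷_; map; _++_; length; take; foldl; filterᵇ; cartesianProduct; cartesianProductWith)
open import Data.List.Properties using (length-++; length-map; length-filter; length-take)
open import Data.List.Relation.Unary.All using (All; []; _∷_; universal)
import Data.List.Relation.Unary.All as ListAll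
open import Data.List.Relation.Unary.Any using (here; there)
open import Data.List.Membership.Propositional using (_∈_)
open import Data.List.Membership.Propositional.Properties
  using (∈-cartesianProductWith⁺; ∈-cartesianProduct⁺; ∈-++⁺ˡ; ∈-++⁺ʳ; ∈-map⁺; ∈-map⁻; ∈-filter⁻)
open import Data.List.Membership.DecPropositional using (_∈?_)
open import Data.Product using (_×_; _,_; ∃; Σ; proj₁; proj₂)
open import Data.Sum using (_⊎_; inj₁; inj₂)
open import Data.Unit using (⊤; tt)
open import Function using (_∘_)
open import Function.Bundles using (Equivalence)
open import Relation.Binary.PropositionalEquality
open import Relation.Nullary using (Dec; yes; no; contradiction; does)
open xor-∧-Solver using (_:+_; _:*_; _:=_; con) renaming (solve to solveᵇ)

-- A decision list may depend on all `n` coordinates, so f cannot be treated as a function of the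
-- exposed buckets alone. What helps is that a coordinatewise mixture of two independent uniform
-- points is again uniform: every point of a walk is as unlikely as `x` itself to run past the first
-- `K` rules. The point `w` is shared by all `x` of a round because the variables in unexposed
-- buckets then have the same values at all endpoints; rules that test them become constants, and
-- one short list over the exposed buckets explains every `x`. An exposed literal is exact for every
-- argument `y`, since on the first `K` variables the overwritten point looks like one of the two
-- ends of the change. Soundness is proved for every fixed partition; only completeness averages
-- over partitions. The randomness consists of uniform bits, so every sample space has a power of
-- two as its size; this is why `K` and `M` are powers of two. Probabilities are never formed: a
-- bound `B / c` on a probability appears as `c * count ≤ B * size`.

xor≡false⇒≡ : ∀ a b → a xor b ≡ false → a ≡ b
xor≡false⇒≡ true  true  _ = refl
xor≡false⇒≡ false false _ = refl

*-swap : ∀ a b c → a * (b * c) ≡ b * (a * c)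
*-swap = solve-∀

-- Indicators of Boolean events.

ind : Bool → ℕ
ind true  = 1
ind false = 0

ind-xor : ∀ a b → ind (a xor b) ≤ ind a + ind b
ind-xor true  true  = z≤n
ind-xor true  false = ≤-refl
ind-xor false b     = ≤-refl

ind-∧ : ∀ a b → ind (a ∧ b) ≡ ind a * ind b
ind-∧ true  b = sym (+-identityʳ (ind b))
ind-∧ false b = refl

ind-∨ : ∀ a b → ind (a ∨ b) ≤ ind a + ind b
ind-∨ true  b = s≤s z≤n
ind-∨ false b = ≤-refl

ind-∨ˡ : ∀ a b → ind a ≤ ind (a ∨ b)
ind-∨ˡ true  b = ≤-refl
ind-∨ˡ false b = z≤n

ind-∨ʳ : ∀ a b → ind b ≤ ind (a ∨ b)
ind-∨ʳ true  true  = ≤-refl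
ind-∨ʳ true  false = z≤n
ind-∨ʳ false b     = ≤-refl

ind≤1 : ∀ a → ind a ≤ 1
ind≤1 true  = ≤-refl
ind≤1 false = z≤n

ind-not : ∀ a → ind a + ind (not a) ≡ 1
ind-not true  = refl
ind-not false = refl

-- Uniform sample spaces. Products and powers are kept symbolic so that Fubini holds by computation.
data Space : Set where
  bit : Space
  _⊗_ : Space → Space → Space
  _^ˢ_ : Space → ℕ → Space

infixr 6 _⊗_
infixl 8 _^ˢ_

Pt : Space → Set
Pt bit      = Bool
Pt (S ⊗ T)  = Pt S × Pt T
Pt (S ^ˢ m) = Vec (Pt S) m

cube : ℕ → Space
cube n = bit ^ˢ n

∑pow : {A : Set} → ((A → ℕ) → ℕ) → ∀ m → (Vec A m → ℕ) → ℕ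
∑pow s zero    F = F []
∑pow s (suc m) F = s (λ a → ∑pow s m (λ as → F (a ∷ as)))

∑ : (S : Space) → (Pt S → ℕ) → ℕ
∑ bit      F = F false + F true
∑ (S ⊗ T)  F = ∑ S (λ a → ∑ T (λ b → F (a , b)))
∑ (S ^ˢ m) F = ∑pow (∑ S) m F

syntax ∑ S (λ x → e) = ∑[ x ∈ S ] e

bits : Space → ℕ
bits bit            = 1
bits (S ⊗ T)        = bits S + bits T
bits (S ^ˢ zero)    = 0
bits (S ^ˢ (suc m)) = bits S + bits (S ^ˢ m)

∥_∥ : Space → ℕ
∥ S ∥ = 2 ^ bits S

∥⊗∥ : ∀ S T → ∥ S ⊗ T ∥ ≡ ∥ S ∥ * ∥ T ∥
∥⊗∥ S T = ^-distribˡ-+-* 2 (bits S) (bits T)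

∥^suc∥ : ∀ S m → ∥ S ^ˢ suc m ∥ ≡ ∥ S ∥ * ∥ S ^ˢ m ∥
∥^suc∥ S m = ^-distribˡ-+-* 2 (bits S) (bits (S ^ˢ m))

∥cube∥ : ∀ n → ∥ cube n ∥ ≡ 2 ^ n
∥cube∥ zero    = refl
∥cube∥ (suc n) = cong (2 *_) (∥cube∥ n)

∑-mono : ∀ S {F G : Pt S → ℕ} → (∀ a → F a ≤ G a) → ∑ S F ≤ ∑ S G
∑-mono bit          h = +-mono-≤ (h false) (h true)
∑-mono (S ⊗ T)      h = ∑-mono S (λ a → ∑-mono T (λ b → h (a , b)))
∑-mono (S ^ˢ zero)  h = h []
∑-mono (S ^ˢ suc m) h = ∑-mono S (λ a → ∑-mono (S ^ˢ m) (λ as → h (a ∷ as)))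

∑-cong : ∀ S {F G : Pt S → ℕ} → (∀ a → F a ≡ G a) → ∑ S F ≡ ∑ S G
∑-cong S h = ≤-antisym (∑-mono S (λ a → ≤-reflexive (h a)))
                       (∑-mono S (λ a → ≤-reflexive (sym (h a))))

∑-+ : ∀ S (F G : Pt S → ℕ) → ∑ S (λ a → F a + G a) ≡ ∑ S F + ∑ S G
∑-+ bit          F G = interchange (F false) (G false) (F true) (G true)
  where
  interchange : ∀ a b c d → (a + b) + (c + d) ≡ (a + c) + (b + d)
  interchange = solve-∀
∑-+ (S ⊗ T)      F G = trans (∑-cong S (λ a → ∑-+ T (λ b → F (a , b)) (λ b → G (a , b)))) (∑-+ S _ _)
∑-+ (S ^ˢ zero)  F G = refl
∑-+ (S ^ˢ suc m) F G =
  trans (∑-cong S (λ a → ∑-+ (S ^ˢ m) (λ as → F (a ∷ as)) (λ as → G (a ∷ as)))) (∑-+ S _ _)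

∑-*ˡ : ∀ S c (F : Pt S → ℕ) → ∑ S (λ a → c * F a) ≡ c * ∑ S F
∑-*ˡ bit          c F = sym (*-distribˡ-+ c (F false) (F true))
∑-*ˡ (S ⊗ T)      c F = trans (∑-cong S (λ a → ∑-*ˡ T c (λ b → F (a , b)))) (∑-*ˡ S c _)
∑-*ˡ (S ^ˢ zero)  c F = refl
∑-*ˡ (S ^ˢ suc m) c F = trans (∑-cong S (λ a → ∑-*ˡ (S ^ˢ m) c (λ as → F (a ∷ as)))) (∑-*ˡ S c _)

∑-*ʳ : ∀ S c (F : Pt S → ℕ) → ∑ S (λ a → F a * c) ≡ ∑ S F * c
∑-*ʳ S c F = trans (∑-cong S (λ a → *-comm (F a) c)) (trans (∑-*ˡ S c F) (*-comm c _))

∑-one : ∀ S → ∑ S (λ _ → 1) ≡ ∥ S ∥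
∑-one bit     = refl
∑-one (S ⊗ T) = begin
  ∑ S (λ a → ∑ T (λ b → 1))     ≡⟨ ∑-cong S (λ _ → trans (∑-one T) (sym (*-identityʳ ∥ T ∥))) ⟩
  ∑ S (λ a → ∥ T ∥ * 1)         ≡⟨ ∑-*ˡ S ∥ T ∥ (λ _ → 1) ⟩
  ∥ T ∥ * ∑ S (λ _ → 1)         ≡⟨ cong (∥ T ∥ *_) (∑-one S) ⟩
  ∥ T ∥ * ∥ S ∥                 ≡⟨ *-comm ∥ T ∥ ∥ S ∥ ⟩
  ∥ S ∥ * ∥ T ∥                 ≡⟨ ∥⊗∥ S T ⟨
  ∥ S ⊗ T ∥                     ∎
  where open ≡-Reasoning
∑-one (S ^ˢ zero)  = refl
∑-one (S ^ˢ suc m) = begin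
  ∑ S (λ a → ∑ (S ^ˢ m) (λ _ → 1)) ≡⟨ ∑-cong S (λ _ → trans (∑-one (S ^ˢ m)) (sym (*-identityʳ ∥ S ^ˢ m ∥))) ⟩
  ∑ S (λ a → ∥ S ^ˢ m ∥ * 1)       ≡⟨ ∑-*ˡ S ∥ S ^ˢ m ∥ (λ _ → 1) ⟩
  ∥ S ^ˢ m ∥ * ∑ S (λ _ → 1)       ≡⟨ cong (∥ S ^ˢ m ∥ *_) (∑-one S) ⟩
  ∥ S ^ˢ m ∥ * ∥ S ∥               ≡⟨ *-comm ∥ S ^ˢ m ∥ ∥ S ∥ ⟩
  ∥ S ∥ * ∥ S ^ˢ m ∥               ≡⟨ ∥^suc∥ S m ⟨
  ∥ S ^ˢ suc m ∥                   ∎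
  where open ≡-Reasoning

∑-const : ∀ S c → ∑ S (λ _ → c) ≡ ∥ S ∥ * c
∑-const S c = begin
  ∑ S (λ _ → c)     ≡⟨ ∑-cong S (λ _ → *-identityʳ c) ⟨
  ∑ S (λ _ → c * 1) ≡⟨ ∑-*ˡ S c (λ _ → 1) ⟩
  c * ∑ S (λ _ → 1) ≡⟨ cong (c *_) (∑-one S) ⟩
  c * ∥ S ∥         ≡⟨ *-comm c ∥ S ∥ ⟩
  ∥ S ∥ * c         ∎
  where open ≡-Reasoning

∑-bound : ∀ S {F : Pt S → ℕ} {c} → (∀ a → F a ≤ c) → ∑ S F ≤ ∥ S ∥ * c
∑-bound S {c = c} h = ≤-trans (∑-mono S h) (≤-reflexive (∑-const S c))

∑-swap : ∀ S T (F : Pt S → Pt T → ℕ) →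
         ∑ S (λ a → ∑ T (λ b → F a b)) ≡ ∑ T (λ b → ∑ S (λ a → F a b))
∑-swap bit          T F = sym (∑-+ T (F false) (F true))
∑-swap (S₁ ⊗ S₂)    T F = trans (∑-cong S₁ (λ a → ∑-swap S₂ T (λ b → F (a , b)))) (∑-swap S₁ T _)
∑-swap (S ^ˢ zero)  T F = refl
∑-swap (S ^ˢ suc m) T F =
  trans (∑-cong S (λ a → ∑-swap (S ^ˢ m) T (λ as → F (a ∷ as)))) (∑-swap S T _)

∑-complement : ∀ S (P : Pt S → Bool) → ∑ S (λ a → ind (P a)) + ∑ S (λ a → ind (not (P a))) ≡ ∥ S ∥
∑-complement S P = trans (sym (∑-+ S _ _)) (trans (∑-cong S (λ a → ind-not (P a))) (∑-one S))

-- The point is found by descending into the half with the smaller sum. It supplies the vote in `φ`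
-- and the additive constant in `close`.
averaging : ∀ n (F : Vec Bool n → ℕ) → ∃ λ a → ∥ cube n ∥ * F a ≤ ∑ (cube n) F
averaging zero    F = [] , ≤-reflexive (+-identityʳ _)
averaging (suc n) F
  with averaging n (λ x → F (false ∷ x)) | averaging n (λ x → F (true ∷ x))
     | ≤-total (∑ (cube n) (λ x → F (false ∷ x))) (∑ (cube n) (λ x → F (true ∷ x)))
... | x , p | _ | inj₁ s = false ∷ x , ≤-trans (≤-reflexive (double ∥ cube n ∥ (F (false ∷ x)))) (+-mono-≤ p (≤-trans p s))
  where
  double : ∀ a b → (2 * a) * b ≡ a * b + a * b
  double = solve-∀
... | _ | x , p | inj₂ s = true ∷ x , ≤-trans (≤-reflexive (double ∥ cube n ∥ (F (true ∷ x)))) (+-mono-≤ (≤-trans p s) p)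
  where
  double : ∀ a b → (2 * a) * b ≡ a * b + a * b
  double = solve-∀

-- Amplification by independent repetition.

allV : {A : Set} → (A → Bool) → ∀ {m} → Vec A m → Bool
allV P []       = true
allV P (a ∷ as) = P a ∧ allV P as

∑-allV : ∀ S (P : Pt S → Bool) m → ∑ (S ^ˢ m) (λ as → ind (allV P as)) ≡ ∑ S (λ a → ind (P a)) ^ m
∑-allV S P zero    = refl
∑-allV S P (suc m) = begin
  ∑ S (λ a → ∑ (S ^ˢ m) (λ as → ind (P a ∧ allV P as)))
    ≡⟨ ∑-cong S (λ a → ∑-cong (S ^ˢ m) (λ as → ind-∧ (P a) (allV P as))) ⟩
  ∑ S (λ a → ∑ (S ^ˢ m) (λ as → ind (P a) * ind (allV P as)))
    ≡⟨ ∑-cong S (λ a → trans (∑-*ˡ (S ^ˢ m) (ind (P a)) _) (cong (ind (P a) *_) (∑-allV S P m))) ⟩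
  ∑ S (λ a → ind (P a) * ∑ S (λ a → ind (P a)) ^ m)
    ≡⟨ ∑-*ʳ S _ _ ⟩
  ∑ S (λ a → ind (P a)) * ∑ S (λ a → ind (P a)) ^ m ∎
  where open ≡-Reasoning

∥^∥ : ∀ S m → ∥ S ^ˢ m ∥ ≡ ∥ S ∥ ^ m
∥^∥ S zero    = refl
∥^∥ S (suc m) = trans (∥^suc∥ S m) (cong (∥ S ∥ *_) (∥^∥ S m))

-- This is `1 + m / x ≤ (1 + 1 / x) ^ m` multiplied by `x ^ (m + 1)`, a form that also makes sense
-- at `x = 0`.
bernoulli : ∀ x m → x ^ m * x + m * x ^ m ≤ suc x ^ m * x
bernoulli x zero    = ≤-reflexive (+-identityʳ _)
bernoulli x (suc m) = begin
  x * x ^ m * x + (x ^ suc m + m * (x * x ^ m)) ≡⟨ e x (x ^ m) m ⟩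
  (x ^ m * x + m * x ^ m) * x + x ^ m * x ≤⟨ +-mono-≤ (*-monoˡ-≤ x (bernoulli x m)) (*-monoˡ-≤ x (^-monoˡ-≤ m (n≤1+n x))) ⟩
  suc x ^ m * x * x + suc x ^ m * x       ≡⟨ e₂ (suc x ^ m) x ⟩
  suc x * suc x ^ m * x                   ∎
  where
  open ≤-Reasoning
  e : ∀ x p m → x * p * x + (x * p + m * (x * p)) ≡ (p * x + m * p) * x + p * x
  e = solve-∀
  e₂ : ∀ q x → q * x * x + q * x ≡ (1 + x) * q * x
  e₂ = solve-∀

-- (1 - 1/N)^N ≤ 1/2 with N = x + 1, cleared of denominators.
halving : ∀ x → 2 * x ^ suc x ≤ suc x ^ suc x
halving zero    = z≤n
-- Bernoulli with exponent `y + 1` gives `(1 + 1 / y) ^ (y + 1) ≥ 2 + 1 / y`.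
halving (suc x) = *-cancelʳ-≤ _ _ y (begin
  2 * y ^ suc y * y             ≡⟨ e y (y ^ suc y) ⟩
  y ^ suc y * y + y * y ^ suc y ≤⟨ +-monoʳ-≤ (y ^ suc y * y) (*-monoˡ-≤ (y ^ suc y) (n≤1+n y)) ⟩
  y ^ suc y * y + suc y * y ^ suc y ≤⟨ bernoulli y (suc y) ⟩
  suc y ^ suc y * y             ∎)
  where
  open ≤-Reasoning
  y = suc x
  e : ∀ x p → 2 * p * x ≡ p * x + x * p
  e = solve-∀

^-distribʳ-* : ∀ a b n → (a * b) ^ n ≡ a ^ n * b ^ n
^-distribʳ-* a b zero    = refl
^-distribʳ-* a b (suc n) = trans (cong (a * b *_) (^-distribʳ-* a b n)) (e a b (a ^ n) (b ^ n))
  where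
  e : ∀ a b c d → a * b * (c * d) ≡ a * c * (b * d)
  e = solve-∀

-- p/s is a pass probability, at most 1 - 1/(N+1).
power-decay : ∀ N d p f s → p + f ≡ s → s ≤ suc N * f → 2 ^ d * p ^ (suc N * d) ≤ s ^ (suc N * d)
power-decay N d p f s refl h = *-cancelˡ-≤ (suc N ^ (suc N * d)) ⦃ m^n≢0 (suc N) (suc N * d) ⦄ (begin
  suc N ^ (suc N * d) * (2 ^ d * p ^ (suc N * d))   ≡⟨ cong₂ (λ u v → u * (2 ^ d * v)) (sym (^-*-assoc (suc N) (suc N) d)) (sym (^-*-assoc p (suc N) d)) ⟩
  A ^ d * (2 ^ d * (p ^ suc N) ^ d)                 ≡⟨ *-swap (A ^ d) (2 ^ d) ((p ^ suc N) ^ d) ⟩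
  2 ^ d * (A ^ d * (p ^ suc N) ^ d)                 ≡⟨ cong (2 ^ d *_) (sym (^-distribʳ-* A (p ^ suc N) d)) ⟩
  2 ^ d * (A * p ^ suc N) ^ d                       ≡⟨ sym (^-distribʳ-* 2 (A * p ^ suc N) d) ⟩
  (2 * (A * p ^ suc N)) ^ d                         ≤⟨ ^-monoˡ-≤ d one ⟩
  (A * s ^ suc N) ^ d                               ≡⟨ ^-distribʳ-* A (s ^ suc N) d ⟩
  A ^ d * (s ^ suc N) ^ d                           ≡⟨ cong₂ _*_ (^-*-assoc (suc N) (suc N) d) (^-*-assoc s (suc N) d) ⟩
  suc N ^ (suc N * d) * s ^ (suc N * d)             ∎)
  where
  open ≤-Reasoning
  A = suc N ^ suc N
  e₂ : ∀ N p f → (1 + N) * p + (1 + N) * f ≡ (1 + N) * (p + f)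
  e₂ = solve-∀
  Np≤ : suc N * p ≤ N * s
  Np≤ = +-cancelʳ-≤ s _ _ (begin
    suc N * p + s           ≤⟨ +-monoʳ-≤ (suc N * p) h ⟩
    suc N * p + suc N * f   ≡⟨ e₂ N p f ⟩
    suc N * s               ≡⟨ +-comm s (N * s) ⟩
    N * s + s               ∎)
  one : 2 * (A * p ^ suc N) ≤ A * s ^ suc N
  one = begin
    2 * (A * p ^ suc N)          ≡⟨ cong (2 *_) (sym (^-distribʳ-* (suc N) p (suc N))) ⟩
    2 * (suc N * p) ^ suc N      ≤⟨ *-monoʳ-≤ 2 (^-monoˡ-≤ (suc N) Np≤) ⟩
    2 * (N * s) ^ suc N          ≡⟨ cong (2 *_) (^-distribʳ-* N s (suc N)) ⟩
    2 * (N ^ suc N * s ^ suc N)  ≡⟨ sym (*-assoc 2 (N ^ suc N) (s ^ suc N)) ⟩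
    2 * N ^ suc N * s ^ suc N    ≤⟨ *-monoˡ-≤ (s ^ suc N) (halving N) ⟩
    A * s ^ suc N                ∎

-- The samples form `d` blocks of `N`. As each sample fails with probability at least `1 / N`, a
-- block passes with probability at most one half.
amplify : ∀ S (P : Pt S → Bool) N .{{_ : NonZero N}} d → ∥ S ∥ ≤ N * ∑ S (λ a → ind (not (P a))) →
          2 ^ d * ∑ (S ^ˢ (N * d)) (λ as → ind (allV P as)) ≤ ∥ S ^ˢ (N * d) ∥
amplify S P (suc N) d h = subst₂ (λ u v → 2 ^ d * u ≤ v) (sym (∑-allV S P (suc N * d))) (sym (∥^∥ S (suc N * d)))
  (power-decay N d _ _ _ (∑-complement S P) h)

-- Drawing sample points from uniform bit strings.

splitBits : ∀ m {n} → Vec Bool (m + n) → Vec Bool m × Vec Bool n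
splitBits zero    s       = [] , s
splitBits (suc m) (b ∷ s) = b ∷ proj₁ (splitBits m s) , proj₂ (splitBits m s)

decode : ∀ S → Vec Bool (bits S) → Pt S
decode bit          (b ∷ []) = b
decode (S ⊗ T)      s = decode S (proj₁ (splitBits (bits S) s)) , decode T (proj₂ (splitBits (bits S) s))
decode (S ^ˢ zero)  s = []
decode (S ^ˢ suc m) s = decode S (proj₁ (splitBits (bits S) s)) ∷ decode (S ^ˢ m) (proj₂ (splitBits (bits S) s))

∑-split : ∀ m n (F : Vec Bool m → Vec Bool n → ℕ) →
          ∑ (cube (m + n)) (λ s → F (proj₁ (splitBits m s)) (proj₂ (splitBits m s))) ≡ ∑ (cube m) (λ x → ∑ (cube n) (F x))
∑-split zero    n F = refl
∑-split (suc m) n F = cong₂ _+_ (∑-split m n (λ x → F (false ∷ x))) (∑-split m n (λ x → F (true ∷ x)))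

-- Counting over the random strings of a `RandAlg` thereby becomes counting over a structured space,
-- where Fubini is available.
∑-decode : ∀ S (F : Pt S → ℕ) → ∑ (cube (bits S)) (λ s → F (decode S s)) ≡ ∑ S F
∑-decode bit F = refl
∑-decode (S ⊗ T) F = begin
  _ ≡⟨ ∑-split (bits S) (bits T) (λ x y → F (decode S x , decode T y)) ⟩
  ∑ (cube (bits S)) (λ x → ∑ (cube (bits T)) (λ y → F (decode S x , decode T y)))
    ≡⟨ ∑-cong (cube (bits S)) (λ x → ∑-decode T (λ b → F (decode S x , b))) ⟩
  ∑ (cube (bits S)) (λ x → ∑ T (λ b → F (decode S x , b))) ≡⟨ ∑-decode S _ ⟩
  ∑ S (λ a → ∑ T (λ b → F (a , b))) ∎
  where open ≡-Reasoning
∑-decode (S ^ˢ zero) F = refl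
∑-decode (S ^ˢ suc m) F = begin
  _ ≡⟨ ∑-split (bits S) (bits (S ^ˢ m)) (λ x y → F (decode S x ∷ decode (S ^ˢ m) y)) ⟩
  ∑ (cube (bits S)) (λ x → ∑ (cube (bits (S ^ˢ m))) (λ y → F (decode S x ∷ decode (S ^ˢ m) y)))
    ≡⟨ ∑-cong (cube (bits S)) (λ x → ∑-decode (S ^ˢ m) (λ b → F (decode S x ∷ b))) ⟩
  ∑ (cube (bits S)) (λ x → ∑ (S ^ˢ m) (λ b → F (decode S x ∷ b))) ≡⟨ ∑-decode S _ ⟩
  ∑ S (λ a → ∑ (S ^ˢ m) (λ b → F (a ∷ b))) ∎
  where open ≡-Reasoning

count-++ : {A : Set} (P : A → Bool) (xs ys : List A) → count P (xs ++ ys) ≡ count P xs + count P ys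
count-++ P []       ys = refl
count-++ P (x ∷ xs) ys with P x
... | true  = cong suc (count-++ P xs ys)
... | false = count-++ P xs ys

count-map : {A B : Set} (P : B → Bool) (g : A → B) (xs : List A) → count P (map g xs) ≡ count (λ x → P (g x)) xs
count-map P g []       = refl
count-map P g (x ∷ xs) with P (g x)
... | true  = cong suc (count-map P g xs)
... | false = count-map P g xs

count-allVecs : ∀ n (P : Vec Bool n → Bool) → count P (allVecs n) ≡ ∑ (cube n) (λ x → ind (P x))
count-allVecs zero P with P []
... | true  = refl
... | false = refl
count-allVecs (suc n) P = trans (count-++ P (map (false ∷_) (allVecs n)) (map (true ∷_) (allVecs n)))
  (cong₂ _+_ (trans (count-map P (false ∷_) (allVecs n)) (count-allVecs n (λ x → P (false ∷ x))))
             (trans (count-map P (true ∷_) (allVecs n)) (count-allVecs n (λ x → P (true ∷ x)))))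

-- The cube as a ring over the field with two elements, and its literals.

_⊕_ : ∀ {n} → Vec Bool n → Vec Bool n → Vec Bool n
_⊕_ = zipWith _xor_

_⋀_ : ∀ {n} → Vec Bool n → Vec Bool n → Vec Bool n
_⋀_ = zipWith _∧_

infixl 6 _⊕_
infixl 7 _⋀_

∑-shiftˡ : ∀ n (x : Vec Bool n) F → ∑ (cube n) (λ y → F (x ⊕ y)) ≡ ∑ (cube n) F
∑-shiftˡ zero    []          F = refl
∑-shiftˡ (suc n) (false ∷ x) F = cong₂ _+_ (∑-shiftˡ n x _) (∑-shiftˡ n x _)
∑-shiftˡ (suc n) (true ∷ x)  F = trans (cong₂ _+_ (∑-shiftˡ n x _) (∑-shiftˡ n x _)) (+-comm (∑ (cube n) (λ y → F (true ∷ y))) _)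

⊕-comm : ∀ {n} (x y : Vec Bool n) → x ⊕ y ≡ y ⊕ x
⊕-comm []      []      = refl
⊕-comm (a ∷ x) (b ∷ y) = cong₂ _∷_ (Boolₚ.xor-comm a b) (⊕-comm x y)

∑-shiftʳ : ∀ n (x : Vec Bool n) F → ∑ (cube n) (λ y → F (y ⊕ x)) ≡ ∑ (cube n) F
∑-shiftʳ n x F = trans (∑-cong (cube n) (λ y → cong F (⊕-comm y x))) (∑-shiftˡ n x F)

⊕-rearrange : ∀ {n} (x y z u : Vec Bool n) → y ⊕ (x ⊕ z ⊕ u) ≡ x ⊕ y ⊕ (z ⊕ u)
⊕-rearrange [] [] [] [] = refl
⊕-rearrange (x ∷ xs) (y ∷ ys) (z ∷ zs) (u ∷ us) = cong₂ _∷_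
  (solveᵇ 4 (λ x y z u → y :+ ((x :+ z) :+ u) := (x :+ y) :+ (z :+ u)) refl x y z u) (⊕-rearrange xs ys zs us)

⊕-assoc : ∀ {n} (x y z : Vec Bool n) → x ⊕ y ⊕ z ≡ x ⊕ (y ⊕ z)
⊕-assoc [] [] [] = refl
⊕-assoc (x ∷ xs) (y ∷ ys) (z ∷ zs) = cong₂ _∷_
  (solveᵇ 3 (λ x y z → x :+ y :+ z := x :+ (y :+ z)) refl x y z) (⊕-assoc xs ys zs)

⋀-distribʳ-⊕ : ∀ {n} (x y z : Vec Bool n) → (x ⊕ y) ⋀ z ≡ (x ⋀ z) ⊕ (y ⋀ z)
⋀-distribʳ-⊕ [] [] [] = refl
⋀-distribʳ-⊕ (x ∷ xs) (y ∷ ys) (z ∷ zs) = cong₂ _∷_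
  (solveᵇ 3 (λ x y z → (x :+ y) :* z := x :* z :+ y :* z) refl x y z) (⋀-distribʳ-⊕ xs ys zs)

⋀-distribˡ-⊕ : ∀ {n} (x y z : Vec Bool n) → x ⋀ (y ⊕ z) ≡ (x ⋀ y) ⊕ (x ⋀ z)
⋀-distribˡ-⊕ [] [] [] = refl
⋀-distribˡ-⊕ (x ∷ xs) (y ∷ ys) (z ∷ zs) = cong₂ _∷_
  (solveᵇ 3 (λ x y z → x :* (y :+ z) := x :* y :+ x :* z) refl x y z) (⋀-distribˡ-⊕ xs ys zs)

-- Constants are included because they pass the literal test as well; `literals⇒decisionList` shows
-- that they do no harm.
data Lit (n : ℕ) : Set where
  const : Bool → Lit n
  var   : Fin n → Bool → Lit n

evalLit : ∀ {n} → Lit n → BoolFun n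
evalLit (const b) x = b
evalLit (var i s) x = lookup x i xor s

⊕-identityˡ : ∀ {n} (x : Vec Bool n) → replicate n false ⊕ x ≡ x
⊕-identityˡ []      = refl
⊕-identityˡ (b ∷ x) = cong (b ∷_) (⊕-identityˡ x)

⋀-zeroʳ : ∀ {n} (x : Vec Bool n) → x ⋀ replicate n false ≡ replicate n false
⋀-zeroʳ []          = refl
⋀-zeroʳ (true ∷ x)  = cong (false ∷_) (⋀-zeroʳ x)
⋀-zeroʳ (false ∷ x) = cong (false ∷_) (⋀-zeroʳ x)

dropHead : ∀ {n} (φ : BoolFun (suc n)) → (∀ x y → φ (x ⊕ y) ≡ φ x xor φ y) →
           φ (true ∷ replicate n false) ≡ false → ∀ b x → φ (b ∷ x) ≡ φ (false ∷ x)
dropHead φ add e false x = refl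
dropHead φ add e true  x = trans (cong (λ v → φ (true ∷ v)) (sym (⊕-identityˡ x)))
  (trans (add (true ∷ replicate _ false) (false ∷ x)) (cong (_xor φ (false ∷ x)) e))

multiplicative⇒literal : ∀ n (φ : BoolFun n) →
  (∀ x y → φ (x ⊕ y) ≡ φ x xor φ y) → (∀ x y → φ (x ⋀ y) ≡ φ x ∧ φ y) →
  (∀ x → φ x ≡ false) ⊎ (∃ λ i → ∀ x → φ x ≡ lookup x i)
multiplicative⇒literal zero φ add mul = inj₁ λ { [] → trans (add [] []) (Boolₚ.xor-same (φ [])) }
multiplicative⇒literal (suc n) φ add mul
  with φ (true ∷ replicate n false) in e₁ | multiplicative⇒literal n (λ x → φ (false ∷ x)) (λ x y → add _ _) (λ x y → mul _ _)
... | true | _ = inj₂ (zero , λ { (b ∷ x) → begin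
    φ (b ∷ x)                           ≡⟨ cong₂ (λ c v → φ (c ∷ v)) (Boolₚ.xor-identityʳ b) (⊕-identityˡ x) ⟨
    φ ((b ∷ 𝟎) ⊕ (false ∷ x))           ≡⟨ add _ _ ⟩
    φ (b ∷ 𝟎) xor φ (false ∷ x)         ≡⟨ cong₂ _xor_ (head≡ b) (tail≡ x) ⟩
    b xor false                         ≡⟨ Boolₚ.xor-identityʳ b ⟩
    b                                   ∎ })
  where
  open ≡-Reasoning
  𝟎 = replicate n false
  zero≡ : φ (false ∷ 𝟎) ≡ false
  zero≡ = trans (cong (λ v → φ (false ∷ v)) (sym (⊕-identityˡ 𝟎))) (trans (add (false ∷ 𝟎) (false ∷ 𝟎)) (Boolₚ.xor-same (φ (false ∷ 𝟎))))
  tail≡ : ∀ x → φ (false ∷ x) ≡ false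
  tail≡ x = begin
    φ (false ∷ x)                       ≡⟨ Boolₚ.∧-identityʳ _ ⟨
    φ (false ∷ x) ∧ true                ≡⟨ cong (φ (false ∷ x) ∧_) e₁ ⟨
    φ (false ∷ x) ∧ φ (true ∷ 𝟎)        ≡⟨ mul _ _ ⟨
    φ (false ∷ (x ⋀ 𝟎))                 ≡⟨ cong (λ v → φ (false ∷ v)) (⋀-zeroʳ x) ⟩
    φ (false ∷ 𝟎)                       ≡⟨ zero≡ ⟩
    false                               ∎
  head≡ : ∀ b → φ (b ∷ 𝟎) ≡ b
  head≡ true  = e₁
  head≡ false = zero≡
... | false | rest with rest
...   | inj₁ h       = inj₁ λ { (b ∷ x) → trans (dropHead φ add e₁ b x) (h x) }
...   | inj₂ (i , h) = inj₂ (suc i , λ { (b ∷ x) → trans (dropHead φ add e₁ b x) (h x) })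

-- The Blum-Luby-Rubinfeld test on four points with sum zero; this version tolerates an additive
-- constant.
affineFails : ∀ {n} → BoolFun n → (x y z : Vec Bool n) → Bool
affineFails g x y z = g x xor g y xor g z xor g (x ⊕ (y ⊕ z))

-- For g(y) = yᵢ + s this is constantly xᵢ.
∂ : ∀ {n} → BoolFun n → (x y : Vec Bool n) → Bool
∂ g x y = g (x ⊕ y) xor g y

-- The independent base points `u`, `v`, `z` make each derivative a random vote on the linear part
-- of `g`, so the sign of the literal never has to be known.
productFails : ∀ {n} → BoolFun n → (x y u v z : Vec Bool n) → Bool
productFails g x y u v z = (∂ g x u ∧ ∂ g y v) xor ∂ g (x ⋀ y) z

-- Self-correction: small test errors force closeness to a literal.

module SelfCorrection {n} (g : BoolFun n) (N : ℕ) (16≤N : 16 ≤ N) where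
  C = cube n
  Q = ∥ C ∥

  affineErr = ∑[ x ∈ C ] ∑[ y ∈ C ] ∑[ z ∈ C ] ind (affineFails g x y z)

  -- The two affine tests share the point `u` and the fourth point `x ⊕ y ⊕ z ⊕ u`, whose values
  -- cancel.
  ∂-difference : ∀ x y z u → ∂ g x y xor ∂ g x z ≡ affineFails g (x ⊕ y) z u xor affineFails g y (x ⊕ z) u
  ∂-difference x y z u = trans
    (solveᵇ 6 (λ a b c d e f → (a :+ b) :+ (c :+ d) := (a :+ (d :+ (e :+ f))) :+ (b :+ (c :+ (e :+ f)))) refl
      (g (x ⊕ y)) (g y) (g (x ⊕ z)) (g z) (g u) (g (x ⊕ y ⊕ (z ⊕ u))))
    (cong (λ v → affineFails g (x ⊕ y) z u xor (g y xor g (x ⊕ z) xor g u xor g v)) (sym (⊕-rearrange x y z u)))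

  -- The bound holds for every single `x`: with the auxiliary point `u` and a shift of `y` or `z` by
  -- `x`, each of the two tests is run on a uniform triple.
  ∂-spread : ∀ x → Q * (∑[ z ∈ C ] ∑[ y ∈ C ] ind (∂ g x y xor ∂ g x z)) ≤ 2 * affineErr
  ∂-spread x = begin
    Q * (∑[ z ∈ C ] ∑[ y ∈ C ] ind (∂ g x y xor ∂ g x z))
      ≡⟨ cong (Q *_) (∑-swap C C _) ⟩
    Q * (∑[ y ∈ C ] ∑[ z ∈ C ] ind (∂ g x y xor ∂ g x z))
      ≡⟨ trans (∑-cong C λ y → ∑-*ˡ C Q _) (∑-*ˡ C Q _) ⟨
    (∑[ y ∈ C ] ∑[ z ∈ C ] (Q * ind (∂ g x y xor ∂ g x z)))
      ≤⟨ ∑-mono C (λ y → ∑-mono C λ z → ≤-trans (≤-reflexive (sym (∑-const C _)))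
           (∑-mono C λ u → ≤-trans (≤-reflexive (cong ind (∂-difference x y z u))) (ind-xor (affineFails g (x ⊕ y) z u) _))) ⟩
    (∑[ y ∈ C ] ∑[ z ∈ C ] ∑[ u ∈ C ] (ind (affineFails g (x ⊕ y) z u) + ind (affineFails g y (x ⊕ z) u)))
      ≡⟨ ∑-cong C (λ y → trans (∑-cong C λ z → ∑-+ C _ _) (∑-+ C _ _)) ⟩
    (∑[ y ∈ C ] ((∑[ z ∈ C ] ∑[ u ∈ C ] ind (affineFails g (x ⊕ y) z u)) + (∑[ z ∈ C ] ∑[ u ∈ C ] ind (affineFails g y (x ⊕ z) u))))
      ≡⟨ ∑-+ C _ _ ⟩
    (∑[ y ∈ C ] ∑[ z ∈ C ] ∑[ u ∈ C ] ind (affineFails g (x ⊕ y) z u)) + (∑[ y ∈ C ] ∑[ z ∈ C ] ∑[ u ∈ C ] ind (affineFails g y (x ⊕ z) u))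
      ≡⟨ cong₂ _+_ (∑-shiftˡ n x (λ y → ∑[ z ∈ C ] ∑[ u ∈ C ] ind (affineFails g y z u)))
                   (∑-cong C λ y → ∑-shiftˡ n x (λ z → ∑[ u ∈ C ] ind (affineFails g y z u))) ⟩
    affineErr + affineErr ≡⟨ cong (affineErr +_) (sym (+-identityʳ affineErr)) ⟩
    2 * affineErr ∎
    where open ≤-Reasoning

  -- In place of a majority vote over all `y`, this takes the vote of one point `z`, chosen by
  -- averaging so that it contradicts no more votes than an average point does.
  φ : BoolFun n
  φ x = ∂ g x (proj₁ (averaging n (λ z → ∑[ y ∈ C ] ind (∂ g x y xor ∂ g x z))))

  φErr : Vec Bool n → ℕ
  φErr x = ∑[ y ∈ C ] ind (∂ g x y xor φ x)

  module _ (affine : 2 * N * affineErr < Q * (Q * Q)) where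

    Q≢0 : NonZero Q
    Q≢0 = m^n≢0 2 (bits C)

    φErr< : ∀ x → N * φErr x < Q
    φErr< x = *-cancelˡ-< (Q * Q) _ _ (begin-strict
      Q * Q * (N * φErr x)     ≡⟨ e Q N (φErr x) ⟩
      N * (Q * (Q * φErr x))   ≤⟨ *-monoʳ-≤ N (*-monoʳ-≤ Q (proj₂ (averaging n (λ z → ∑[ y ∈ C ] ind (∂ g x y xor ∂ g x z))))) ⟩
      N * (Q * (∑[ z ∈ C ] ∑[ y ∈ C ] ind (∂ g x y xor ∂ g x z))) ≤⟨ *-monoʳ-≤ N (∂-spread x) ⟩
      N * (2 * affineErr)      ≡⟨ e₂ N affineErr ⟩
      2 * N * affineErr        <⟨ affine ⟩
      Q * (Q * Q)              ≡⟨ *-comm Q (Q * Q) ⟩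
      Q * Q * Q ∎)
      where
      open ≤-Reasoning
      e : ∀ q n x → q * q * (n * x) ≡ n * (q * (q * x))
      e = solve-∀
      e₂ : ∀ n x → n * (2 * x) ≡ 2 * n * x
      e₂ = solve-∀

    -- A statement independent of the sample has probability 0 or 1, so a probability below
    -- `16 / N ≤ 1` refutes it. The 16 is dictated by `multiplicative`: four evaluations, each wrong
    -- with probability below `4 / N`.
    certain : ∀ b → N * (Q * ind b) < 16 * Q → b ≡ false
    certain false _ = refl
    certain true  h = contradiction (<-≤-trans h (≤-trans (*-monoˡ-≤ Q 16≤N) (*-monoʳ-≤ N (≤-reflexive (sym (*-identityʳ Q)))))) (<-irrefl refl)

    -- Derivatives telescope: `∂ g (x ⊕ y) z` is `∂ g x (y ⊕ z)` plus `∂ g y z`. A failure of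
    -- additivity would therefore make one of three votes wrong at every `z`, but each is wrong for
    -- fewer than `Q / N` of them.
    additive : ∀ x y → φ (x ⊕ y) ≡ φ x xor φ y
    additive x y = xor≡false⇒≡ (φ (x ⊕ y)) (φ x xor φ y) (certain _ (begin-strict
      N * (Q * ind b)                                        ≡⟨ cong (N *_) (∑-const C _) ⟨
      N * (∑[ z ∈ C ] ind b)                                 ≤⟨ *-monoʳ-≤ N (∑-mono C bound) ⟩
      N * (∑[ z ∈ C ] (E (x ⊕ y) z + (E x (y ⊕ z) + E y z))) ≡⟨ cong (N *_) (trans (∑-+ C _ _) (cong (φErr (x ⊕ y) +_) (trans (∑-+ C _ _) (cong (_+ φErr y) (∑-shiftˡ n y (E x)))))) ⟩
      N * (φErr (x ⊕ y) + (φErr x + φErr y))                 ≡⟨ e N _ _ _ ⟩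
      N * φErr (x ⊕ y) + (N * φErr x + N * φErr y)           <⟨ +-mono-< (φErr< (x ⊕ y)) (+-mono-< (φErr< x) (φErr< y)) ⟩
      Q + (Q + Q)                                            ≤⟨ m≤m+n _ (13 * Q) ⟩
      Q + (Q + Q) + 13 * Q                                   ≡⟨ e₂ Q ⟩
      16 * Q                                                 ∎))
      where
      open ≤-Reasoning
      b = φ (x ⊕ y) xor (φ x xor φ y)
      E : Vec Bool n → Vec Bool n → ℕ
      E x z = ind (∂ g x z xor φ x)
      e : ∀ N a b c → N * (a + (b + c)) ≡ N * a + (N * b + N * c)
      e = solve-∀
      e₂ : ∀ Q → Q + (Q + Q) + 13 * Q ≡ 16 * Q
      e₂ = solve-∀
      identity : ∀ z → b ≡ (∂ g (x ⊕ y) z xor φ (x ⊕ y)) xor ((∂ g x (y ⊕ z) xor φ x) xor (∂ g y z xor φ y))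
      identity z = trans
        (solveᵇ 6 (λ p q r s t u → p :+ (q :+ r) := ((s :+ t) :+ p) :+ (((s :+ u) :+ q) :+ ((u :+ t) :+ r))) refl
          (φ (x ⊕ y)) (φ x) (φ y) (g (x ⊕ y ⊕ z)) (g z) (g (y ⊕ z)))
        (cong (λ v → (∂ g (x ⊕ y) z xor φ (x ⊕ y)) xor (((g v xor g (y ⊕ z)) xor φ x) xor (∂ g y z xor φ y))) (⊕-assoc x y z))
      bound : ∀ z → ind b ≤ E (x ⊕ y) z + (E x (y ⊕ z) + E y z)
      bound z = begin
        ind b ≡⟨ cong ind (identity z) ⟩
        _     ≤⟨ ind-xor (∂ g (x ⊕ y) z xor φ (x ⊕ y)) _ ⟩
        _     ≤⟨ +-monoʳ-≤ (E (x ⊕ y) z) (ind-xor (∂ g x (y ⊕ z) xor φ x) _) ⟩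
        _ ∎

    -- The constant is `g xor φ` at a point `y` chosen by averaging; over all `y` the disagreement
    -- turns into the wrong votes for `φ x`.
    close : ∃ λ c → N * (∑[ x ∈ C ] ind (g x xor (φ x xor c))) ≤ Q
    close = c , *-cancelˡ-≤ Q ⦃ Q≢0 ⦄ (begin
      Q * (N * (∑[ x ∈ C ] ind (g x xor (φ x xor c))))        ≡⟨ *-swap Q N _ ⟩
      N * (Q * (∑[ x ∈ C ] ind (g x xor (φ x xor c))))        ≤⟨ *-monoʳ-≤ N (proj₂ y₀) ⟩
      N * (∑[ y ∈ C ] ∑[ x ∈ C ] ind (g x xor (φ x xor (g y xor φ y)))) ≡⟨ cong (N *_) (∑-cong C λ y → trans (sym (∑-shiftʳ n y _)) (∑-cong C λ x → cong ind (identity x y))) ⟩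
      N * (∑[ y ∈ C ] ∑[ x ∈ C ] ind (∂ g x y xor φ x))       ≡⟨ cong (N *_) (∑-swap C C _) ⟩
      N * (∑[ x ∈ C ] φErr x)                                 ≡⟨ ∑-*ˡ C N φErr ⟨
      (∑[ x ∈ C ] (N * φErr x))                               ≤⟨ ∑-bound C (λ x → <⇒≤ (φErr< x)) ⟩
      Q * Q                                                   ∎)
      where
      open ≤-Reasoning
      y₀ = averaging n (λ y → ∑[ x ∈ C ] ind (g x xor (φ x xor (g y xor φ y))))
      c = g (proj₁ y₀) xor φ (proj₁ y₀)
      identity : ∀ x y → g (x ⊕ y) xor (φ (x ⊕ y) xor (g y xor φ y)) ≡ ∂ g x y xor φ x
      identity x y = trans (cong (λ v → g (x ⊕ y) xor (v xor (g y xor φ y))) (additive x y))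
        (solveᵇ 4 (λ a b c d → a :+ ((b :+ c) :+ (d :+ c)) := (a :+ d) :+ b) refl (g (x ⊕ y)) (φ x) (φ y) (g y))

    productErr = ∑[ x ∈ C ] ∑[ y ∈ C ] ∑[ u ∈ C ] ∑[ v ∈ C ] ∑[ z ∈ C ] ind (productFails g x y u v z)

    -- The deviation of `φ` from multiplicativity. Additivity of `φ` makes it a bilinear form, and a
    -- nonzero bilinear form cannot be rare.
    defect : Vec Bool n → Vec Bool n → Bool
    defect x y = (φ x ∧ φ y) xor φ (x ⋀ y)

    defect-linearˡ : ∀ x x′ y → defect (x ⊕ x′) y ≡ defect x y xor defect x′ y
    defect-linearˡ x x′ y = trans
      (cong₂ (λ a b → (a ∧ φ y) xor b) (additive x x′) (trans (cong φ (⋀-distribʳ-⊕ x x′ y)) (additive _ _)))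
      (solveᵇ 5 (λ a b c d e → ((a :+ b) :* c) :+ (d :+ e) := ((a :* c) :+ d) :+ ((b :* c) :+ e)) refl (φ x) (φ x′) (φ y) _ _)

    defect-linearʳ : ∀ x y y′ → defect x (y ⊕ y′) ≡ defect x y xor defect x y′
    defect-linearʳ x y y′ = trans
      (cong₂ (λ a b → (φ x ∧ a) xor b) (additive y y′) (trans (cong φ (⋀-distribˡ-⊕ x y y′)) (additive _ _)))
      (solveᵇ 5 (λ a b c d e → (a :* (b :+ c)) :+ (d :+ e) := ((a :* b) :+ d) :+ ((a :* c) :+ e)) refl (φ x) (φ y) (φ y′) _ _)

    defectSum = ∑[ x ∈ C ] ∑[ y ∈ C ] ind (defect x y)

    -- When all three derivatives vote as `φ` does, the defect is itself a failure of the product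
    -- test. Otherwise a wrong vote supplies the 1, unless it is hidden by a product that vanishes
    -- anyway.
    defect-bound : ∀ x y u v z → ind (defect x y) ≤
      ind (productFails g x y u v z) + (ind (∂ g x u xor φ x) + (ind (∂ g y v xor φ y) + ind (∂ g (x ⋀ y) z xor φ (x ⋀ y))))
    defect-bound x y u v z = go (∂ g x u) (∂ g y v) (∂ g (x ⋀ y) z) (φ x) (φ y) (φ (x ⋀ y))
      where
      open ≤-Reasoning
      go : ∀ a b c a′ b′ c′ → ind ((a′ ∧ b′) xor c′) ≤ ind ((a ∧ b) xor c) + (ind (a xor a′) + (ind (b xor b′) + ind (c xor c′)))
      go a b c a′ b′ c′ with ind-xor (c xor c′) ((a ∧ b) xor c)
      go true  true  c true  true  c′ | h = begin
        ind (not c′)                       ≡⟨ cong ind (solveᵇ 2 (λ c c′ → con true :+ c′ := (c :+ c′) :+ (con true :+ c)) refl c c′) ⟩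
        _                                  ≤⟨ h ⟩
        ind (c xor c′) + ind (not c)       ≡⟨ +-comm (ind (c xor c′)) _ ⟩
        ind (not c) + ind (c xor c′)       ∎
      go true  true  c true  false c′ | h = ≤-trans (ind≤1 _) (≤-trans (s≤s z≤n) (m≤n+m _ (ind (not c))))
      go true  true  c false b′    c′ | h = ≤-trans (ind≤1 _) (≤-trans (s≤s z≤n) (m≤n+m _ (ind (not c))))
      go true  false c true  true  c′ | h = ≤-trans (ind≤1 _) (≤-trans (s≤s z≤n) (m≤n+m _ (ind c)))
      go true  false c true  false c′ | h = begin
        ind c′                             ≡⟨ cong ind (solveᵇ 2 (λ c c′ → c′ := (c :+ c′) :+ c) refl c c′) ⟩
        _                                  ≤⟨ h ⟩
        ind (c xor c′) + ind c             ≡⟨ +-comm (ind (c xor c′)) _ ⟩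
        ind c + ind (c xor c′)             ∎
      go true  false c false b′    c′ | h = ≤-trans (ind≤1 _) (≤-trans (s≤s z≤n) (m≤n+m _ (ind c)))
      go false b     c true  b′    c′ | h = ≤-trans (ind≤1 _) (≤-trans (s≤s z≤n) (m≤n+m _ (ind c)))
      go false b     c false b′    c′ | h = begin
        ind c′                             ≡⟨ cong ind (solveᵇ 2 (λ c c′ → c′ := (c :+ c′) :+ c) refl c c′) ⟩
        _                                  ≤⟨ h ⟩
        ind (c xor c′) + ind c             ≡⟨ +-comm (ind (c xor c′)) _ ⟩
        ind c + ind (c xor c′)             ≤⟨ +-monoʳ-≤ (ind c) (m≤n+m _ (ind (b xor b′))) ⟩
        ind c + (ind (b xor b′) + ind (c xor c′)) ∎

    module _ (product : 2 * N * productErr < Q * (Q * (Q * (Q * Q)))) where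

      -- Of the factor 4, one unit pays for the product test and three pay for the wrong votes.
      defectSum< : N * defectSum < 4 * (Q * Q)
      defectSum< = *-cancelˡ-< (Q * (Q * Q)) _ _ (begin-strict
        Q * (Q * Q) * (N * defectSum)   ≡⟨ e N Q defectSum ⟩
        N * (Q * (Q * (Q * defectSum))) ≡⟨ cong (N *_) pull ⟩
        N * (∑[ x ∈ C ] ∑[ y ∈ C ] ∑[ u ∈ C ] ∑[ v ∈ C ] ∑[ z ∈ C ] ind (defect x y))
          ≤⟨ *-monoʳ-≤ N (∑-mono C λ x → ∑-mono C λ y → perPair x y) ⟩
        N * (∑[ x ∈ C ] ∑[ y ∈ C ] (P x y + Q * (Q * (φErr x + (φErr y + φErr (x ⋀ y))))))
          ≡⟨ cong (N *_) (trans (∑-cong C λ x → ∑-+ C _ _) (∑-+ C _ _)) ⟩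
        N * (productErr + (∑[ x ∈ C ] ∑[ y ∈ C ] (Q * (Q * (φErr x + (φErr y + φErr (x ⋀ y)))))))
          ≡⟨ *-distribˡ-+ N productErr _ ⟩
        N * productErr + N * (∑[ x ∈ C ] ∑[ y ∈ C ] (Q * (Q * (φErr x + (φErr y + φErr (x ⋀ y))))))
          ≡⟨ cong (N * productErr +_) (trans (sym (∑-*ˡ C N _)) (∑-cong C λ x → sym (∑-*ˡ C N _))) ⟩
        N * productErr + (∑[ x ∈ C ] ∑[ y ∈ C ] (N * (Q * (Q * (φErr x + (φErr y + φErr (x ⋀ y)))))))
          ≤⟨ +-monoʳ-≤ (N * productErr) (∑-bound C λ x → ∑-bound C λ y → three x y) ⟩
        N * productErr + Q * (Q * (Q * (Q * (Q + (Q + Q)))))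
          <⟨ +-monoˡ-< _ (≤-<-trans (≤-trans (m≤n+m _ (N * productErr)) (≤-reflexive (e₃ N productErr))) product) ⟩
        Q * (Q * (Q * (Q * Q))) + Q * (Q * (Q * (Q * (Q + (Q + Q)))))
          ≡⟨ e₂ Q ⟩
        Q * (Q * Q) * (4 * (Q * Q)) ∎)
        where
        open ≤-Reasoning
        P : Vec Bool n → Vec Bool n → ℕ
        P x y = ∑[ u ∈ C ] ∑[ v ∈ C ] ∑[ z ∈ C ] ind (productFails g x y u v z)
        e : ∀ N Q d → Q * (Q * Q) * (N * d) ≡ N * (Q * (Q * (Q * d)))
        e = solve-∀
        e₂ : ∀ Q → Q * (Q * (Q * (Q * Q))) + Q * (Q * (Q * (Q * (Q + (Q + Q))))) ≡ Q * (Q * Q) * (4 * (Q * Q))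
        e₂ = solve-∀
        e₃ : ∀ N p → N * p + N * p ≡ 2 * N * p
        e₃ = solve-∀
        e₄ : ∀ N Q a b c → N * (Q * (Q * (a + (b + c)))) ≡ Q * (Q * (N * a + (N * b + N * c)))
        e₄ = solve-∀
        const₃ : ∀ c → (∑[ u ∈ C ] ∑[ v ∈ C ] ∑[ z ∈ C ] c) ≡ Q * (Q * (Q * c))
        const₃ c = trans (∑-cong C λ _ → trans (∑-cong C λ _ → ∑-const C c) (∑-const C (Q * c))) (∑-const C (Q * (Q * c)))
        pull : Q * (Q * (Q * defectSum)) ≡ (∑[ x ∈ C ] ∑[ y ∈ C ] ∑[ u ∈ C ] ∑[ v ∈ C ] ∑[ z ∈ C ] ind (defect x y))
        pull = sym (trans (∑-cong C λ x → trans (∑-cong C λ y → const₃ (ind (defect x y)))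
                 (trans (∑-*ˡ C Q _) (cong (Q *_) (trans (∑-*ˡ C Q _) (cong (Q *_) (∑-*ˡ C Q _))))))
                 (trans (∑-*ˡ C Q _) (cong (Q *_) (trans (∑-*ˡ C Q _) (cong (Q *_) (∑-*ˡ C Q _))))))
        three : ∀ x y → N * (Q * (Q * (φErr x + (φErr y + φErr (x ⋀ y))))) ≤ Q * (Q * (Q + (Q + Q)))
        three x y = ≤-trans (≤-reflexive (e₄ N Q (φErr x) (φErr y) (φErr (x ⋀ y))))
          (*-monoʳ-≤ Q (*-monoʳ-≤ Q (+-mono-≤ (<⇒≤ (φErr< x)) (+-mono-≤ (<⇒≤ (φErr< y)) (<⇒≤ (φErr< (x ⋀ y)))))))
        perPair : ∀ x y → (∑[ u ∈ C ] ∑[ v ∈ C ] ∑[ z ∈ C ] ind (defect x y)) ≤ P x y + Q * (Q * (φErr x + (φErr y + φErr (x ⋀ y))))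
        perPair x y = begin
          (∑[ u ∈ C ] ∑[ v ∈ C ] ∑[ z ∈ C ] ind (defect x y))
            ≤⟨ ∑-mono C (λ u → ∑-mono C λ v → ∑-mono C λ z → defect-bound x y u v z) ⟩
          (∑[ u ∈ C ] ∑[ v ∈ C ] ∑[ z ∈ C ] (ind (productFails g x y u v z) + (a u + (b v + c z))))
            ≡⟨ ∑-cong C (λ u → trans (∑-cong C λ v → trans (∑-+ C _ _) (cong ((∑[ z ∈ C ] ind (productFails g x y u v z)) +_)
                 (trans (∑-+ C _ _) (cong₂ _+_ (∑-const C (a u)) (trans (∑-+ C _ _) (cong (_+ ∑ C c) (∑-const C (b v))))))))
               (trans (∑-+ C _ _) (cong ((∑[ v ∈ C ] ∑[ z ∈ C ] ind (productFails g x y u v z)) +_)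
                 (trans (∑-+ C _ _) (cong₂ _+_ (∑-const C (Q * a u)) (trans (∑-+ C _ _) (cong₂ _+_ (∑-*ˡ C Q b) (∑-const C (∑ C c)))))))) ) ⟩
          (∑[ u ∈ C ] ((∑[ v ∈ C ] ∑[ z ∈ C ] ind (productFails g x y u v z)) + (Q * (Q * a u) + (Q * ∑ C b + Q * ∑ C c))))
            ≡⟨ trans (∑-+ C _ _) (cong (P x y +_) (trans (∑-+ C _ _) (cong₂ _+_ (trans (∑-*ˡ C Q _) (cong (Q *_) (∑-*ˡ C Q a))) (∑-const C _)))) ⟩
          P x y + (Q * (Q * ∑ C a) + Q * (Q * ∑ C b + Q * ∑ C c))
            ≡⟨ cong (P x y +_) (e₅ Q (∑ C a) (∑ C b) (∑ C c)) ⟩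
          P x y + Q * (Q * (∑ C a + (∑ C b + ∑ C c))) ∎
          where
          a b c : Vec Bool n → ℕ
          a u = ind (∂ g x u xor φ x)
          b v = ind (∂ g y v xor φ y)
          c z = ind (∂ g (x ⋀ y) z xor φ (x ⋀ y))
          e₅ : ∀ Q a b c → Q * (Q * a) + Q * (Q * b + Q * c) ≡ Q * (Q * (a + (b + c)))
          e₅ = solve-∀

      -- A bilinear form that takes the value 1 somewhere does so on at least a quarter of all pairs.
      multiplicative : ∀ x y → φ (x ⋀ y) ≡ φ x ∧ φ y
      multiplicative x₀ y₀ = sym (xor≡false⇒≡ _ _ (certain _ (*-cancelˡ-< Q _ _ (begin-strict
        Q * (N * (Q * ind (defect x₀ y₀)))                      ≡⟨ e Q N _ ⟩
        N * (Q * (Q * ind (defect x₀ y₀)))                      ≡⟨ cong (N *_) (trans (∑-cong C λ _ → ∑-const C _) (∑-const C _)) ⟨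
        N * (∑[ x ∈ C ] ∑[ y ∈ C ] ind (defect x₀ y₀))          ≤⟨ *-monoʳ-≤ N (∑-mono C λ x → ∑-mono C λ y → four x y) ⟩
        N * (∑[ x ∈ C ] ∑[ y ∈ C ] ((d x y + d (x ⊕ x₀) y) + (d x (y ⊕ y₀) + d (x ⊕ x₀) (y ⊕ y₀)))) ≡⟨ cong (N *_) total ⟩
        N * ((defectSum + defectSum) + (defectSum + defectSum)) ≡⟨ e₂ N defectSum ⟩
        4 * (N * defectSum)                                     <⟨ *-monoʳ-< 4 defectSum< ⟩
        4 * (4 * (Q * Q))                                       ≡⟨ e₃ Q ⟩
        Q * (16 * Q)                                            ∎))))
        where
        open ≤-Reasoning
        d : Vec Bool n → Vec Bool n → ℕ
        d x y = ind (defect x y)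
        e : ∀ Q N a → Q * (N * (Q * a)) ≡ N * (Q * (Q * a))
        e = solve-∀
        e₂ : ∀ N a → N * ((a + a) + (a + a)) ≡ 4 * (N * a)
        e₂ = solve-∀
        e₃ : ∀ Q → 4 * (4 * (Q * Q)) ≡ Q * (16 * Q)
        e₃ = solve-∀
        four : ∀ x y → d x₀ y₀ ≤ (d x y + d (x ⊕ x₀) y) + (d x (y ⊕ y₀) + d (x ⊕ x₀) (y ⊕ y₀))
        four x y = begin
          d x₀ y₀ ≡⟨ cong ind (trans (solveᵇ 4 (λ a b c d → d := (a :+ (a :+ b)) :+ ((a :+ c) :+ ((a :+ c) :+ (b :+ d)))) refl
                       (defect x y) (defect x₀ y) (defect x y₀) (defect x₀ y₀))
                     (sym (cong₂ (λ p q → (defect x y xor p) xor q) (defect-linearˡ x x₀ y)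
                        (cong₂ _xor_ (defect-linearʳ x y y₀) (trans (defect-linearˡ x x₀ (y ⊕ y₀)) (cong₂ _xor_ (defect-linearʳ x y y₀) (defect-linearʳ x₀ y y₀))))))) ⟩
          ind ((defect x y xor defect (x ⊕ x₀) y) xor (defect x (y ⊕ y₀) xor defect (x ⊕ x₀) (y ⊕ y₀)))
            ≤⟨ ind-xor (defect x y xor defect (x ⊕ x₀) y) _ ⟩
          _ ≤⟨ +-mono-≤ (ind-xor (defect x y) _) (ind-xor (defect x (y ⊕ y₀)) _) ⟩
          _ ∎
        total : (∑[ x ∈ C ] ∑[ y ∈ C ] ((d x y + d (x ⊕ x₀) y) + (d x (y ⊕ y₀) + d (x ⊕ x₀) (y ⊕ y₀))))
                ≡ (defectSum + defectSum) + (defectSum + defectSum)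
        total = trans (∑-cong C λ x → trans (∑-+ C _ _) (cong₂ _+_ (∑-+ C _ _) (∑-+ C _ _)))
          (trans (∑-+ C _ _) (cong₂ _+_
            (trans (∑-+ C _ _) (cong (defectSum +_) (∑-shiftʳ n x₀ (λ x → ∑[ y ∈ C ] d x y))))
            (trans (∑-+ C _ _) (cong₂ _+_ (∑-cong C λ x → ∑-shiftʳ n y₀ (d x))
              (trans (∑-cong C λ x → ∑-shiftʳ n y₀ (d (x ⊕ x₀))) (∑-shiftʳ n x₀ (λ x → ∑[ y ∈ C ] d x y)))))))

      closeToLiteral : ∃ λ (l : Lit n) → N * (∑[ x ∈ C ] ind (g x xor evalLit l x)) ≤ Q
      closeToLiteral = toLiteral close (multiplicative⇒literal n φ additive multiplicative)
        where
        toLiteral : (∃ λ c → N * (∑[ x ∈ C ] ind (g x xor (φ x xor c))) ≤ Q) →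
                    ((∀ x → φ x ≡ false) ⊎ (∃ λ i → ∀ x → φ x ≡ lookup x i)) →
                    ∃ λ (l : Lit n) → N * (∑[ x ∈ C ] ind (g x xor evalLit l x)) ≤ Q
        toLiteral (c , h) (inj₁ zeroφ) = const c , ≤-trans (≤-reflexive (cong (N *_)
          (∑-cong C λ x → cong (λ v → ind (g x xor (v xor c))) (sym (zeroφ x))))) h
        toLiteral (c , h) (inj₂ (i , coord)) = var i c , ≤-trans (≤-reflexive (cong (N *_)
          (∑-cong C λ x → cong (λ v → ind (g x xor (v xor c))) (sym (coord x))))) h

-- The literal test

Trial : ℕ → Space
Trial n = (cube n ⊗ cube n ⊗ cube n) ⊗ (cube n ⊗ cube n ⊗ cube n ⊗ cube n ⊗ cube n)

trialPasses : ∀ {n} → BoolFun n → Pt (Trial n) → Bool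
trialPasses g ((x , y , z) , (x′ , y′ , u , v , w)) = not (affineFails g x y z ∨ productFails g x′ y′ u v w)

∑-⊗ˡ : ∀ S T F → ∑ (S ⊗ T) (λ p → F (proj₁ p)) ≡ ∥ T ∥ * ∑ S F
∑-⊗ˡ S T F = trans (∑-cong S λ a → ∑-const T (F a)) (∑-*ˡ S ∥ T ∥ F)

∑-⊗ʳ : ∀ S T F → ∑ (S ⊗ T) (λ p → F (proj₂ p)) ≡ ∥ S ∥ * ∑ T F
∑-⊗ʳ S T F = ∑-const S (∑ T F)

module _ {n} (g : BoolFun n) (N : ℕ) (16≤N : 16 ≤ N) where
  private
    open SelfCorrection g N 16≤N
    Aff = C ⊗ C ⊗ C
    Pro = C ⊗ C ⊗ C ⊗ C ⊗ C

  -- The affine and the product test have the same threshold `1 / (2 * N)`, so a single rejection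
  -- bound covers whichever error is large; if both are small, self-correction applies.
  literalTest-sound : (∃ λ (l : Lit n) → N * (∑[ x ∈ C ] ind (g x xor evalLit l x)) ≤ Q)
                      ⊎ ∥ Trial n ∥ ≤ 2 * N * ∑ (Trial n) (λ t → ind (not (trialPasses g t)))
  literalTest-sound with 2 * N * affineErr <? Q * (Q * Q)
  ... | no affine≮ = inj₂ (begin
    ∥ Trial n ∥                   ≡⟨ ∥⊗∥ Aff Pro ⟩
    ∥ Aff ∥ * ∥ Pro ∥             ≡⟨ *-comm ∥ Aff ∥ ∥ Pro ∥ ⟩
    ∥ Pro ∥ * ∥ Aff ∥             ≡⟨ cong (∥ Pro ∥ *_) (trans (∥⊗∥ C (C ⊗ C)) (cong (Q *_) (∥⊗∥ C C))) ⟩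
    ∥ Pro ∥ * (Q * (Q * Q))       ≤⟨ *-monoʳ-≤ ∥ Pro ∥ (≮⇒≥ affine≮) ⟩
    ∥ Pro ∥ * (2 * N * affineErr) ≡⟨ *-swap ∥ Pro ∥ (2 * N) affineErr ⟩
    2 * N * (∥ Pro ∥ * affineErr) ≡⟨ cong (2 * N *_) (∑-⊗ˡ Aff Pro (λ { (x , y , z) → ind (affineFails g x y z) })) ⟨
    2 * N * ∑ (Trial n) (λ t → ind (failsˡ t)) ≤⟨ *-monoʳ-≤ (2 * N) (∑-mono (Trial n) λ t → ≤-trans (ind-∨ˡ (failsˡ t) (failsʳ t)) (≤-reflexive (cong ind (sym (Boolₚ.not-involutive _))))) ⟩
    2 * N * ∑ (Trial n) (λ t → ind (not (trialPasses g t))) ∎)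
    where
    open ≤-Reasoning
    failsˡ failsʳ : Pt (Trial n) → Bool
    failsˡ ((x , y , z) , _) = affineFails g x y z
    failsʳ (_ , (x , y , u , v , w)) = productFails g x y u v w
  ... | yes affine with 2 * N * productErr affine <? Q * (Q * (Q * (Q * Q)))
  ...   | yes product = inj₁ (closeToLiteral affine product)
  ...   | no product≮ = inj₂ (begin
    ∥ Trial n ∥                   ≡⟨ ∥⊗∥ Aff Pro ⟩
    ∥ Aff ∥ * ∥ Pro ∥             ≡⟨ cong (∥ Aff ∥ *_) (trans (∥⊗∥ C (C ⊗ C ⊗ C ⊗ C)) (cong (Q *_) (trans (∥⊗∥ C (C ⊗ C ⊗ C)) (cong (Q *_) (trans (∥⊗∥ C (C ⊗ C)) (cong (Q *_) (∥⊗∥ C C))))))) ⟩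
    ∥ Aff ∥ * (Q * (Q * (Q * (Q * Q)))) ≤⟨ *-monoʳ-≤ ∥ Aff ∥ (≮⇒≥ product≮) ⟩
    ∥ Aff ∥ * (2 * N * productErr affine) ≡⟨ *-swap ∥ Aff ∥ (2 * N) (productErr affine) ⟩
    2 * N * (∥ Aff ∥ * productErr affine) ≡⟨ cong (2 * N *_) (∑-⊗ʳ Aff Pro (λ { (x , y , u , v , w) → ind (productFails g x y u v w) })) ⟨
    2 * N * ∑ (Trial n) (λ t → ind (failsʳ t)) ≤⟨ *-monoʳ-≤ (2 * N) (∑-mono (Trial n) λ t → ≤-trans (ind-∨ʳ (failsˡ t) (failsʳ t)) (≤-reflexive (cong ind (sym (Boolₚ.not-involutive _))))) ⟩
    2 * N * ∑ (Trial n) (λ t → ind (not (trialPasses g t))) ∎)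
    where
    open ≤-Reasoning
    failsˡ failsʳ : Pt (Trial n) → Bool
    failsˡ ((x , y , z) , _) = affineFails g x y z
    failsʳ (_ , (x , y , u , v , w)) = productFails g x y u v w

lookup-⊕ : ∀ {n} (x y : Vec Bool n) i → lookup (x ⊕ y) i ≡ lookup x i xor lookup y i
lookup-⊕ (a ∷ x) (b ∷ y) zero    = refl
lookup-⊕ (a ∷ x) (b ∷ y) (suc i) = lookup-⊕ x y i

lookup-⋀ : ∀ {n} (x y : Vec Bool n) i → lookup (x ⋀ y) i ≡ lookup x i ∧ lookup y i
lookup-⋀ (a ∷ x) (b ∷ y) zero    = refl
lookup-⋀ (a ∷ x) (b ∷ y) (suc i) = lookup-⋀ x y i

-- Exact literals are never rejected, so completeness spends no error probability on these trials.
literal-passes : ∀ {n} (g : BoolFun n) i s → (∀ x → g x ≡ lookup x i xor s) → ∀ t → trialPasses g t ≡ true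
literal-passes g i s lit ((x , y , z) , (x′ , y′ , u , v , w)) = cong not (cong₂ _∨_ affine product)
  where
  affine : affineFails g x y z ≡ false
  affine rewrite lit x | lit y | lit z | lit (x ⊕ (y ⊕ z)) | lookup-⊕ x (y ⊕ z) i | lookup-⊕ y z i =
    go (lookup x i) (lookup y i) (lookup z i) s
    where
    go : ∀ a b c s → (a xor s) xor (b xor s) xor (c xor s) xor ((a xor (b xor c)) xor s) ≡ false
    go = solveᵇ 4 (λ a b c s → (a :+ s) :+ ((b :+ s) :+ ((c :+ s) :+ ((a :+ (b :+ c)) :+ s))) := con false) refl
  derivative : ∀ x y → ∂ g x y ≡ lookup x i
  derivative x y rewrite lit (x ⊕ y) | lit y | lookup-⊕ x y i = go (lookup x i) (lookup y i) s
    where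
    go : ∀ a b s → ((a xor b) xor s) xor (b xor s) ≡ a
    go = solveᵇ 3 (λ a b s → ((a :+ b) :+ s) :+ (b :+ s) := a) refl
  product : productFails g x′ y′ u v w ≡ false
  product rewrite derivative x′ u | derivative y′ v | derivative (x′ ⋀ y′) w | lookup-⋀ x′ y′ i = Boolₚ.xor-same (lookup x′ i ∧ lookup y′ i)

-- Decision lists over an arbitrary index set

evalR : {I : Set} → (I → Bool) → List (I × Bool × Bool) → Bool → Bool
evalR z []               d = d
evalR z ((c , ξ , a) ∷ rs) d = if (z c xor ξ) then evalR z rs d else a

evalRules≡evalR : ∀ {n} rs d (x : Vec Bool n) → evalRules rs d x ≡ evalR (lookup x) rs d
evalRules≡evalR []               d x = refl
evalRules≡evalR ((i , ξ , a) ∷ rs) d x = cong (λ v → if (lookup x i xor ξ) then v else a) (evalRules≡evalR rs d x)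

evalR-cong : ∀ {I : Set} (z z′ : I → Bool) rs d → All (λ r → z (proj₁ r) ≡ z′ (proj₁ r)) rs → evalR z rs d ≡ evalR z′ rs d
evalR-cong z z′ []               d []       = refl
evalR-cong z z′ ((c , ξ , a) ∷ rs) d (e ∷ es) = cong₂ (λ u v → if (u xor ξ) then v else a) e (evalR-cong z z′ rs d es)

-- A rule that tests a constant either never fires and is dropped, or always fires and ends the
-- list. The sign of a literal is absorbed by the rule.
literals⇒decisionList : {I : Set} {n : ℕ} (l : I → Lit n) → ∀ rs d →
  ∃ λ (L : DecisionList n) → ∀ x → evalR (λ c → evalLit (l c) x) rs d ≡ evalDL L x
literals⇒decisionList l []               d = ([] , d) , λ x → refl
literals⇒decisionList l ((c , ξ , a) ∷ rs) d with l c | literals⇒decisionList l rs d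
... | var i s | (rs′ , d′) , h = ((i , s xor ξ , a) ∷ rs′ , d′) , λ x →
  cong₂ (λ u v → if u then v else a) (Boolₚ.xor-assoc (lookup x i) s ξ) (h x)
... | const b | (rs′ , d′) , h with b xor ξ
...   | true  = (rs′ , d′) , h
...   | false = ([] , a) , λ x → refl

-- Truncating decision lists

substitute : ∀ {n} → Fin n → Bool → List (Fin n × Bool × Bool) → Bool → DecisionList n
substitute i b [] d = [] , d
substitute i b ((j , ξ , a) ∷ rs) d with i Finₚ.≟ j
... | no  _ = (j , ξ , a) ∷ proj₁ (substitute i b rs d) , proj₂ (substitute i b rs d)
... | yes _ = if b xor ξ then substitute i b rs d else ([] , a)

substitute-eval : ∀ {n} i b rs d x → lookup x i ≡ b → evalDL {n} (substitute i b rs d) x ≡ evalRules rs d x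
substitute-eval i b [] d x e = refl
substitute-eval i b ((j , ξ , a) ∷ rs) d x e with i Finₚ.≟ j
... | no  _    = cong (λ v → if (lookup x j xor ξ) then v else a) (substitute-eval i b rs d x e)
... | yes refl rewrite e with b xor ξ
...   | true  = substitute-eval i b rs d x e
...   | false = refl

Fresh : ∀ {n} → Fin n → List (Fin n × Bool × Bool) → Set
Fresh i = All (λ r → i ≢ proj₁ r)

Distinct : ∀ {n} → List (Fin n × Bool × Bool) → Set
Distinct []       = ⊤
Distinct (r ∷ rs) = Fresh (proj₁ r) rs × Distinct rs

substitute-fresh : ∀ {n} i b rs d → Fresh {n} i (proj₁ (substitute i b rs d))
substitute-fresh i b [] d = []
substitute-fresh i b ((j , ξ , a) ∷ rs) d with i Finₚ.≟ j
... | no i≢j = i≢j ∷ substitute-fresh i b rs d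
... | yes _ with b xor ξ
...   | true  = substitute-fresh i b rs d
...   | false = []

substitute-keepsFresh : ∀ {n} i b k rs d → Fresh {n} k rs → Fresh k (proj₁ (substitute i b rs d))
substitute-keepsFresh i b k [] d [] = []
substitute-keepsFresh i b k ((j , ξ , a) ∷ rs) d (p ∷ ps) with i Finₚ.≟ j
... | no _ = p ∷ substitute-keepsFresh i b k rs d ps
... | yes _ with b xor ξ
...   | true  = substitute-keepsFresh i b k rs d ps
...   | false = []

substitute-distinct : ∀ {n} i b rs d → Distinct {n} rs → Distinct {n} (proj₁ (substitute i b rs d))
substitute-distinct i b [] d _ = tt
substitute-distinct i b ((j , ξ , a) ∷ rs) d (p , ps) with i Finₚ.≟ j
... | no _ = substitute-keepsFresh i b j rs d p , substitute-distinct i b rs d ps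
... | yes _ with b xor ξ
...   | true  = substitute-distinct i b rs d ps
...   | false = tt

-- Behind a rule on `i` the value of that variable is known to be `not ξ`, so later tests of it can
-- be resolved. Distinct variables make the tests independent in `deep-rare`.
normalise : ∀ {n} → List (Fin n × Bool × Bool) → Bool → DecisionList n
normalise []               d = [] , d
normalise ((i , ξ , a) ∷ rs) d =
  (i , ξ , a) ∷ proj₁ (substitute i (not ξ) (proj₁ (normalise rs d)) (proj₂ (normalise rs d)))
  , proj₂ (substitute i (not ξ) (proj₁ (normalise rs d)) (proj₂ (normalise rs d)))

normalise-eval : ∀ {n} rs d (x : Vec Bool n) → evalDL (normalise rs d) x ≡ evalRules rs d x
normalise-eval [] d x = refl
normalise-eval ((i , ξ , a) ∷ rs) d x with lookup x i in e | ξ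
... | true  | true  = refl
... | false | false = refl
... | true  | false = trans (substitute-eval i true (proj₁ (normalise rs d)) (proj₂ (normalise rs d)) x e) (normalise-eval rs d x)
... | false | true  = trans (substitute-eval i false (proj₁ (normalise rs d)) (proj₂ (normalise rs d)) x e) (normalise-eval rs d x)

normalise-distinct : ∀ {n} rs d → Distinct {n} (proj₁ (normalise rs d))
normalise-distinct [] d = tt
normalise-distinct ((i , ξ , a) ∷ rs) d =
  substitute-fresh i (not ξ) (proj₁ (normalise rs d)) (proj₂ (normalise rs d)) ,
  substitute-distinct i (not ξ) (proj₁ (normalise rs d)) (proj₂ (normalise rs d)) (normalise-distinct rs d)

-- The clause for the empty list means that a list with fewer than `K` rules has no exceptional
-- points: truncation does not change it.
deep : ∀ {n} → ℕ → List (Fin n × Bool × Bool) → Vec Bool n → Bool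
deep zero    rs                 x = true
deep (suc K) []                 x = false
deep (suc K) ((i , ξ , a) ∷ rs) x = (lookup x i xor ξ) ∧ deep K rs x

shallow-eval : ∀ {n} K rs d (x : Vec Bool n) → deep K rs x ≡ false → evalRules rs d x ≡ evalRules (take K rs) d x
shallow-eval (suc K) []                 d x h = refl
shallow-eval (suc K) ((i , ξ , a) ∷ rs) d x h with lookup x i xor ξ
... | true  = shallow-eval K rs d x h
... | false = refl

Agree : ∀ {n} → List (Fin n × Bool × Bool) → (x y : Vec Bool n) → Set
Agree rs x y = All (λ r → lookup x (proj₁ r) ≡ lookup y (proj₁ r)) rs

deep-cong : ∀ {n} K rs (x y : Vec Bool n) → Agree (take K rs) x y → deep K rs x ≡ deep K rs y
deep-cong zero    rs                 x y _        = refl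
deep-cong (suc K) []                 x y _        = refl
deep-cong (suc K) ((i , ξ , a) ∷ rs) x y (e ∷ es) = cong₂ (λ u v → (u xor ξ) ∧ v) e (deep-cong K rs x y es)

∑-flip : ∀ n i (F : Vec Bool n → ℕ) → ∑ (cube n) (λ x → F (updateAt x i not)) ≡ ∑ (cube n) F
∑-flip (suc n) zero    F = +-comm (∑ (cube n) (λ x → F (true ∷ x))) _
∑-flip (suc n) (suc i) F = cong₂ _+_ (∑-flip n i _) (∑-flip n i _)

fresh-agree : ∀ {n} K i rs (x : Vec Bool n) → Fresh i rs → Agree (take K rs) (updateAt x i not) x
fresh-agree zero    i rs       x _        = []
fresh-agree (suc K) i []       x _        = []
fresh-agree (suc K) i (r ∷ rs) x (p ∷ ps) = lookup∘updateAt′ (proj₁ r) i (≢-sym p) x ∷ fresh-agree K i rs x ps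

-- Flipping variable `i` reverses the first test and, since `i` is fresh, leaves the later ones
-- alone. So exactly half of the points that survive the later tests also survive the first.
deep-rare : ∀ {n} K rs → Distinct rs → 2 ^ K * (∑[ x ∈ cube n ] ind (deep K rs x)) ≤ ∥ cube n ∥
deep-rare {n} zero    rs _ = ≤-reflexive (trans (*-identityˡ (∑[ x ∈ cube n ] 1)) (∑-one (cube n)))
deep-rare {n} (suc K) [] _ = ≤-trans (≤-reflexive (trans (cong (2 ^ suc K *_) (trans (∑-const (cube n) 0) (*-zeroʳ ∥ cube n ∥))) (*-zeroʳ (2 ^ suc K)))) z≤n
deep-rare {n} (suc K) ((i , ξ , a) ∷ rs) (fresh , distinct) = begin
  2 * 2 ^ K * ∑ C (λ x → ind ((lookup x i xor ξ) ∧ deep K rs x)) ≡⟨ e (2 ^ K) _ ⟩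
  2 ^ K * (∑ C (λ x → ind ((lookup x i xor ξ) ∧ deep K rs x)) + ∑ C (λ x → ind ((lookup x i xor ξ) ∧ deep K rs x)))
    ≡⟨ cong (λ v → 2 ^ K * (∑ C (λ x → ind ((lookup x i xor ξ) ∧ deep K rs x)) + v)) (trans (sym (∑-flip n i _)) (∑-cong C λ x → cong ind (flipped x))) ⟩
  2 ^ K * (∑ C (λ x → ind ((lookup x i xor ξ) ∧ deep K rs x)) + ∑ C (λ x → ind (not (lookup x i xor ξ) ∧ deep K rs x)))
    ≡⟨ cong (2 ^ K *_) (trans (sym (∑-+ C _ _)) (∑-cong C λ x → cases (lookup x i xor ξ) (deep K rs x))) ⟩
  2 ^ K * ∑ C (λ x → ind (deep K rs x)) ≤⟨ deep-rare K rs distinct ⟩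
  ∥ C ∥ ∎
  where
  open ≤-Reasoning
  C = cube n
  e : ∀ p a → 2 * p * a ≡ p * (a + a)
  e = solve-∀
  flipped : ∀ x → (lookup (updateAt x i not) i xor ξ) ∧ deep K rs (updateAt x i not) ≡ not (lookup x i xor ξ) ∧ deep K rs x
  flipped x = cong₂ _∧_ (trans (cong (_xor ξ) (lookup∘updateAt i x)) (sym (Boolₚ.not-distribˡ-xor (lookup x i) ξ)))
                        (deep-cong K rs (updateAt x i not) x (fresh-agree K i rs x fresh))
  cases : ∀ a b → ind (a ∧ b) + ind (not a ∧ b) ≡ ind b
  cases true  b = +-identityʳ (ind b)
  cases false b = refl

-- Union bound and bucket collisions

∑-any : ∀ S {A : Set} (P : A → Pt S → Bool) c B (as : List A) →
        (∀ a → c * ∑ S (λ s → ind (P a s)) ≤ B) → c * ∑ S (λ s → ind (any (λ a → P a s) as)) ≤ length as * B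
∑-any S P c B []       h = ≤-reflexive (trans (cong (c *_) (trans (∑-const S 0) (*-zeroʳ ∥ S ∥))) (*-zeroʳ c))
∑-any S P c B (a ∷ as) h = begin
  c * ∑ S (λ s → ind (P a s ∨ any (λ a → P a s) as)) ≤⟨ *-monoʳ-≤ c (∑-mono S λ s → ind-∨ (P a s) _) ⟩
  c * ∑ S (λ s → ind (P a s) + ind (any (λ a → P a s) as)) ≡⟨ trans (cong (c *_) (∑-+ S _ _)) (*-distribˡ-+ c _ _) ⟩
  c * ∑ S (λ s → ind (P a s)) + c * ∑ S (λ s → ind (any (λ a → P a s) as)) ≤⟨ +-mono-≤ (h a) (∑-any S P c B as h) ⟩
  B + length as * B ∎
  where open ≤-Reasoning

any-false : {A : Set} (p : A → Bool) (as : List A) → any p as ≡ false → ∀ {a} → a ∈ as → p a ≡ false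
any-false p (a ∷ as) h (here refl) with p a
... | false = refl
any-false p (a ∷ as) h (there i) with p a
... | false = any-false p as h i

any-true : {A : Set} (p : A → Bool) (as : List A) → ∀ {a} → a ∈ as → p a ≡ true → any p as ≡ true
any-true p (a ∷ as) (here refl) e rewrite e = refl
any-true p (b ∷ as) (there i)   e = trans (cong (p b ∨_) (any-true p as i e)) (Boolₚ.∨-zeroʳ (p b))

Label : ℕ → Set
Label μ = Vec Bool μ

_≟ᴸ_ : ∀ {μ} (c c′ : Label μ) → Dec (c ≡ c′)
_≟ᴸ_ = ≡-dec Boolₚ._≟_

∑-≟ : ∀ μ (d : Label μ) → ∑ (cube μ) (λ c → ind (does (d ≟ᴸ c))) ≡ 1
∑-≟ zero    []          = refl
∑-≟ (suc μ) (false ∷ d) = cong₂ _+_ (∑-≟ μ d) (trans (∑-const (cube μ) 0) (*-zeroʳ ∥ cube μ ∥))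
∑-≟ (suc μ) (true ∷ d)  = cong₂ _+_ (trans (∑-const (cube μ) 0) (*-zeroʳ ∥ cube μ ∥)) (∑-≟ μ d)

-- `collision-rare` meets both orientations, and the decision is not symmetric by computation.
∑-≟′ : ∀ μ (d : Label μ) → ∑ (cube μ) (λ c → ind (does (c ≟ᴸ d))) ≡ 1
∑-≟′ zero    []          = refl
∑-≟′ (suc μ) (false ∷ d) = cong₂ _+_ (∑-≟′ μ d) (trans (∑-const (cube μ) 0) (*-zeroʳ ∥ cube μ ∥))
∑-≟′ (suc μ) (true ∷ d)  = cong₂ _+_ (trans (∑-const (cube μ) 0) (*-zeroʳ ∥ cube μ ∥)) (∑-≟′ μ d)

Buckets : ℕ → ℕ → Space
Buckets n μ = cube μ ^ˢ n

-- Once one of the two labels is fixed, exactly one value of the other hits it.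
collision-rare : ∀ {n} μ (i j : Fin n) → i ≢ j →
  ∥ cube μ ∥ * ∑ (Buckets n μ) (λ β → ind (does (lookup β i ≟ᴸ lookup β j))) ≡ ∥ Buckets n μ ∥
collision-rare μ zero    zero    i≢j = contradiction refl i≢j
collision-rare {suc n} μ zero (suc j) _ = trans (cong (∥ cube μ ∥ *_) (trans (∑-swap (cube μ) (Buckets n μ) _)
  (trans (∑-cong (Buckets n μ) λ β → ∑-≟′ μ (lookup β j)) (∑-one (Buckets n μ))))) (sym (∥^suc∥ (cube μ) n))
collision-rare {suc n} μ (suc i) zero _ = trans (cong (∥ cube μ ∥ *_) (trans (∑-swap (cube μ) (Buckets n μ) _)
  (trans (∑-cong (Buckets n μ) λ β → ∑-≟ μ (lookup β i)) (∑-one (Buckets n μ))))) (sym (∥^suc∥ (cube μ) n))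
collision-rare {suc n} μ (suc i) (suc j) i≢j = trans (cong (∥ cube μ ∥ *_) (∑-const (cube μ) _))
  (trans (cong (∥ cube μ ∥ *_) (collision-rare μ i j (i≢j ∘ cong suc))) (sym (∥^suc∥ (cube μ) n)))

collides : ∀ {n μ} → Vec (Label μ) n → Fin n → Fin n → Bool
collides β i j = not (does (i Finₚ.≟ j)) ∧ does (lookup β i ≟ᴸ lookup β j)

collides-rare : ∀ {n} μ (i j : Fin n) → ∥ cube μ ∥ * ∑ (Buckets n μ) (λ β → ind (collides β i j)) ≤ ∥ Buckets n μ ∥
collides-rare {n} μ i j with i Finₚ.≟ j
... | yes _  = ≤-trans (≤-reflexive (trans (cong (∥ cube μ ∥ *_) (trans (∑-const (Buckets n μ) 0) (*-zeroʳ ∥ Buckets n μ ∥))) (*-zeroʳ ∥ cube μ ∥))) z≤n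
... | no i≢j = ≤-reflexive (collision-rare μ i j i≢j)

anyCollides : ∀ {n μ} → List (Fin n) → Vec (Label μ) n → Bool
anyCollides vs β = any (λ i → any (λ j → collides β i j) vs) vs

anyCollides-rare : ∀ {n} μ (vs : List (Fin n)) →
  ∥ cube μ ∥ * ∑ (Buckets n μ) (λ β → ind (anyCollides vs β)) ≤ length vs * (length vs * ∥ Buckets n μ ∥)
anyCollides-rare {n} μ vs = ∑-any (Buckets n μ) (λ i β → any (λ j → collides β i j) vs) ∥ cube μ ∥ _ vs
  (λ i → ∑-any (Buckets n μ) (λ j β → collides β i j) ∥ cube μ ∥ _ vs (λ j → collides-rare μ i j))

separated : ∀ {n μ} (vs : List (Fin n)) (β : Vec (Label μ) n) → anyCollides vs β ≡ false →
            ∀ {i j} → i ∈ vs → j ∈ vs → lookup β i ≡ lookup β j → i ≡ j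
separated vs β h {i} {j} i∈ j∈ e with i Finₚ.≟ j | any-false _ vs (any-false _ vs h i∈) j∈
... | yes p | _ = p
... | no  _ | q with lookup β i ≟ᴸ lookup β j
...   | yes _ = contradiction q λ ()
...   | no ¬e = contradiction e ¬e

-- Hypotheses

length-cartesianProductWith : {A B C : Set} (f : A → B → C) (as : List A) (bs : List B) →
  length (cartesianProductWith f as bs) ≡ length as * length bs
length-cartesianProductWith f []       bs = refl
length-cartesianProductWith f (a ∷ as) bs = trans (length-++ (map (f a) bs))
  (cong₂ _+_ (length-map (f a) bs) (length-cartesianProductWith f as bs))

-- Shorter lists are included because translating a decision list into bucket readings may cut it
-- off.
listsOver : {A : Set} → List A → ℕ → List (List A)
listsOver as zero    = [] ∷ []
listsOver as (suc k) = [] ∷ cartesianProductWith _∷_ as (listsOver as k)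

length-listsOver : {A : Set} (as : List A) (k : ℕ) → length (listsOver as k) ≤ suc (length as) ^ k
length-listsOver as zero    = ≤-refl
length-listsOver as (suc k) = begin
  suc (length (cartesianProductWith _∷_ as (listsOver as k))) ≡⟨ cong suc (length-cartesianProductWith _∷_ as (listsOver as k)) ⟩
  suc (length as * length (listsOver as k)) ≤⟨ +-mono-≤ (m^n>0 (suc (length as)) k) (*-monoʳ-≤ (length as) (length-listsOver as k)) ⟩
  suc (length as) * suc (length as) ^ k ∎
  where open ≤-Reasoning

∈-listsOver : ∀ {A : Set} {as : List A} k bs → length bs ≤ k → All (_∈ as) bs → bs ∈ listsOver as k
∈-listsOver zero    []       _       _          = here refl
∈-listsOver (suc k) []       _       _          = here refl
∈-listsOver (suc k) (b ∷ bs) (s≤s l) (b∈ ∷ bs∈) = there (∈-cartesianProductWith⁺ _∷_ b∈ (∈-listsOver k bs l bs∈))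

∈-allVecs : ∀ {n} (x : Vec Bool n) → x ∈ allVecs n
∈-allVecs []                = here refl
∈-allVecs {suc n} (false ∷ x) = ∈-++⁺ˡ (∈-map⁺ (false ∷_) (∈-allVecs x))
∈-allVecs {suc n} (true ∷ x)  = ∈-++⁺ʳ (map (false ∷_) (allVecs n)) (∈-map⁺ (true ∷_) (∈-allVecs x))

length-allVecs : ∀ n → length (allVecs n) ≡ 2 ^ n
length-allVecs zero    = refl
length-allVecs (suc n) = trans (length-++ (map (false ∷_) (allVecs n)))
  (trans (cong₂ _+_ (length-map (false ∷_) (allVecs n)) (length-map (true ∷_) (allVecs n)))
         (cong₂ _+_ (length-allVecs n) (trans (length-allVecs n) (sym (+-identityʳ (2 ^ n))))))

booleans : List Bool
booleans = true ∷ false ∷ []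

∈-booleans : ∀ b → b ∈ booleans
∈-booleans true  = here refl
∈-booleans false = there (here refl)

rules : ∀ μ → List (Label μ × Bool × Bool)
rules μ = cartesianProduct (allVecs μ) (cartesianProduct booleans booleans)

-- Rules speak about labels instead of coordinates, so the size of the union bound does not depend
-- on `n`.
hypotheses : ∀ μ → ℕ → List (List (Label μ × Bool × Bool) × Bool)
hypotheses μ K = cartesianProduct (listsOver (rules μ) K) booleans

∈-hypotheses : ∀ {μ} K (rs : List (Label μ × Bool × Bool)) d → length rs ≤ K → (rs , d) ∈ hypotheses μ K
∈-hypotheses K rs d l = ∈-cartesianProduct⁺ (∈-listsOver K rs l (everyRule rs)) (∈-booleans d)
  where
  everyRule : ∀ rs → All (_∈ rules _) rs
  everyRule []                 = []
  everyRule ((c , ξ , a) ∷ rs) = ∈-cartesianProduct⁺ (∈-allVecs c) (∈-cartesianProduct⁺ (∈-booleans ξ) (∈-booleans a)) ∷ everyRule rs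

length-hypotheses : ∀ μ K → length (hypotheses μ K) ≤ suc (2 ^ μ * 4) ^ K * 2
length-hypotheses μ K = begin
  length (hypotheses μ K)             ≡⟨ length-cartesianProductWith _,_ (listsOver (rules μ) K) booleans ⟩
  length (listsOver (rules μ) K) * 2  ≤⟨ *-monoˡ-≤ 2 (length-listsOver (rules μ) K) ⟩
  suc (length (rules μ)) ^ K * 2      ≡⟨ cong (λ v → suc v ^ K * 2) (trans (length-cartesianProductWith _,_ (allVecs μ) (cartesianProduct booleans booleans)) (cong (_* 4) (length-allVecs μ))) ⟩
  suc (2 ^ μ * 4) ^ K * 2 ∎
  where open ≤-Reasoning

-- Adaptive query programs as a free monad, with evaluation and cost.

data Prog (n : ℕ) (A : Set) : Set where
  ret : A → Prog n A
  ask : Vec Bool n → (Bool → Prog n A) → Prog n A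

private variable
  n len : ℕ
  Ans Res : Set

infixl 1 _>>=_

_>>=_ : Prog n Ans → (Ans → Prog n Res) → Prog n Res
ret a   >>= k = k a
ask x h >>= k = ask x (λ b → h b >>= k)

eval : Prog n Ans → BoolFun n → Ans
eval (ret a)   f = a
eval (ask x k) f = eval (k (f x)) f

cost : Prog n Ans → ℕ
cost (ret a)   = 0
cost (ask x k) = suc (cost (k false) ⊔ cost (k true))

toTree : Prog n Bool → QTree n
toTree (ret b)   = leaf b
toTree (ask x k) = query x (λ b → toTree (k b))

run-toTree : ∀ (p : Prog n Bool) f → run (toTree p) f ≡ eval p f
run-toTree (ret b)   f = refl
run-toTree (ask x k) f = run-toTree (k (f x)) f

depth-toTree : ∀ (p : Prog n Bool) → depth (toTree p) ≡ cost p
depth-toTree (ret b)   = refl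
depth-toTree (ask x k) = cong₂ (λ a b → suc (a ⊔ b)) (depth-toTree (k false)) (depth-toTree (k true))

eval->>= : ∀ (p : Prog n Ans) (k : Ans → Prog n Res) f → eval (p >>= k) f ≡ eval (k (eval p f)) f
eval->>= (ret a)   k f = refl
eval->>= (ask x h) k f = eval->>= (h (f x)) k f

cost-ask : ∀ x (k : Bool → Prog n Ans) {a} → (∀ b → cost (k b) ≤ a) → cost (ask x k) ≤ suc a
cost-ask x k h = s≤s (⊔-lub (h false) (h true))

cost->>= : ∀ (p : Prog n Ans) (k : Ans → Prog n Res) {a b} → cost p ≤ a → (∀ x → cost (k x) ≤ b) → cost (p >>= k) ≤ a + b
cost->>= (ret v)   k {a} {b} _ h = ≤-trans (h v) (m≤n+m b a)
cost->>= (ask x q) k {suc a} (s≤s c) h = cost-ask x (λ b → q b >>= k) (λ b → cost->>= (q b) k (≤-trans (branch b) c) h)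
  where
  branch : ∀ b → cost (q b) ≤ cost (q false) ⊔ cost (q true)
  branch false = m≤m⊔n _ _
  branch true  = m≤n⊔m _ _

branches : ∀ {μ} → (Label μ → Bool) → (Label μ → Bool) → Label (suc μ) → Bool
branches l r (false ∷ c) = l c
branches l r (true ∷ c)  = r c

-- All readings are collected before any hypothesis is tried, so that going through all hypotheses
-- costs no further query.
table : ∀ μ → (Label μ → Prog n Bool) → Prog n (Label μ → Bool)
table zero    o = o [] >>= λ b → ret (λ _ → b)
table (suc μ) o = table μ (λ c → o (false ∷ c)) >>= λ l → table μ (λ c → o (true ∷ c)) >>= λ r → ret (branches l r)

eval-table : ∀ μ (o : Label μ → Prog n Bool) f c → eval (table μ o) f c ≡ eval (o c) f
eval-table zero    o f [] = cong (λ h → h []) (eval->>= (o []) (λ b → ret (λ _ → b)) f)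
eval-table (suc μ) o f (b ∷ c) = trans
  (cong (λ h → h (b ∷ c)) (trans (eval->>= (table μ (λ c → o (false ∷ c))) (λ l → table μ (λ c → o (true ∷ c)) >>= λ r → ret (branches l r)) f)
                                (eval->>= (table μ (λ c → o (true ∷ c))) (λ r → ret (branches _ r)) f)))
  (branch b)
  where
  branch : ∀ b → branches (eval (table μ (λ c → o (false ∷ c))) f) (eval (table μ (λ c → o (true ∷ c))) f) (b ∷ c) ≡ eval (o (b ∷ c)) f
  branch false = eval-table μ (λ c → o (false ∷ c)) f c
  branch true  = eval-table μ (λ c → o (true ∷ c)) f c

cost-table : ∀ μ (o : Label μ → Prog n Bool) → (∀ c → cost (o c) ≤ 1) → cost (table μ o) ≤ 2 ^ μ
cost-table zero    o h = cost->>= (o []) _ {1} {0} (h []) (λ _ → z≤n)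
cost-table (suc μ) o h = cost->>= (table μ (λ c → o (false ∷ c))) _ (cost-table μ _ (λ c → h (false ∷ c)))
  (λ l → cost->>= (table μ (λ c → o (true ∷ c))) _ (cost-table μ _ (λ c → h (true ∷ c))) (λ r → z≤n))

evalR-ext : ∀ {I : Set} (z z′ : I → Bool) rs d → (∀ c → z c ≡ z′ c) → evalR z rs d ≡ evalR z′ rs d
evalR-ext z z′ rs d h = evalR-cong z z′ rs d (universal (λ r → h (proj₁ r)) rs)

any-cong : ∀ {A : Set} {p q : A → Bool} (as : List A) → (∀ a → p a ≡ q a) → any p as ≡ any q as
any-cong []       h = refl
any-cong (a ∷ as) h = cong₂ _∨_ (h a) (any-cong as h)

-- The function under test is `λ x → f (at x)`, so each of its values costs one query to `f`.
trialProg : (Vec Bool n → Vec Bool n) → Pt (Trial n) → Prog n Bool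
trialProg at ((x , y , z) , (x′ , y′ , u , v , w)) =
  ask (at x) λ gx → ask (at y) λ gy → ask (at z) λ gz → ask (at (x ⊕ (y ⊕ z))) λ gxyz →
  ask (at (x′ ⊕ u)) λ gxu → ask (at u) λ gu → ask (at (y′ ⊕ v)) λ gyv → ask (at v) λ gv →
  ask (at (x′ ⋀ y′ ⊕ w)) λ gxyw → ask (at w) λ gw →
  ret (not ((gx xor gy xor gz xor gxyz) ∨ (((gxu xor gu) ∧ (gyv xor gv)) xor (gxyw xor gw))))

everyTrial : (Vec Bool n → Vec Bool n) → Vec (Pt (Trial n)) len → Prog n Bool
everyTrial at []       = ret true
everyTrial at (t ∷ ts) = trialProg at t >>= λ b → everyTrial at ts >>= λ bs → ret (b ∧ bs)

eval-everyTrial : ∀ at (ts : Vec (Pt (Trial n)) len) f → eval (everyTrial at ts) f ≡ allV (trialPasses (λ x → f (at x))) ts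
eval-everyTrial at []       f = refl
eval-everyTrial at (t ∷ ts) f = trans (eval->>= (trialProg at t) (λ b → everyTrial at ts >>= λ bs → ret (b ∧ bs)) f)
  (trans (eval->>= (everyTrial at ts) (λ bs → ret (_ ∧ bs)) f) (cong (trialPasses (λ x → f (at x)) t ∧_) (eval-everyTrial at ts f)))

cost-everyTrial : ∀ at (ts : Vec (Pt (Trial n)) len) → cost (everyTrial at ts) ≤ len * 10
cost-everyTrial at []       = z≤n
cost-everyTrial {len = suc len} at (t ∷ ts) = cost->>= (trialProg at t) _ {10} {len * 10} ≤-refl
  (λ b → subst (cost (everyTrial at ts >>= λ bs → ret (b ∧ bs)) ≤_) (+-identityʳ (len * 10)) (cost->>= (everyTrial at ts) _ (cost-everyTrial at ts) (λ _ → z≤n)))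

-- The tester and its query cost.

RoundSpace : (n m m₂ : ℕ) → Space
RoundSpace n m m₂ = cube n ⊗ (cube n ^ˢ m) ⊗ (Trial n ^ˢ m₂)

module Tester {n} (μ K m m₂ : ℕ) (β : Vec (Label μ) n) where

  hybrid : (Label μ → Bool) → (x w : Vec Bool n) → Vec Bool n
  hybrid S x w = tabulate λ i → if S (lookup β i) then lookup w i else lookup x i

  none : Label μ → Bool
  none _ = false

  single : Label μ → Label μ → Bool
  single b c = does (c ≟ᴸ b)

  _∪_ : (Label μ → Bool) → Label μ → Label μ → Bool
  (S ∪ b) c = S c ∨ single b c

  overwrite : Label μ → (u y : Vec Bool n) → Vec Bool n
  overwrite b = hybrid (single b)

  -- The witness u of a bucket b is such that y ↦ f (overwrite b u y) is not constant.
  State : Set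
  State = Label μ → Maybe (Vec Bool n)

  extend : State → Label μ → Vec Bool n → State
  extend G b u c = if single b c then just u else G c

  unfound : State → List (Label μ)
  unfound G = filterᵇ (λ c → is-nothing (G c)) (allVecs μ)

  walk : (x w : Vec Bool n) → List (Label μ) → (Label μ → Bool) → Bool → Prog n (Maybe (Label μ × Vec Bool n))
  walk x w []       S v = ret nothing
  walk x w (b ∷ bs) S v = ask (hybrid (S ∪ b) x w) λ v′ →
    -- The witness is the point before the change; the point after it can differ from it only in
    -- bucket `b`.
    if v xor v′ then ret (just (b , hybrid S x w)) else walk x w bs (S ∪ b) v′

  orElse : Maybe Ans → Prog n (Maybe Ans) → Prog n (Maybe Ans)
  orElse (just a) p = ret (just a)
  orElse nothing  p = p

  search : (w : Vec Bool n) → List (Label μ) → ∀ {k} → Vec (Vec Bool n) k → Prog n (Maybe (Label μ × Vec Bool n))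
  search w bs []       = ret nothing
  search w bs (x ∷ xs) = ask (hybrid none x w) (walk x w bs none) >>= λ r → orElse r (search w bs xs)

  -- An unexposed bucket reads as `false`, which is a constant literal; hence a hypothesis may
  -- mention any label.
  reading : State → BoolFun n → Vec Bool n → Label μ → Bool
  reading G f x c = maybe (λ u → f (overwrite c u x)) false (G c)

  readingProg : State → Vec Bool n → Label μ → Prog n Bool
  readingProg G x c = maybe (λ u → ask (overwrite c u x) ret) (ret false) (G c)

  readings : State → ∀ {k} → Vec (Vec Bool n) k → Prog n (Vec (Bool × (Label μ → Bool)) k)
  readings G []       = ret []
  readings G (x ∷ xs) = ask x λ v → table μ (readingProg G x) >>= λ z → readings G xs >>= λ vs → ret ((v , z) ∷ vs)

  explains : List (Label μ × Bool × Bool) × Bool → Bool × (Label μ → Bool) → Bool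
  explains (rs , d) (v , z) = not (v xor evalR z rs d)

  -- The check reuses the points `xs` of the search: these are the points for which the walks have
  -- just compared `f x` with the value at the endpoint. Fresh points would come without that
  -- knowledge.
  afterSearch : State → Vec (Vec Bool n) m → Vec (Pt (Trial n)) m₂ → (State → Prog n Bool) → Maybe (Label μ × Vec Bool n) → Prog n Bool
  afterSearch G xs ys k nothing        = readings G xs >>= λ vs → ret (any (λ H → allV (explains H) vs) (hypotheses μ K))
  afterSearch G xs ys k (just (b , u)) = everyTrial (overwrite b u) ys >>= λ ok → if ok then k (extend G b u) else ret false

  Round : Space
  Round = RoundSpace n m m₂

  tester : ∀ {t} → State → Vec (Pt Round) t → Prog n Bool
  -- Running out of rounds can only follow an atypical event if `f` is a decision list: every
  -- earlier round exposes a new bucket, and there will be one round more than there are buckets.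
  tester G []                  = ret false
  tester G ((w , xs , ys) ∷ ρ) = search w (unfound G) xs >>= afterSearch G xs ys (λ G′ → tester G′ ρ)

  consistent : State → BoolFun n → ∀ {k} → Vec (Vec Bool n) k → List (Label μ × Bool × Bool) × Bool → Bool
  consistent G f xs H = allV (λ x → explains H (f x , reading G f x)) xs

  eval-readings : ∀ G {k} (xs : Vec (Vec Bool n) k) f H → allV (explains H) (eval (readings G xs) f) ≡ consistent G f xs H
  eval-readings G []       f H = refl
  eval-readings G (x ∷ xs) f H = trans
    (cong (allV (explains H)) (trans (eval->>= (table μ (readingProg G x)) _ f) (eval->>= (readings G xs) _ f)))
    (cong₂ (λ a b → not (f x xor a) ∧ b) (evalR-ext _ _ (proj₁ H) (proj₂ H) pointwise) (eval-readings G xs f H))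
    where
    pointwise : ∀ c → eval (table μ (readingProg G x)) f c ≡ reading G f x c
    pointwise c with eval-table μ (readingProg G x) f c
    ... | e with G c
    ...   | just u  = e
    ...   | nothing = e

  find : BoolFun n → State → Vec Bool n → ∀ {k} → Vec (Vec Bool n) k → Maybe (Label μ × Vec Bool n)
  find f G w xs = eval (search w (unfound G) xs) f

  accepts : BoolFun n → ∀ {t} → State → Vec (Pt Round) t → Bool
  accepts f G ρ = eval (tester G ρ) f

  accepts-nothing : ∀ f {t} G w xs ys (ρ : Vec (Pt Round) t) → find f G w xs ≡ nothing →
    accepts f G ((w , xs , ys) ∷ ρ) ≡ any (consistent G f xs) (hypotheses μ K)
  accepts-nothing f G w xs ys ρ e = begin
    accepts f G ((w , xs , ys) ∷ ρ)
      ≡⟨ eval->>= (search w (unfound G) xs) _ f ⟩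
    eval (afterSearch G xs ys (λ G′ → tester G′ ρ) (find f G w xs)) f
      ≡⟨ cong (λ r → eval (afterSearch G xs ys (λ G′ → tester G′ ρ) r) f) e ⟩
    eval (readings G xs >>= λ vs → ret (any (λ H → allV (explains H) vs) (hypotheses μ K))) f
      ≡⟨ eval->>= (readings G xs) _ f ⟩
    any (λ H → allV (explains H) (eval (readings G xs) f)) (hypotheses μ K)
      ≡⟨ any-cong (hypotheses μ K) (eval-readings G xs f) ⟩
    any (consistent G f xs) (hypotheses μ K) ∎
    where open ≡-Reasoning

  accepts-just : ∀ f {t} G w xs ys (ρ : Vec (Pt Round) t) b u → find f G w xs ≡ just (b , u) →
    accepts f G ((w , xs , ys) ∷ ρ) ≡ allV (trialPasses (λ y → f (overwrite b u y))) ys ∧ accepts f (extend G b u) ρ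
  accepts-just f G w xs ys ρ b u e = begin
    accepts f G ((w , xs , ys) ∷ ρ)
      ≡⟨ eval->>= (search w (unfound G) xs) _ f ⟩
    eval (afterSearch G xs ys (λ G′ → tester G′ ρ) (find f G w xs)) f
      ≡⟨ cong (λ r → eval (afterSearch G xs ys (λ G′ → tester G′ ρ) r) f) e ⟩
    eval (everyTrial (overwrite b u) ys >>= λ ok → if ok then tester (extend G b u) ρ else ret false) f
      ≡⟨ eval->>= (everyTrial (overwrite b u) ys) _ f ⟩
    eval (if eval (everyTrial (overwrite b u) ys) f then tester (extend G b u) ρ else ret false) f
      ≡⟨ cong (λ v → eval (if v then tester (extend G b u) ρ else ret false) f) (eval-everyTrial (overwrite b u) ys f) ⟩
    eval (if allV (trialPasses (λ y → f (overwrite b u y))) ys then tester (extend G b u) ρ else ret false) f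
      ≡⟨ push (allV (trialPasses (λ y → f (overwrite b u y))) ys) ⟩
    allV (trialPasses (λ y → f (overwrite b u y))) ys ∧ accepts f (extend G b u) ρ ∎
    where
    open ≡-Reasoning
    push : ∀ v → eval (if v then tester (extend G b u) ρ else ret false) f ≡ v ∧ accepts f (extend G b u) ρ
    push true  = refl
    push false = refl

  M : ℕ
  M = 2 ^ μ

  cost-walk : ∀ x w bs S v → cost (walk x w bs S v) ≤ length bs
  cost-walk x w []       S v = z≤n
  cost-walk x w (b ∷ bs) S v = cost-ask (hybrid (S ∪ b) x w) _ λ v′ → branch v′ (v xor v′)
    where
    branch : ∀ v′ q → cost (if q then ret (just (b , hybrid S x w)) else walk x w bs (S ∪ b) v′) ≤ length bs
    branch v′ true  = z≤n
    branch v′ false = cost-walk x w bs (S ∪ b) v′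

  cost-search : ∀ w bs {k} (xs : Vec (Vec Bool n) k) → cost (search w bs xs) ≤ k * suc (length bs)
  cost-search w bs []       = z≤n
  cost-search w bs (x ∷ xs) = cost->>= (ask (hybrid none x w) (walk x w bs none)) _
    (cost-ask (hybrid none x w) _ (cost-walk x w bs none))
    λ { (just _) → z≤n ; nothing → cost-search w bs xs }

  cost-readings : ∀ G {k} (xs : Vec (Vec Bool n) k) → cost (readings G xs) ≤ k * suc M
  cost-readings G []               = z≤n
  cost-readings G {suc k} (x ∷ xs) = cost-ask x _ λ v → cost->>= (table μ (readingProg G x)) _
    (cost-table μ (readingProg G x) one)
    λ z → subst (cost (readings G xs >>= λ vs → ret ((v , z) ∷ vs)) ≤_) (+-identityʳ (k * suc M)) (cost->>= (readings G xs) _ (cost-readings G xs) (λ _ → z≤n))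
    where
    one : ∀ c → cost (readingProg G x c) ≤ 1
    one c with G c
    ... | just u  = ≤-refl
    ... | nothing = z≤n

  roundCost : ℕ
  roundCost = m * suc M + (m * suc M + m₂ * 10)

  cost-tester : ∀ {t} G (ρ : Vec (Pt Round) t) → cost (tester G ρ) ≤ t * roundCost
  cost-tester G [] = z≤n
  cost-tester {suc t} G ((w , xs , ys) ∷ ρ) = begin
    cost (tester G ((w , xs , ys) ∷ ρ)) ≤⟨ cost->>= (search w (unfound G) xs) _ searchCost after ⟩
    m * suc M + (m * suc M + m₂ * 10 + t * roundCost) ≡⟨ +-assoc (m * suc M) (m * suc M + m₂ * 10) (t * roundCost) ⟨
    roundCost + t * roundCost ∎
    where
    open ≤-Reasoning
    searchCost : cost (search w (unfound G) xs) ≤ m * suc M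
    searchCost = ≤-trans (cost-search w (unfound G) xs)
      (*-monoʳ-≤ m (s≤s (≤-trans (length-filter (λ c → Boolₚ.T? (is-nothing (G c))) (allVecs μ)) (≤-reflexive (length-allVecs μ)))))
    after : ∀ r → cost (afterSearch G xs ys (λ G′ → tester G′ ρ) r) ≤ m * suc M + m₂ * 10 + t * roundCost
    after nothing = ≤-trans (cost->>= (readings G xs) _ {b = 0} (cost-readings G xs) (λ _ → z≤n))
      (+-mono-≤ (m≤m+n (m * suc M) (m₂ * 10)) z≤n)
    after (just (b , u)) = ≤-trans (cost->>= (everyTrial (overwrite b u) ys) _ (cost-everyTrial (overwrite b u) ys)
        (λ { true → cost-tester (extend G b u) ρ ; false → z≤n }))
      (+-monoˡ-≤ (t * roundCost) (m≤n+m (m₂ * 10) (m * suc M)))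

-- Soundness: functions far from every decision list.

ind-∧ʳ : ∀ a b → ind (a ∧ b) ≤ ind b
ind-∧ʳ true  b = ≤-refl
ind-∧ʳ false b = z≤n

module Soundness {n} (μ K T j d D N : ℕ) (β : Vec (Label μ) n) (f : BoolFun n)
  .{{_ : NonZero T}} .{{_ : NonZero N}}
  (16≤N : 16 ≤ N) (N≡ : N ≡ 2 * T * 2 ^ μ)
  (hypothesesFew : D * length (hypotheses μ K) ≤ 2 ^ j) (D≤2^d : D ≤ 2 ^ d)
  (far : ∀ L → ∥ cube n ∥ ≤ T * (∑[ x ∈ cube n ] ind (f x xor evalDL L x))) where

  open Tester {n} μ K (2 * T * j) (2 * N * d) β

  private
    C = cube n
    Q = ∥ C ∥
    X = ∥ C ^ˢ (2 * T * j) ∥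
    Y = ∥ Trial n ^ˢ (2 * N * d) ∥
    instance
      2T≢0 : NonZero (2 * T)
      2T≢0 = m*n≢0 2 T
      2N≢0 : NonZero (2 * N)
      2N≢0 = m*n≢0 2 N
      M≢0 : NonZero M
      M≢0 = m^n≢0 2 μ
      2^j≢0 : NonZero (2 ^ j)
      2^j≢0 = m^n≢0 2 j

  Sound : State → Set
  Sound G = ∀ c → ∃ λ (l : Lit n) → N * (∑[ x ∈ C ] ind (reading G f x c xor evalLit l x)) ≤ Q

  -- Replacing all readings by their literals changes a hypothesis on at most half of the distance from f to the nearest
  -- decision list.
  unexplained : ∀ G → Sound G → ∀ H → Q ≤ 2 * T * (∑[ x ∈ C ] ind (not (explains H (f x , reading G f x))))
  unexplained G sound H@(rs , dflt) = +-cancelʳ-≤ Q _ _ (begin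
    Q + Q                                                  ≡⟨ e₁ Q ⟩
    2 * Q                                                  ≤⟨ *-monoʳ-≤ 2 (far L) ⟩
    2 * (T * (∑[ x ∈ C ] ind (f x xor evalDL L x)))        ≡⟨ *-assoc 2 T _ ⟨
    2 * T * (∑[ x ∈ C ] ind (f x xor evalDL L x))          ≤⟨ *-monoʳ-≤ (2 * T) (∑-mono C triangle) ⟩
    2 * T * (∑[ x ∈ C ] (ind (f x xor F x) + ind (differ x))) ≡⟨ trans (cong (2 * T *_) (∑-+ C _ _)) (*-distribˡ-+ (2 * T) _ _) ⟩
    2 * T * (∑[ x ∈ C ] ind (f x xor F x)) + 2 * T * (∑[ x ∈ C ] ind (differ x)) ≤⟨ +-monoʳ-≤ _ differRare ⟩
    2 * T * (∑[ x ∈ C ] ind (f x xor F x)) + Q             ≡⟨ cong (λ v → 2 * T * v + Q) (∑-cong C λ x → cong ind (sym (Boolₚ.not-involutive _))) ⟩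
    2 * T * (∑[ x ∈ C ] ind (not (explains H (f x , reading G f x)))) + Q ∎)
    where
    open ≤-Reasoning
    e₁ : ∀ q → q + q ≡ 2 * q
    e₁ = solve-∀
    l : Label μ → Lit n
    l c = proj₁ (sound c)
    L = proj₁ (literals⇒decisionList l rs dflt)
    F : BoolFun n
    F x = evalR (reading G f x) rs dflt
    mistaken : Label μ → Vec Bool n → Bool
    mistaken c x = reading G f x c xor evalLit (l c) x
    differ : Vec Bool n → Bool
    differ x = any (λ c → mistaken c x) (allVecs μ)
    triangle : ∀ x → ind (f x xor evalDL L x) ≤ ind (f x xor F x) + ind (differ x)
    triangle x with differ x in eq
    ... | true  = ≤-trans (ind≤1 (f x xor evalDL L x)) (m≤n+m 1 _)
    ... | false = ≤-trans (≤-reflexive (cong (λ v → ind (f x xor v)) (trans (sym (proj₂ (literals⇒decisionList l rs dflt) x))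
                    (evalR-ext _ _ rs dflt λ c → sym (xor≡false⇒≡ _ _ (any-false (λ c → mistaken c x) (allVecs μ) eq (∈-allVecs c)))))))
                    (m≤m+n _ 0)
    -- A union bound over all `M` labels, hence valid for every hypothesis at once:
    -- `M / N = 1 / (2 * T)`.
    differRare : 2 * T * (∑[ x ∈ C ] ind (differ x)) ≤ Q
    differRare = *-cancelʳ-≤ _ _ M (begin
      2 * T * (∑[ x ∈ C ] ind (differ x)) * M ≡⟨ e (2 * T) _ M ⟩
      2 * T * M * (∑[ x ∈ C ] ind (differ x)) ≡⟨ cong (_* (∑[ x ∈ C ] ind (differ x))) (sym N≡) ⟩
      N * (∑[ x ∈ C ] ind (differ x))         ≤⟨ ∑-any C mistaken N Q (allVecs μ) (λ c → proj₂ (sound c)) ⟩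
      length (allVecs μ) * Q                  ≡⟨ cong (_* Q) (length-allVecs μ) ⟩
      M * Q                                   ≡⟨ *-comm M Q ⟩
      Q * M                                   ∎)
      where
      e : ∀ a b c → a * b * c ≡ a * c * b
      e = solve-∀

  -- The state stems from earlier rounds, so `xs` is independent of it. A fixed hypothesis errs with
  -- probability at least `1 / (2 * T)` on each sample and survives all of them with probability at
  -- most `1 / 2 ^ j`; `hypothesesFew` keeps the sum below `1 / D`.
  consistentRare : ∀ G → Sound G → D * ∑ (C ^ˢ (2 * T * j)) (λ xs → ind (any (consistent G f xs) (hypotheses μ K))) ≤ X
  consistentRare G sound = *-cancelˡ-≤ (2 ^ j) (begin
    2 ^ j * (D * S)                    ≡⟨ *-swap (2 ^ j) D S ⟩
    D * (2 ^ j * S)                    ≤⟨ *-monoʳ-≤ D (∑-any (C ^ˢ (2 * T * j)) (λ H xs → consistent G f xs H) (2 ^ j) X (hypotheses μ K)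
                                            (λ H → amplify C (λ x → explains H (f x , reading G f x)) (2 * T) j (unexplained G sound H))) ⟩
    D * (length (hypotheses μ K) * X)  ≡⟨ *-assoc D _ X ⟨
    D * length (hypotheses μ K) * X    ≤⟨ *-monoˡ-≤ X hypothesesFew ⟩
    2 ^ j * X                          ∎)
    where
    open ≤-Reasoning
    S = ∑ (C ^ˢ (2 * T * j)) (λ xs → ind (any (consistent G f xs) (hypotheses μ K)))

  extend-sound : ∀ G → Sound G → ∀ b u →
    (∃ λ (l : Lit n) → N * (∑[ x ∈ C ] ind (f (overwrite b u x) xor evalLit l x)) ≤ Q) → Sound (extend G b u)
  extend-sound G sound b u close c with c ≟ᴸ b
  ... | yes refl = close
  ... | no _     = sound c

  -- A round can go wrong in two ways, each of probability at most `1 / D`: a function far from all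
  -- literals survives its trials, or some hypothesis fits by chance.
  tester-sound : ∀ t G → Sound G → D * ∑ (Round ^ˢ t) (λ ρ → ind (accepts f G ρ)) ≤ 2 * t * ∥ Round ^ˢ t ∥
  tester-sound zero    G sound = ≤-reflexive (*-zeroʳ D)
  tester-sound (suc t) G sound = begin
    D * (∑[ w ∈ C ] ∑[ xs ∈ XS ] inner w xs)
      ≡⟨ trans (sym (∑-*ˡ C D _)) (∑-cong C λ w → sym (∑-*ˡ XS D _)) ⟩
    (∑[ w ∈ C ] ∑[ xs ∈ XS ] (D * inner w xs))
      ≤⟨ ∑-mono C (λ w → ∑-mono XS λ xs → perSample w xs (find f G w xs) refl) ⟩
    (∑[ w ∈ C ] ∑[ xs ∈ XS ] (Y * R * (D * cons xs + (1 + 2 * t))))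
      ≡⟨ ∑-const C _ ⟩
    Q * (∑[ xs ∈ XS ] (Y * R * (D * cons xs + (1 + 2 * t))))
      ≡⟨ cong (Q *_) (trans (∑-*ˡ XS (Y * R) _) (cong (Y * R *_) (trans (∑-+ XS _ _) (cong₂ _+_ (∑-*ˡ XS D cons) (∑-const XS (1 + 2 * t)))))) ⟩
    Q * (Y * R * (D * ∑ XS cons + X * (1 + 2 * t)))
      ≤⟨ *-monoʳ-≤ Q (*-monoʳ-≤ (Y * R) (+-monoˡ-≤ (X * (1 + 2 * t)) (consistentRare G sound))) ⟩
    Q * (Y * R * (X + X * (1 + 2 * t)))
      ≡⟨ e Q X Y R t ⟩
    2 * suc t * (Q * (X * Y) * R)
      ≡⟨ cong (2 * suc t *_) (sym (trans (∥^suc∥ Round t) (cong (_* R) (trans (∥⊗∥ C (XS ⊗ YS)) (cong (Q *_) (∥⊗∥ XS YS)))))) ⟩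
    2 * suc t * ∥ Round ^ˢ suc t ∥ ∎
    where
    open ≤-Reasoning
    XS = C ^ˢ (2 * T * j)
    YS = Trial n ^ˢ (2 * N * d)
    R = ∥ Round ^ˢ t ∥
    inner : Vec Bool n → Pt XS → ℕ
    inner w xs = ∑[ ys ∈ YS ] ∑[ ρ ∈ Round ^ˢ t ] ind (accepts f G ((w , xs , ys) ∷ ρ))
    cons : Pt XS → ℕ
    cons xs = ind (any (consistent G f xs) (hypotheses μ K))
    e : ∀ Q X Y R t → Q * (Y * R * (X + X * (1 + 2 * t))) ≡ 2 * (1 + t) * (Q * (X * Y) * R)
    e = solve-∀
    -- Charging both kinds of failure to every sample avoids conditioning on what the search
    -- returns.
    perSample : ∀ w xs r → find f G w xs ≡ r → D * inner w xs ≤ Y * R * (D * cons xs + (1 + 2 * t))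
    perSample w xs nothing eq = begin
      D * inner w xs                        ≡⟨ cong (D *_) (∑-cong YS λ ys → ∑-cong (Round ^ˢ t) λ ρ → cong ind (accepts-nothing f G w xs ys ρ eq)) ⟩
      D * (∑[ ys ∈ YS ] ∑[ ρ ∈ Round ^ˢ t ] cons xs) ≡⟨ cong (D *_) (trans (∑-cong YS λ _ → ∑-const (Round ^ˢ t) _) (∑-const YS _)) ⟩
      D * (Y * (R * cons xs))               ≡⟨ e₁ D Y R (cons xs) ⟩
      Y * R * (D * cons xs)                 ≤⟨ *-monoʳ-≤ (Y * R) (m≤m+n (D * cons xs) (1 + 2 * t)) ⟩
      Y * R * (D * cons xs + (1 + 2 * t))   ∎
      where
      e₁ : ∀ D Y R c → D * (Y * (R * c)) ≡ Y * R * (D * c)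
      e₁ = solve-∀
    perSample w xs (just (b , u)) eq = ≤-trans
      (*-monoʳ-≤ D (≤-reflexive (∑-cong YS λ ys → ∑-cong (Round ^ˢ t) λ ρ → cong ind (accepts-just f G w xs ys ρ b u eq))))
      (perWitness (literalTest-sound g N 16≤N))
      where
      g : BoolFun n
      g y = f (overwrite b u y)
      inner′ = ∑[ ys ∈ YS ] ∑[ ρ ∈ Round ^ˢ t ] ind (allV (trialPasses g) ys ∧ accepts f (extend G b u) ρ)
      -- The witness is determined by `w` and `xs`, so the trials `ys` are independent of the
      -- function `g` that they examine.
      perWitness : (∃ λ (l : Lit n) → N * (∑[ x ∈ C ] ind (g x xor evalLit l x)) ≤ Q)
                   ⊎ ∥ Trial n ∥ ≤ 2 * N * ∑ (Trial n) (λ t → ind (not (trialPasses g t))) →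
                   D * inner′ ≤ Y * R * (D * cons xs + (1 + 2 * t))
      perWitness (inj₁ close) = begin
        D * inner′ ≤⟨ *-monoʳ-≤ D (∑-mono YS λ ys → ∑-mono (Round ^ˢ t) λ ρ → ind-∧ʳ (allV (trialPasses g) ys) (accepts f (extend G b u) ρ)) ⟩
        D * (∑[ ys ∈ YS ] ∑[ ρ ∈ Round ^ˢ t ] ind (accepts f (extend G b u) ρ)) ≡⟨ cong (D *_) (∑-const YS _) ⟩
        D * (Y * (∑[ ρ ∈ Round ^ˢ t ] ind (accepts f (extend G b u) ρ))) ≡⟨ *-swap D Y _ ⟩
        Y * (D * (∑[ ρ ∈ Round ^ˢ t ] ind (accepts f (extend G b u) ρ))) ≤⟨ *-monoʳ-≤ Y (tester-sound t (extend G b u) (extend-sound G sound b u close)) ⟩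
        Y * (2 * t * R)                       ≡⟨ e₂ Y t R ⟩
        Y * R * (2 * t)                       ≤⟨ *-monoʳ-≤ (Y * R) (m≤n+m (2 * t) (D * cons xs + 1)) ⟩
        Y * R * (D * cons xs + 1 + 2 * t)     ≡⟨ cong (Y * R *_) (+-assoc (D * cons xs) 1 (2 * t)) ⟩
        Y * R * (D * cons xs + (1 + 2 * t))   ∎
        where
        e₂ : ∀ Y t R → Y * (2 * t * R) ≡ Y * R * (2 * t)
        e₂ = solve-∀
      perWitness (inj₂ rejects) = begin
        D * inner′ ≤⟨ *-monoʳ-≤ D (∑-mono YS λ ys → ∑-mono (Round ^ˢ t) λ ρ → ind-∧ˡ (allV (trialPasses g) ys) (accepts f (extend G b u) ρ)) ⟩
        D * (∑[ ys ∈ YS ] ∑[ ρ ∈ Round ^ˢ t ] ind (allV (trialPasses g) ys)) ≡⟨ cong (D *_) (trans (∑-cong YS λ _ → ∑-const (Round ^ˢ t) _) (∑-*ˡ YS R _)) ⟩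
        D * (R * (∑[ ys ∈ YS ] ind (allV (trialPasses g) ys))) ≡⟨ *-swap D R _ ⟩
        R * (D * (∑[ ys ∈ YS ] ind (allV (trialPasses g) ys))) ≤⟨ *-monoʳ-≤ R (*-monoˡ-≤ _ D≤2^d) ⟩
        R * (2 ^ d * (∑[ ys ∈ YS ] ind (allV (trialPasses g) ys))) ≤⟨ *-monoʳ-≤ R (amplify (Trial n) (trialPasses g) (2 * N) d rejects) ⟩
        R * Y                                 ≡⟨ e₂ R Y ⟩
        Y * R * 1                             ≤⟨ *-monoʳ-≤ (Y * R) (≤-trans (s≤s z≤n) (m≤n+m (1 + 2 * t) (D * cons xs))) ⟩
        Y * R * (D * cons xs + (1 + 2 * t))   ∎
        where
        ind-∧ˡ : ∀ a b → ind (a ∧ b) ≤ ind a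
        ind-∧ˡ true  b = ind≤1 b
        ind-∧ˡ false b = z≤n
        e₂ : ∀ R Y → R * Y ≡ Y * R * 1
        e₂ = solve-∀

  empty-sound : Sound (λ _ → nothing)
  empty-sound c = const false , ≤-trans (≤-reflexive (trans (cong (N *_) (trans (∑-const C 0) (*-zeroʳ Q))) (*-zeroʳ N))) z≤n

-- Completeness: decision lists are accepted.

-- Each coordinate of the mixture comes from exactly one of two independent uniform points, so the
-- mixture is uniform. This holds for every point of a walk, although the walks share `w`.
∑-mix : ∀ n (S : Fin n → Bool) F →
  ∑[ w ∈ cube n ] ∑[ x ∈ cube n ] F (tabulate λ i → if S i then lookup w i else lookup x i) ≡ ∥ cube n ∥ * ∑ (cube n) F
∑-mix zero    S F = sym (*-identityˡ (F []))
∑-mix (suc n) S F with S zero | ∑-mix n (λ i → S (suc i)) (λ x → F (false ∷ x)) | ∑-mix n (λ i → S (suc i)) (λ x → F (true ∷ x))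
... | true | e₀ | e₁ = trans (cong₂ _+_ (trans (∑-+ (cube n) _ _) (cong₂ _+_ e₀ e₀)) (trans (∑-+ (cube n) _ _) (cong₂ _+_ e₁ e₁)))
                             (e ∥ cube n ∥ _ _)
  where
  e : ∀ q a b → (q * a + q * a) + (q * b + q * b) ≡ 2 * q * (a + b)
  e = solve-∀
... | false | e₀ | e₁ = trans (cong₂ _+_ (trans (∑-+ (cube n) _ _) (cong₂ _+_ e₀ e₁)) (trans (∑-+ (cube n) _ _) (cong₂ _+_ e₀ e₁)))
                             (e ∥ cube n ∥ _ _)
  where
  e : ∀ q a b → (q * a + q * b) + (q * a + q * b) ≡ 2 * q * (a + b)
  e = solve-∀

filterᵇ-mono : {A : Set} (p p′ : A → Bool) (cs : List A) → (∀ c → p′ c ≡ true → p c ≡ true) →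
  length (filterᵇ p′ cs) ≤ length (filterᵇ p cs)
filterᵇ-mono p p′ []       h = z≤n
filterᵇ-mono p p′ (c ∷ cs) h with p′ c in e′ | p c in e
... | true  | true  = s≤s (filterᵇ-mono p p′ cs h)
... | true  | false = contradiction (trans (sym e) (h c e′)) λ ()
... | false | true  = m≤n⇒m≤1+n (filterᵇ-mono p p′ cs h)
... | false | false = filterᵇ-mono p p′ cs h

filterᵇ-strict : {A : Set} (p p′ : A → Bool) (cs : List A) → (∀ c → p′ c ≡ true → p c ≡ true) →
  ∀ {b} → b ∈ cs → p b ≡ true → p′ b ≡ false → length (filterᵇ p′ cs) < length (filterᵇ p cs)
filterᵇ-strict p p′ (c ∷ cs) h (here refl) e e′ rewrite e | e′ = s≤s (filterᵇ-mono p p′ cs h)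
filterᵇ-strict p p′ (c ∷ cs) h (there b∈) eb eb′ with p′ c in e′ | p c in e
... | true  | true  = s≤s (filterᵇ-strict p p′ cs h b∈ eb eb′)
... | true  | false = contradiction (trans (sym e) (h c e′)) λ ()
... | false | true  = m≤n⇒m≤1+n (filterᵇ-strict p p′ cs h b∈ eb eb′)
... | false | false = filterᵇ-strict p p′ cs h b∈ eb eb′

module Completeness {n} (μ K m m₂ D : ℕ) (β : Vec (Label μ) n)
  (rs : List (Fin n × Bool × Bool)) (dflt : Bool) (distinct : Distinct rs)
  (f : BoolFun n) (f≡ : ∀ x → f x ≡ evalRules rs dflt x)
  (sep : ∀ {i j} → i ∈ map proj₁ (take K rs) → j ∈ map proj₁ (take K rs) → lookup β i ≡ lookup β j → i ≡ j)
  (fewQueries : D * (m * suc (2 ^ μ)) ≤ 2 ^ K) where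

  open Tester {n} μ K m m₂ β

  private
    C = cube n
    Q = ∥ C ∥
    X = ∥ C ^ˢ m ∥
    Y = ∥ Trial n ^ˢ m₂ ∥
    P = take K rs
    vs = map proj₁ P

  bad : Vec Bool n → Bool
  bad = deep K rs

  shallow : ∀ x → bad x ≡ false → f x ≡ evalRules P dflt x
  shallow x h = trans (f≡ x) (shallow-eval K rs dflt x h)

  -- Only `x` is assumed shallow: depth is decided by the first `K` variables, so `y` is shallow
  -- too.
  agree : ∀ x y → bad x ≡ false → Agree P x y → f y ≡ f x
  agree x y h a = begin
    f y                        ≡⟨ shallow y (trans (sym (deep-cong K rs x y a)) h) ⟩
    evalRules P dflt y         ≡⟨ evalRules≡evalR P dflt y ⟩
    evalR (lookup y) P dflt    ≡⟨ evalR-cong (lookup x) (lookup y) P dflt a ⟨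
    evalR (lookup x) P dflt    ≡⟨ evalRules≡evalR P dflt x ⟨
    evalRules P dflt x         ≡⟨ shallow x h ⟨
    f x                        ∎
    where open ≡-Reasoning

  lookup-hybrid : ∀ S x w i → lookup (hybrid S x w) i ≡ (if S (lookup β i) then lookup w i else lookup x i)
  lookup-hybrid S x w i = lookup∘tabulate _ i

  agreeOn : ∀ x y → (∀ i → i ∈ vs → lookup x i ≡ lookup y i) → Agree P x y
  agreeOn x y h = ListAll.tabulate λ r∈ → h _ (∈-map⁺ proj₁ r∈)

  LiteralAt : Label μ → Vec Bool n → Set
  LiteralAt b u = ∃ λ i → ∃ λ s → i ∈ vs × lookup β i ≡ b × (∀ y → f (overwrite b u y) ≡ lookup y i xor s)

  -- The bucket of a flip contains exactly one of the first K variables, and both ends of the flip are shallow.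
  flip-literal : ∀ x w S b → bad (hybrid S x w) ≡ false → bad (hybrid (S ∪ b) x w) ≡ false →
    f (hybrid S x w) ≢ f (hybrid (S ∪ b) x w) → LiteralAt b (hybrid S x w)
  flip-literal x w S b good good′ flips = pick (_∈?_ _≟ᴸ_ b (map (lookup β) vs))
    where
    p  = hybrid S x w
    p′ = hybrid (S ∪ b) x w
    outside : ∀ i → lookup β i ≢ b → lookup p i ≡ lookup p′ i
    outside i i∉b = trans (lookup-hybrid S x w i) (trans (cong (λ v → if v then lookup w i else lookup x i) same) (sym (lookup-hybrid (S ∪ b) x w i)))
      where
      same : S (lookup β i) ≡ (S ∪ b) (lookup β i)
      same with lookup β i ≟ᴸ b
      ... | yes e = contradiction e i∉b
      ... | no  _ = sym (Boolₚ.∨-identityʳ _)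
    pick : Dec (b ∈ map (lookup β) vs) → LiteralAt b p
    pick (no b∉) = contradiction (sym (agree p p′ good (agreeOn p p′ λ i i∈ → outside i λ e → b∉ (subst (_∈ map (lookup β) vs) e (∈-map⁺ (lookup β) i∈))))) flips
    pick (yes b∈) with ∈-map⁻ (lookup β) b∈
    -- The sign is forced by the case `y = p`, in which overwriting changes nothing.
    ... | i , i∈ , refl = i , lookup p i xor f p , i∈ , refl , literal
      where
      only : ∀ k → k ∈ vs → k ≢ i → lookup β k ≢ lookup β i
      only k k∈ k≢i e = k≢i (sep k∈ i∈ e)
      p≢p′ : lookup p i ≢ lookup p′ i
      p≢p′ e = flips (sym (agree p p′ good (agreeOn p p′ everywhere)))
        where
        everywhere : ∀ k → k ∈ vs → lookup p k ≡ lookup p′ k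
        everywhere k k∈ with k Finₚ.≟ i
        ... | yes refl = e
        ... | no k≢i   = outside k (only k k∈ k≢i)
      module _ (y : Vec Bool n) where
        q = overwrite (lookup β i) p y
        q≡ : ∀ z → (∀ k → k ∈ vs → k ≢ i → lookup p k ≡ lookup z k) → lookup y i ≡ lookup z i → ∀ k → k ∈ vs → lookup z k ≡ lookup q k
        q≡ z h e k k∈ = trans (at k k∈) (sym (lookup-hybrid (single (lookup β i)) p y k))
          where
          at : ∀ k → k ∈ vs → lookup z k ≡ (if single (lookup β i) (lookup β k) then lookup y k else lookup p k)
          at k k∈ with lookup β k ≟ᴸ lookup β i
          ... | yes e′ with sep k∈ i∈ e′
          ...   | refl = sym e
          at k k∈ | no ¬e = sym (h k k∈ λ { refl → ¬e refl })
        -- Among the first `K` variables, `p` and `p′` differ at `i` only. So there `q` agrees with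
        -- `p` or with `p′`, according to its value at `i`, and `y` itself need not be typical.
        literal : f q ≡ lookup y i xor (lookup p i xor f p)
        literal with lookup y i Boolₚ.≟ lookup p i
        ... | yes e = trans (agree p q good (agreeOn p q (q≡ p (λ _ _ _ → refl) e)))
              (trans (solveᵇ 2 (λ a b → b := a :+ (a :+ b)) refl (lookup p i) (f p)) (cong (λ v → v xor (lookup p i xor f p)) (sym e)))
        ... | no ¬e = trans (agree p′ q good′ (agreeOn p′ q (q≡ p′ (λ k k∈ k≢i → outside k (only k k∈ k≢i)) (other (lookup y i) (lookup p i) (lookup p′ i) ¬e p≢p′))))
              (flipped (lookup y i) (lookup p i) (f p) (f p′) ¬e flips)
          where
          other : ∀ (a b c : Bool) → a ≢ b → b ≢ c → a ≡ c
          other true  true  c     h _ = contradiction refl h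
          other true  false true  _ _ = refl
          other true  false false _ h = contradiction refl h
          other false true  true  _ h = contradiction refl h
          other false true  false _ _ = refl
          other false false c     h _ = contradiction refl h
          flipped : ∀ (a b c d : Bool) → a ≢ b → c ≢ d → d ≡ a xor (b xor c)
          flipped true  true  _     _     h _ = contradiction refl h
          flipped false false _     _     h _ = contradiction refl h
          flipped true  false true  true  _ h = contradiction refl h
          flipped true  false true  false _ _ = refl
          flipped true  false false true  _ _ = refl
          flipped true  false false false _ h = contradiction refl h
          flipped false true  true  true  _ h = contradiction refl h
          flipped false true  true  false _ _ = refl
          flipped false true  false true  _ _ = refl
          flipped false true  false false _ h = contradiction refl h

  -- The event covers the whole walk, also the points beyond a change of `f`. It thus does not
  -- depend on where the walk stops, and each of its points is a mixture with a fixed set of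
  -- buckets.
  walkBad : (x w : Vec Bool n) → List (Label μ) → (Label μ → Bool) → Bool
  walkBad x w []       S = bad (hybrid S x w)
  walkBad x w (b ∷ bs) S = bad (hybrid S x w) ∨ walkBad x w bs (S ∪ b)

  searchBad : (w : Vec Bool n) → List (Label μ) → ∀ {k} → Vec (Vec Bool n) k → Bool
  searchBad w bs []       = false
  searchBad w bs (x ∷ xs) = walkBad x w bs none ∨ searchBad w bs xs

  walkBad-head : ∀ x w bs S → walkBad x w bs S ≡ false → bad (hybrid S x w) ≡ false
  walkBad-head x w []       S h = h
  walkBad-head x w (b ∷ bs) S h with bad (hybrid S x w)
  ... | false = refl

  Unchanged : (w : Vec Bool n) → List (Label μ) → (Label μ → Bool) → Vec Bool n → Set
  Unchanged w bs S x = f (hybrid S x w) ≡ f (hybrid (foldl _∪_ S bs) x w) × bad (hybrid (foldl _∪_ S bs) x w) ≡ false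

  Outcome : Set → List (Label μ) → Maybe (Label μ × Vec Bool n) → Set
  Outcome U bs nothing        = U
  Outcome U bs (just (b , u)) = b ∈ bs × LiteralAt b u

  walk-outcome : ∀ x w bs S → walkBad x w bs S ≡ false → Outcome (Unchanged w bs S x) bs (eval (walk x w bs S (f (hybrid S x w))) f)
  walk-outcome x w []       S h = refl , h
  walk-outcome x w (b ∷ bs) S h with bad (hybrid S x w) in good
  ... | false with f (hybrid S x w) Boolₚ.≟ f (hybrid (S ∪ b) x w)
  ...   | no flips = subst (λ v → Outcome (Unchanged w (b ∷ bs) S x) (b ∷ bs) (eval (if v then ret (just (b , hybrid S x w)) else walk x w bs (S ∪ b) (f (hybrid (S ∪ b) x w))) f))
                       (sym (xor-≢ _ _ flips)) (here refl , flip-literal x w S b good (walkBad-head x w bs (S ∪ b) h) flips)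
    where
    xor-≢ : ∀ a b → a ≢ b → a xor b ≡ true
    xor-≢ true  true  h = contradiction refl h
    xor-≢ true  false h = refl
    xor-≢ false true  h = refl
    xor-≢ false false h = contradiction refl h
  ...   | yes same = subst (λ v → Outcome (Unchanged w (b ∷ bs) S x) (b ∷ bs) (eval (if v then ret (just (b , hybrid S x w)) else walk x w bs (S ∪ b) (f (hybrid (S ∪ b) x w))) f))
                       (sym (trans (cong (_xor f (hybrid (S ∪ b) x w)) same) (Boolₚ.xor-same (f (hybrid (S ∪ b) x w))))) (step _ (walk-outcome x w bs (S ∪ b) h))
    where
    step : ∀ r → Outcome (Unchanged w bs (S ∪ b) x) bs r → Outcome (Unchanged w (b ∷ bs) S x) (b ∷ bs) r
    step nothing  (e , g)   = trans same e , g
    step (just _) (b∈ , ℓ) = there b∈ , ℓ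

  search-outcome : ∀ w bs {k} (xs : Vec (Vec Bool n) k) → searchBad w bs xs ≡ false →
    Outcome (VecAll.All (Unchanged w bs none) xs) bs (eval (search w bs xs) f)
  search-outcome w bs []       h = VecAll.[]
  search-outcome w bs (x ∷ xs) h = subst (Outcome _ bs) (sym (eval->>= (ask (hybrid none x w) (walk x w bs none)) (λ r → orElse r (search w bs xs)) f))
    (combine (eval (walk x w bs none (f (hybrid none x w))) f) (walk-outcome x w bs none (proj₁ (split _ _ h))))
    where
    split : ∀ a b → a ∨ b ≡ false → a ≡ false × b ≡ false
    split false false _ = refl , refl
    combine : ∀ r → Outcome (Unchanged w bs none x) bs r → Outcome (VecAll.All (Unchanged w bs none) (x ∷ xs)) bs (eval (orElse r (search w bs xs)) f)
    combine (just _) o = o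
    combine nothing  o with eval (search w bs xs) f | search-outcome w bs xs (proj₂ (split (walkBad x w bs none) _ h))
    ... | nothing | os = o VecAll.∷ os
    ... | just _  | os = os

  Good : State → Set
  Good G = ∀ c u → G c ≡ just u → LiteralAt c u

  any-single-filterᵇ : ∀ p c cs → any (λ b → single b c) (filterᵇ p cs) ≡ p c ∧ any (λ b → single b c) cs
  any-single-filterᵇ p c []       = sym (Boolₚ.∧-zeroʳ (p c))
  any-single-filterᵇ p c (b ∷ cs) with p b in e
  ... | true with c ≟ᴸ b
  ...   | yes refl = sym (trans (Boolₚ.∧-identityʳ (p c)) e)
  ...   | no _     = any-single-filterᵇ p c cs
  any-single-filterᵇ p c (b ∷ cs) | false with c ≟ᴸ b
  ...   | yes refl = trans (any-single-filterᵇ p c cs) (trans (cong (_∧ any (λ b → single b c) cs) e) (sym (cong (_∧ true) e)))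
  ...   | no _     = any-single-filterᵇ p c cs

  foldl-∪ : ∀ bs S c → foldl _∪_ S bs c ≡ S c ∨ any (λ b → single b c) bs
  foldl-∪ []       S c = sym (Boolₚ.∨-identityʳ (S c))
  foldl-∪ (b ∷ bs) S c = trans (foldl-∪ bs (S ∪ b) c) (Boolₚ.∨-assoc (S c) (single b c) _)

  single-refl : ∀ c → single c c ≡ true
  single-refl c with c ≟ᴸ c
  ... | yes _ = refl
  ... | no ¬e = contradiction refl ¬e

  foldl-unfound : ∀ G c → foldl _∪_ none (unfound G) c ≡ is-nothing (G c)
  foldl-unfound G c = trans (foldl-∪ (unfound G) none c) (trans (any-single-filterᵇ (λ c → is-nothing (G c)) c (allVecs μ))
    (trans (cong (is-nothing (G c) ∧_) (any-true (λ b → single b c) (allVecs μ) (∈-allVecs c) (single-refl c))) (Boolₚ.∧-identityʳ _)))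

  -- At the endpoint a variable in an exposed bucket still has its value from `x`, which the reading
  -- gives up to a sign that moves into the rule. Any other variable has its value from `w`, so its
  -- rule disappears or cuts the list off. The result serves all `x` because `w` is common to them.
  translate : ∀ G → Good G → ∀ w R → All (λ r → proj₁ r ∈ vs) R →
    ∃ λ (H : List (Label μ × Bool × Bool) × Bool) → length (proj₁ H) ≤ length R ×
      (∀ x → evalRules R dflt (hybrid (foldl _∪_ none (unfound G)) x w) ≡ evalR (reading G f x) (proj₁ H) (proj₂ H))
  translate G good w []                [] = ([] , dflt) , z≤n , λ x → refl
  translate G good w ((i , ξ , a) ∷ R) (i∈ ∷ R∈) with G (lookup β i) in Gi | translate G good w R R∈
  ... | just u | (R′ , d′) , le , h with good (lookup β i) u Gi
  -- The exposed literal reads some variable `k` of this bucket; separation identifies it with the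
  -- variable that the rule tests.
  ...   | k , s , k∈ , e , lit with sep k∈ i∈ e
  ...     | refl = ((lookup β i , s xor ξ , a) ∷ R′ , d′) , s≤s le , λ x → cong₂ (λ t v → if t then v else a) (test x) (h x)
    where
    test : ∀ x → lookup (hybrid (foldl _∪_ none (unfound G)) x w) i xor ξ ≡ reading G f x (lookup β i) xor (s xor ξ)
    test x = begin
      lookup (hybrid (foldl _∪_ none (unfound G)) x w) i xor ξ
        ≡⟨ cong (_xor ξ) (trans (lookup-hybrid (foldl _∪_ none (unfound G)) x w i) (cong (λ v → if v then lookup w i else lookup x i) (trans (foldl-unfound G (lookup β i)) (cong is-nothing Gi)))) ⟩
      lookup x i xor ξ
        ≡⟨ solveᵇ 3 (λ x ξ s → x :+ ξ := (x :+ s) :+ (s :+ ξ)) refl (lookup x i) ξ s ⟩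
      (lookup x i xor s) xor (s xor ξ)
        ≡⟨ cong (_xor (s xor ξ)) (trans (sym (lit x)) (sym (cong (maybe (λ u → f (overwrite (lookup β i) u x)) false) Gi))) ⟩
      reading G f x (lookup β i) xor (s xor ξ) ∎
      where open ≡-Reasoning
  translate G good w ((i , ξ , a) ∷ R) (i∈ ∷ R∈) | nothing | (R′ , d′) , le , h =
    (proj₁ H′ , proj₁ (proj₂ H′)) , proj₁ (proj₂ (proj₂ H′)) , λ x → trans (cong (λ v → if v xor ξ then _ else a) (fixed x)) (proj₂ (proj₂ (proj₂ H′)) x)
    where
    fixed : ∀ x → lookup (hybrid (foldl _∪_ none (unfound G)) x w) i ≡ lookup w i
    fixed x = trans (lookup-hybrid (foldl _∪_ none (unfound G)) x w i) (cong (λ v → if v then lookup w i else lookup x i) (trans (foldl-unfound G (lookup β i)) (cong is-nothing Gi)))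
    H′ : Σ (List (Label μ × Bool × Bool)) λ R″ → Σ Bool λ d″ → length R″ ≤ suc (length R) ×
         (∀ x → (if lookup w i xor ξ then evalRules R dflt (hybrid (foldl _∪_ none (unfound G)) x w) else a) ≡ evalR (reading G f x) R″ d″)
    H′ with lookup w i xor ξ
    ... | true  = R′ , d′ , m≤n⇒m≤1+n le , h
    ... | false = [] , a , z≤n , λ x → refl

  consistent-hypothesis : ∀ G → Good G → ∀ w {k} (xs : Vec (Vec Bool n) k) → VecAll.All (Unchanged w (unfound G) none) xs →
    any (consistent G f xs) (hypotheses μ K) ≡ true
  consistent-hypothesis G good w xs unchanged with translate G good w P (ListAll.tabulate λ r∈ → ∈-map⁺ proj₁ r∈)
  ... | H , le , h = any-true (consistent G f xs) (hypotheses μ K) (∈-hypotheses K (proj₁ H) (proj₂ H) (≤-trans le (≤-trans (≤-reflexive (length-take K rs)) (m⊓n≤m K _)))) (every xs unchanged)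
    where
    explained : ∀ x → Unchanged w (unfound G) none x → explains H (f x , reading G f x) ≡ true
    explained x (e , shallowEnd) = cong not (trans (cong (_xor evalR (reading G f x) (proj₁ H) (proj₂ H))
      (trans (cong f (sym (tabulate∘lookup x))) (trans e (trans (shallow _ shallowEnd) (h x))))) (Boolₚ.xor-same (evalR (reading G f x) (proj₁ H) (proj₂ H))))
    every : ∀ {k} (xs : Vec (Vec Bool n) k) → VecAll.All (Unchanged w (unfound G) none) xs → consistent G f xs H ≡ true
    every []       VecAll.[]       = refl
    every (x ∷ xs) (u VecAll.∷ us) = cong₂ _∧_ (explained x u) (every xs us)

  extend-good : ∀ G → Good G → ∀ b u → LiteralAt b u → Good (extend G b u)
  extend-good G good b u ℓ c v e with c ≟ᴸ b
  extend-good G good b u ℓ c v refl | yes refl = ℓ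
  ... | no _     = good c v e

  -- This is the measure that bounds the number of rounds.
  extend-unfound : ∀ G b u → b ∈ unfound G → length (unfound (extend G b u)) < length (unfound G)
  extend-unfound G b u b∈ = filterᵇ-strict (λ c → is-nothing (G c)) (λ c → is-nothing (extend G b u c)) (allVecs μ) mono
    (∈-allVecs b) (Equivalence.to Boolₚ.T-≡ (proj₂ (∈-filter⁻ (λ c → Boolₚ.T? (is-nothing (G c))) {xs = allVecs μ} b∈))) found
    where
    found : is-nothing (extend G b u b) ≡ false
    found rewrite single-refl b = refl
    mono : ∀ c → is-nothing (extend G b u c) ≡ true → is-nothing (G c) ≡ true
    mono c h with single b c
    ... | false = h

  bad-hybrid-rare : ∀ S → 2 ^ K * (∑[ w ∈ C ] ∑[ x ∈ C ] ind (bad (hybrid S x w))) ≤ Q * Q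
  bad-hybrid-rare S = begin
    2 ^ K * (∑[ w ∈ C ] ∑[ x ∈ C ] ind (bad (hybrid S x w))) ≡⟨ cong (2 ^ K *_) (∑-mix n (λ i → S (lookup β i)) (λ x → ind (bad x))) ⟩
    2 ^ K * (Q * (∑[ x ∈ C ] ind (bad x)))                   ≡⟨ *-swap (2 ^ K) Q _ ⟩
    Q * (2 ^ K * (∑[ x ∈ C ] ind (bad x)))                   ≤⟨ *-monoʳ-≤ Q (deep-rare K rs distinct) ⟩
    Q * Q ∎
    where
    open ≤-Reasoning

  walkBad-rare : ∀ bs S → 2 ^ K * (∑[ w ∈ C ] ∑[ x ∈ C ] ind (walkBad x w bs S)) ≤ suc (length bs) * (Q * Q)
  walkBad-rare []       S = ≤-trans (bad-hybrid-rare S) (m≤m+n (Q * Q) 0)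
  walkBad-rare (b ∷ bs) S = begin
    2 ^ K * (∑[ w ∈ C ] ∑[ x ∈ C ] ind (bad (hybrid S x w) ∨ walkBad x w bs (S ∪ b)))
      ≤⟨ *-monoʳ-≤ (2 ^ K) (∑-mono C λ w → ∑-mono C λ x → ind-∨ (bad (hybrid S x w)) (walkBad x w bs (S ∪ b))) ⟩
    2 ^ K * (∑[ w ∈ C ] ∑[ x ∈ C ] (ind (bad (hybrid S x w)) + ind (walkBad x w bs (S ∪ b))))
      ≡⟨ trans (cong (2 ^ K *_) (trans (∑-cong C λ w → ∑-+ C _ _) (∑-+ C _ _))) (*-distribˡ-+ (2 ^ K) _ _) ⟩
    2 ^ K * (∑[ w ∈ C ] ∑[ x ∈ C ] ind (bad (hybrid S x w))) + 2 ^ K * (∑[ w ∈ C ] ∑[ x ∈ C ] ind (walkBad x w bs (S ∪ b)))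
      ≤⟨ +-mono-≤ (bad-hybrid-rare S) (walkBad-rare bs (S ∪ b)) ⟩
    Q * Q + suc (length bs) * (Q * Q) ∎
    where open ≤-Reasoning

  -- There are `k` walks of `length bs + 1` points each; a union bound is indifferent to the
  -- dependence caused by the common `w`.
  searchBad-rare : ∀ bs k → 2 ^ K * (∑[ w ∈ C ] ∑[ xs ∈ C ^ˢ k ] ind (searchBad w bs xs)) ≤ k * suc (length bs) * (Q * ∥ C ^ˢ k ∥)
  searchBad-rare bs zero    = ≤-reflexive (trans (cong (2 ^ K *_) (trans (∑-const C 0) (*-zeroʳ Q))) (*-zeroʳ (2 ^ K)))
  searchBad-rare bs (suc k) = begin
    2 ^ K * (∑[ w ∈ C ] ∑[ x ∈ C ] ∑[ xs ∈ C ^ˢ k ] ind (walkBad x w bs none ∨ searchBad w bs xs))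
      ≤⟨ *-monoʳ-≤ (2 ^ K) (∑-mono C λ w → ∑-mono C λ x → ∑-mono (C ^ˢ k) λ xs → ind-∨ (walkBad x w bs none) (searchBad w bs xs)) ⟩
    2 ^ K * (∑[ w ∈ C ] ∑[ x ∈ C ] ∑[ xs ∈ C ^ˢ k ] (ind (walkBad x w bs none) + ind (searchBad w bs xs)))
      ≡⟨ cong (2 ^ K *_) (∑-cong C λ w → trans (∑-cong C λ x → trans (∑-+ (C ^ˢ k) _ _) (cong (_+ sb w) (∑-const (C ^ˢ k) _)))
           (trans (∑-+ C _ _) (cong₂ _+_ (∑-*ˡ C X′ _) (∑-const C (sb w))))) ⟩
    2 ^ K * (∑[ w ∈ C ] (X′ * (∑[ x ∈ C ] ind (walkBad x w bs none)) + Q * sb w))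
      ≡⟨ cong (2 ^ K *_) (trans (∑-+ C _ _) (cong₂ _+_ (∑-*ˡ C X′ _) (∑-*ˡ C Q sb))) ⟩
    2 ^ K * (X′ * (∑[ w ∈ C ] ∑[ x ∈ C ] ind (walkBad x w bs none)) + Q * ∑ C sb)
      ≡⟨ e (2 ^ K) X′ _ Q (∑ C sb) ⟩
    X′ * (2 ^ K * (∑[ w ∈ C ] ∑[ x ∈ C ] ind (walkBad x w bs none))) + Q * (2 ^ K * ∑ C sb)
      ≤⟨ +-mono-≤ (*-monoʳ-≤ X′ (walkBad-rare bs none)) (*-monoʳ-≤ Q (searchBad-rare bs k)) ⟩
    X′ * (suc (length bs) * (Q * Q)) + Q * (k * suc (length bs) * (Q * X′))
      ≡⟨ e₂ X′ (suc (length bs)) Q k ⟩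
    suc k * suc (length bs) * (Q * (Q * X′))
      ≡⟨ cong (λ v → suc k * suc (length bs) * (Q * v)) (sym (∥^suc∥ C k)) ⟩
    suc k * suc (length bs) * (Q * ∥ C ^ˢ suc k ∥) ∎
    where
    open ≤-Reasoning
    X′ = ∥ C ^ˢ k ∥
    sb : Vec Bool n → ℕ
    sb w = ∑[ xs ∈ C ^ˢ k ] ind (searchBad w bs xs)
    e : ∀ p x a q b → p * (x * a + q * b) ≡ x * (p * a) + q * (p * b)
    e = solve-∀
    e₂ : ∀ x l q k → x * (l * (q * q)) + q * (k * l * (q * x)) ≡ (1 + k) * l * (q * (q * x))
    e₂ = solve-∀

  unfound≤M : ∀ G → length (unfound G) ≤ M
  unfound≤M G = ≤-trans (length-filter (λ c → Boolₚ.T? (is-nothing (G c))) (allVecs μ)) (≤-reflexive (length-allVecs μ))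

  roundBad-rare : ∀ G → D * (∑[ w ∈ C ] ∑[ xs ∈ C ^ˢ m ] ind (searchBad w (unfound G) xs)) ≤ Q * X
  roundBad-rare G = *-cancelˡ-≤ (2 ^ K) ⦃ m^n≢0 2 K ⦄ (begin
    2 ^ K * (D * s)                              ≡⟨ *-swap (2 ^ K) D s ⟩
    D * (2 ^ K * s)                              ≤⟨ *-monoʳ-≤ D (searchBad-rare (unfound G) m) ⟩
    D * (m * suc (length (unfound G)) * (Q * X)) ≤⟨ *-monoʳ-≤ D (*-monoˡ-≤ (Q * X) (*-monoʳ-≤ m (s≤s (unfound≤M G)))) ⟩
    D * (m * suc M * (Q * X))                    ≡⟨ *-assoc D (m * suc M) (Q * X) ⟨
    D * (m * suc M) * (Q * X)                    ≤⟨ *-monoˡ-≤ (Q * X) fewQueries ⟩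
    2 ^ K * (Q * X)                              ∎)
    where
    open ≤-Reasoning
    s = ∑[ w ∈ C ] ∑[ xs ∈ C ^ˢ m ] ind (searchBad w (unfound G) xs)

  -- A round errs only through a deep point on one of its walks, with probability at most `1 / D`.
  -- Otherwise it either accepts or exposes a bucket, which preserves the bound on `unfound` for the
  -- remaining rounds.
  tester-complete : ∀ t G → Good G → length (unfound G) < t →
    D * ∑ (Round ^ˢ t) (λ ρ → ind (not (accepts f G ρ))) ≤ t * ∥ Round ^ˢ t ∥
  tester-complete (suc t) G good fuel = begin
    D * (∑[ w ∈ C ] ∑[ xs ∈ XS ] inner w xs)
      ≡⟨ trans (sym (∑-*ˡ C D _)) (∑-cong C λ w → sym (∑-*ˡ XS D _)) ⟩
    (∑[ w ∈ C ] ∑[ xs ∈ XS ] (D * inner w xs))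
      ≤⟨ ∑-mono C (λ w → ∑-mono XS λ xs → perSample w xs) ⟩
    (∑[ w ∈ C ] ∑[ xs ∈ XS ] (Y * R * (D * sb w xs + t)))
      ≡⟨ trans (∑-cong C λ w → ∑-*ˡ XS (Y * R) _) (∑-*ˡ C (Y * R) _) ⟩
    Y * R * (∑[ w ∈ C ] ∑[ xs ∈ XS ] (D * sb w xs + t))
      ≡⟨ cong (Y * R *_) (trans (∑-cong C λ w → trans (∑-+ XS _ _) (cong₂ _+_ (∑-*ˡ XS D _) (∑-const XS t)))
                         (trans (∑-+ C _ _) (cong₂ _+_ (∑-*ˡ C D _) (∑-const C (X * t))))) ⟩
    Y * R * (D * (∑[ w ∈ C ] ∑[ xs ∈ XS ] sb w xs) + Q * (X * t))
      ≤⟨ *-monoʳ-≤ (Y * R) (+-monoˡ-≤ (Q * (X * t)) (roundBad-rare G)) ⟩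
    Y * R * (Q * X + Q * (X * t))
      ≡⟨ e Q X Y R t ⟩
    suc t * (Q * (X * Y) * R)
      ≡⟨ cong (suc t *_) (sym (trans (∥^suc∥ Round t) (cong (_* R) (trans (∥⊗∥ C (XS ⊗ YS)) (cong (Q *_) (∥⊗∥ XS YS)))))) ⟩
    suc t * ∥ Round ^ˢ suc t ∥ ∎
    where
    open ≤-Reasoning
    XS = C ^ˢ m
    YS = Trial n ^ˢ m₂
    R = ∥ Round ^ˢ t ∥
    inner : Vec Bool n → Pt XS → ℕ
    inner w xs = ∑[ ys ∈ YS ] ∑[ ρ ∈ Round ^ˢ t ] ind (not (accepts f G ((w , xs , ys) ∷ ρ)))
    sb : Vec Bool n → Pt XS → ℕ
    sb w xs = ind (searchBad w (unfound G) xs)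
    e : ∀ Q X Y R t → Y * R * (Q * X + Q * (X * t)) ≡ (1 + t) * (Q * (X * Y) * R)
    e = solve-∀
    zero-sum : ∑[ ys ∈ YS ] ∑[ ρ ∈ Round ^ˢ t ] 0 ≡ 0
    zero-sum = trans (∑-cong YS λ _ → trans (∑-const (Round ^ˢ t) 0) (*-zeroʳ R)) (trans (∑-const YS 0) (*-zeroʳ Y))
    perOutcome : ∀ w xs r → find f G w xs ≡ r → Outcome (VecAll.All (Unchanged w (unfound G) none) xs) (unfound G) r → D * inner w xs ≤ Y * R * t
    perOutcome w xs nothing eq unchanged = ≤-trans (≤-reflexive (trans (cong (D *_)
      (trans (∑-cong YS λ ys → ∑-cong (Round ^ˢ t) λ ρ → cong (λ v → ind (not v)) (trans (accepts-nothing f G w xs ys ρ eq) (consistent-hypothesis G good w xs unchanged))) zero-sum)) (*-zeroʳ D))) z≤n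
    perOutcome w xs (just (b , u)) eq (b∈ , ℓ@(i , s , _ , _ , lit)) = begin
      D * inner w xs
        ≡⟨ cong (D *_) (∑-cong YS λ ys → ∑-cong (Round ^ˢ t) λ ρ → cong (λ v → ind (not v)) (trans (accepts-just f G w xs ys ρ b u eq) (cong (_∧ accepts f (extend G b u) ρ) (allPass ys)))) ⟩
      D * (∑[ ys ∈ YS ] ∑[ ρ ∈ Round ^ˢ t ] ind (not (accepts f (extend G b u) ρ))) ≡⟨ cong (D *_) (∑-const YS _) ⟩
      D * (Y * (∑[ ρ ∈ Round ^ˢ t ] ind (not (accepts f (extend G b u) ρ)))) ≡⟨ *-swap D Y _ ⟩
      Y * (D * (∑[ ρ ∈ Round ^ˢ t ] ind (not (accepts f (extend G b u) ρ))))
        ≤⟨ *-monoʳ-≤ Y (tester-complete t (extend G b u) (extend-good G good b u ℓ) (<-≤-trans (extend-unfound G b u b∈) (≤-pred fuel))) ⟩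
      Y * (t * R) ≡⟨ e₂ Y t R ⟩
      Y * R * t ∎
      where
      e₂ : ∀ a b c → a * (b * c) ≡ a * c * b
      e₂ = solve-∀
      allPass : ∀ {k} (ys : Vec (Pt (Trial n)) k) → allV (trialPasses (λ y → f (overwrite b u y))) ys ≡ true
      allPass []       = refl
      allPass (y ∷ ys) = cong₂ _∧_ (literal-passes (λ y → f (overwrite b u y)) i s lit y) (allPass ys)
    perSample : ∀ w xs → D * inner w xs ≤ Y * R * (D * sb w xs + t)
    perSample w xs with searchBad w (unfound G) xs in eq
    ... | false = ≤-trans (perOutcome w xs (find f G w xs) refl (search-outcome w (unfound G) xs eq)) (*-monoʳ-≤ (Y * R) (m≤n+m t (D * 0)))
    ... | true  = begin
      D * inner w xs       ≤⟨ *-monoʳ-≤ D (∑-bound YS λ ys → ∑-bound (Round ^ˢ t) λ ρ → ind≤1 _) ⟩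
      D * (Y * (R * 1))    ≡⟨ e₁ D Y R ⟩
      Y * R * (D * 1)      ≤⟨ *-monoʳ-≤ (Y * R) (m≤m+n (D * 1) t) ⟩
      Y * R * (D * 1 + t)  ∎
      where
      e₁ : ∀ D Y R → D * (Y * (R * 1)) ≡ Y * R * (D * 1)
      e₁ = solve-∀

  empty-good : Good (λ _ → nothing)
  empty-good c u ()

-- Logarithms, rounding and the passage from probabilities to counts.

n<2^n : ∀ n → n < 2 ^ n
n<2^n zero    = s≤s z≤n
n<2^n (suc n) = begin-strict
  suc n         ≤⟨ n<2^n n ⟩
  2 ^ n         <⟨ m<m+n (2 ^ n) (≤-trans (m^n>0 2 n) (≤-reflexive (sym (+-identityʳ (2 ^ n))))) ⟩
  2 * 2 ^ n     ∎
  where open ≤-Reasoning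

n<2^suc⌊log₂n⌋ : ∀ n → n < 2 ^ suc ⌊log₂ n ⌋
n<2^suc⌊log₂n⌋ n with n <? 2 ^ suc ⌊log₂ n ⌋
... | yes p = p
... | no ¬p = contradiction (≤-trans (≤-reflexive (sym (⌊log₂[2^n]⌋≡n (suc ⌊log₂ n ⌋)))) (⌊log₂⌋-mono-≤ (≮⇒≥ ¬p))) 1+n≰n

-- Rounds the logarithm of `T` up to a power of two at the cost of a factor 2, so that `K` can be a
-- power of two.
power-between : ∀ l → ∃ λ k → suc l ≤ 2 ^ k × 2 ^ k ≤ 2 * suc l
power-between zero = 0 , ≤-refl , s≤s z≤n
power-between (suc l) with power-between l
... | k , lower , upper with suc (suc l) ≤? 2 ^ k
...   | yes p = k , p , ≤-trans upper (*-monoʳ-≤ 2 (n≤1+n (suc l)))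
...   | no ¬p = suc k , ≤-trans (s≤s (≤-trans (m≤n+m (suc l) l) (≤-reflexive (cong (l +_) (sym (+-identityʳ (suc l))))))) (*-monoʳ-≤ 2 lower)
              , *-monoʳ-≤ 2 (≤-trans (≤-pred (≰⇒> ¬p)) (n≤1+n (suc l)))

-- Since `1 / ⌈1/ε⌉ ≤ ε`, the distance can be measured by an integer that later serves as a sample
-- size.
far⇒⌈1/ε⌉-far : ∀ {n} a b (f : BoolFun n) → FarFromDL (suc a) (suc b) f →
  ∀ L → ∥ cube n ∥ ≤ ceilInv a b * (∑[ x ∈ cube n ] ind (f x xor evalDL L x))
far⇒⌈1/ε⌉-far {n} a b f far L = *-cancelˡ-≤ (suc a) (begin
  suc a * ∥ cube n ∥                     ≡⟨ cong (suc a *_) (∥cube∥ n) ⟩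
  suc a * 2 ^ n                          ≤⟨ far L ⟩
  suc b * dist f (evalDL L)              ≡⟨ cong (suc b *_) (count-allVecs n (λ x → f x xor evalDL L x)) ⟩
  suc b * δ                              ≤⟨ *-monoˡ-≤ δ ceil ⟩
  T * suc a * δ                          ≡⟨ e T (suc a) δ ⟩
  suc a * (T * δ)                        ∎)
  where
  open ≤-Reasoning
  T = ceilInv a b
  δ = ∑[ x ∈ cube n ] ind (f x xor evalDL L x)
  e : ∀ t a d → t * a * d ≡ a * (t * d)
  e = solve-∀
  ceil : suc b ≤ T * suc a
  ceil = +-cancelʳ-≤ a _ _ (begin
    suc b + a                                    ≡⟨ m≡m%n+[m/n]*n (suc b + a) (suc a) ⟩
    (suc b + a) % suc a + T * suc a              ≤⟨ +-monoˡ-≤ (T * suc a) (≤-pred (m%n<n (suc b + a) (suc a))) ⟩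
    a + T * suc a                                ≡⟨ +-comm a (T * suc a) ⟩
    T * suc a + a                                ∎)

ceilInv>0 : ∀ a b → 1 ≤ ceilInv a b
ceilInv>0 a b with ceilInv a b in e
... | suc _ = s≤s z≤n
... | zero  = contradiction (begin-strict
  a                                      <⟨ n<1+n a ⟩
  suc a                                  ≤⟨ s≤s (m≤n+m a b) ⟩
  suc b + a                              ≡⟨ m≡m%n+[m/n]*n (suc b + a) (suc a) ⟩
  (suc b + a) % suc a + ceilInv a b * suc a ≡⟨ cong (λ v → (suc b + a) % suc a + v * suc a) e ⟩
  (suc b + a) % suc a + 0                ≡⟨ +-identityʳ _ ⟩
  (suc b + a) % suc a                    ≤⟨ ≤-pred (m%n<n (suc b + a) (suc a)) ⟩
  a                                      ∎) (<-irrefl refl)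
  where open ≤-Reasoning

two-thirds : ∀ p q s → p + q ≡ s → 3 * q ≤ s → 2 * s ≤ 3 * p
two-thirds p q s refl h = +-cancelʳ-≤ (p + q) _ _ (begin
  2 * (p + q) + (p + q) ≡⟨ e p q ⟩
  3 * p + 3 * q         ≤⟨ +-monoʳ-≤ (3 * p) h ⟩
  3 * p + (p + q)       ∎)
  where
  open ≤-Reasoning
  e : ∀ p q → 2 * (p + q) + (p + q) ≡ 3 * p + 3 * q
  e = solve-∀

-- Choice of the parameters and assembly of the algorithm.

module Assembly (n T κ : ℕ) .{{_ : NonZero T}} (1≤κ : 1 ≤ κ) where

  K μ M D j d N m m₂ : ℕ
  K  = 2 ^ κ
  -- This makes `M = 8 * K ^ 2`, so that some pair among `K` variables collides with probability at
  -- most `1 / 8`.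
  μ  = κ + κ + 3
  M  = 2 ^ μ
  -- With `M + 1` rounds the soundness error `2 * (M + 1) / D` is `1 / 3`; the completeness error
  -- `(M + 1) / D` is `1 / 6`, which leaves `1 / 6` for collisions.
  D  = 6 * suc M
  -- The summands pay for the factor `D`, for at most `(4 * M + 1) ^ K` rule lists and for the two
  -- defaults; the estimate `x < 2 ^ x` stands in for logarithms.
  j  = D + suc (M * 4) * K + 1
  d  = D
  N  = 2 * T * M
  m  = 2 * T * j
  m₂ = 2 * N * d

  M≡8K² : M ≡ K * K * 8
  M≡8K² = trans (^-distribˡ-+-* 2 (κ + κ) 3) (cong (_* 8) (^-distribˡ-+-* 2 κ κ))

  1≤M : 1 ≤ M
  1≤M = m^n>0 2 μ

  1≤K : 1 ≤ K
  1≤K = m^n>0 2 κ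

  16≤M : 16 ≤ M
  16≤M = ^-monoʳ-≤ 2 (+-monoˡ-≤ 3 (≤-trans 1≤κ (m≤m+n κ κ)))

  instance
    N≢0 : NonZero N
    N≢0 = m*n≢0 (2 * T) M ⦃ m*n≢0 2 T ⦄ ⦃ m^n≢0 2 μ ⦄

  16≤N : 16 ≤ N
  16≤N = ≤-trans 16≤M (m≤n*m M (2 * T) ⦃ m*n≢0 2 T ⦄)

  hypothesesFew : D * length (hypotheses μ K) ≤ 2 ^ j
  hypothesesFew = begin
    D * length (hypotheses μ K)               ≤⟨ *-mono-≤ (<⇒≤ (n<2^n D)) (length-hypotheses μ K) ⟩
    2 ^ D * (suc (M * 4) ^ K * 2)             ≤⟨ *-monoʳ-≤ (2 ^ D) (*-monoˡ-≤ 2 (^-monoˡ-≤ K (<⇒≤ (n<2^n (suc (M * 4)))))) ⟩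
    2 ^ D * ((2 ^ suc (M * 4)) ^ K * 2)       ≡⟨ cong (λ v → 2 ^ D * (v * 2)) (^-*-assoc 2 (suc (M * 4)) K) ⟩
    2 ^ D * (2 ^ (suc (M * 4) * K) * 2)       ≡⟨ *-assoc (2 ^ D) _ 2 ⟨
    2 ^ D * 2 ^ (suc (M * 4) * K) * 2         ≡⟨ cong (_* 2) (^-distribˡ-+-* 2 D (suc (M * 4) * K)) ⟨
    2 ^ (D + suc (M * 4) * K) * 2             ≡⟨ ^-distribˡ-+-* 2 (D + suc (M * 4) * K) 1 ⟨
    2 ^ j                                     ∎
    where open ≤-Reasoning

  sucM≤2M : suc M ≤ 2 * M
  sucM≤2M = ≤-trans (+-monoˡ-≤ M 1≤M) (≤-reflexive (cong (M +_) (sym (+-identityʳ M))))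

  j≤18MK : j ≤ 18 * (M * K)
  j≤18MK = begin
    6 * suc M + suc (M * 4) * K + 1        ≤⟨ +-mono-≤ (+-mono-≤ (*-monoʳ-≤ 6 sucM≤2M) (*-monoˡ-≤ K (+-monoˡ-≤ (M * 4) 1≤M))) (*-mono-≤ 1≤M 1≤K) ⟩
    6 * (2 * M) + (M + M * 4) * K + M * K  ≤⟨ +-monoˡ-≤ (M * K) (+-monoˡ-≤ ((M + M * 4) * K) (*-monoʳ-≤ 6 (*-monoʳ-≤ 2 (≤-trans (≤-reflexive (sym (*-identityʳ M))) (*-monoʳ-≤ M 1≤K))))) ⟩
    6 * (2 * (M * K)) + (M + M * 4) * K + M * K ≡⟨ e M K ⟩
    18 * (M * K)                           ∎
    where
    open ≤-Reasoning
    e : ∀ M K → 6 * (2 * (M * K)) + (M + M * 4) * K + M * K ≡ 18 * (M * K)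
    e = solve-∀

  Seed : Space
  Seed = Buckets n μ ⊗ RoundSpace n m m₂ ^ˢ suc M

  r : ℕ
  r = bits Seed

  alg : Pt Seed → Prog n Bool
  alg (β , ρ) = Tester.tester μ K m m₂ β (λ _ → nothing) ρ

  A : RandAlg n r
  A s = toTree (alg (decode Seed s))

  B R : ℕ
  B = ∥ Buckets n μ ∥
  R = ∥ RoundSpace n m m₂ ^ˢ suc M ∥

  accepted : ∀ f (p : Bool → Bool) → count (λ s → p (run (A s) f)) (allVecs r) ≡ ∑ Seed (λ s → ind (p (eval (alg s) f)))
  accepted f p = begin
    count (λ s → p (run (A s) f)) (allVecs r)                      ≡⟨ count-allVecs r _ ⟩
    ∑ (cube r) (λ s → ind (p (run (A s) f)))                       ≡⟨ ∑-cong (cube r) (λ s → cong (λ v → ind (p v)) (run-toTree (alg (decode Seed s)) f)) ⟩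
    ∑ (cube r) (λ s → ind (p (eval (alg (decode Seed s)) f)))      ≡⟨ ∑-decode Seed (λ s → ind (p (eval (alg s) f))) ⟩
    ∑ Seed (λ s → ind (p (eval (alg s) f)))                        ∎
    where open ≡-Reasoning

  accept+reject : ∀ f → acceptCount A f + rejectCount A f ≡ 2 ^ r
  accept+reject f = trans (cong₂ _+_ (accepted f (λ v → v)) (accepted f not)) (∑-complement Seed (λ s → eval (alg s) f))

  sound : ∀ f → (∀ L → ∥ cube n ∥ ≤ T * (∑[ x ∈ cube n ] ind (f x xor evalDL L x))) → 2 * 2 ^ r ≤ 3 * rejectCount A f
  sound f far = two-thirds (rejectCount A f) (acceptCount A f) (2 ^ r) (trans (+-comm (rejectCount A f) _) (accept+reject f))
    (≤-trans (≤-reflexive (cong (3 *_) (accepted f (λ v → v)))) (begin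
      3 * (∑[ β ∈ Buckets n μ ] acc β)     ≡⟨ ∑-*ˡ (Buckets n μ) 3 acc ⟨
      (∑[ β ∈ Buckets n μ ] (3 * acc β))   ≤⟨ ∑-bound (Buckets n μ) perPartition ⟩
      B * R                                ≡⟨ ∥⊗∥ (Buckets n μ) (RoundSpace n m m₂ ^ˢ suc M) ⟨
      2 ^ r                                ∎))
    where
    open ≤-Reasoning
    acc : Vec (Label μ) n → ℕ
    acc β = ∑ (RoundSpace n m m₂ ^ˢ suc M) (λ ρ → ind (eval (alg (β , ρ)) f))
    perPartition : ∀ β → 3 * acc β ≤ R
    perPartition β = *-cancelˡ-≤ (2 * suc M) (begin
      2 * suc M * (3 * acc β) ≡⟨ e (suc M) (acc β) ⟩
      D * acc β               ≤⟨ tester-sound (suc M) (λ _ → nothing) empty-sound ⟩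
      2 * suc M * R           ∎)
      where
      open Soundness {n} μ K T j d D N β f 16≤N refl hypothesesFew (<⇒≤ (n<2^n D)) far
      e : ∀ s a → 2 * s * (3 * a) ≡ 6 * s * a
      e = solve-∀

  module _ (fewQueries : D * (m * suc M) ≤ 2 ^ K) where

    complete : ∀ f → IsDecisionList f → 2 * 2 ^ r ≤ 3 * acceptCount A f
    complete f ((rs₀ , d₀) , f≡₀) = two-thirds (acceptCount A f) (rejectCount A f) (2 ^ r) (accept+reject f)
      (*-cancelˡ-≤ 2 (≤-trans (≤-reflexive (cong (λ v → 2 * (3 * v)) (accepted f not))) (begin
        2 * (3 * (∑[ β ∈ Buckets n μ ] rej β))  ≡⟨ *-assoc 2 3 (∑ (Buckets n μ) rej) ⟨
        6 * (∑[ β ∈ Buckets n μ ] rej β)        ≡⟨ ∑-*ˡ (Buckets n μ) 6 rej ⟨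
        (∑[ β ∈ Buckets n μ ] (6 * rej β))      ≤⟨ ∑-mono (Buckets n μ) perPartition ⟩
        (∑[ β ∈ Buckets n μ ] (R * (6 * ind (anyCollides vs β) + 1)))
          ≡⟨ trans (∑-*ˡ (Buckets n μ) R _) (cong (R *_) (trans (∑-+ (Buckets n μ) _ _) (cong₂ _+_ (∑-*ˡ (Buckets n μ) 6 _) (∑-one (Buckets n μ))))) ⟩
        R * (6 * collisions + B)                ≤⟨ *-monoʳ-≤ R (+-monoˡ-≤ B collisionsRare) ⟩
        R * (B + B)                             ≡⟨ e₁ R B ⟩
        2 * (B * R)                             ≡⟨ cong (2 *_) (∥⊗∥ (Buckets n μ) (RoundSpace n m m₂ ^ˢ suc M)) ⟨
        2 * 2 ^ r                               ∎)))
      where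
      open ≤-Reasoning
      e₁ : ∀ R B → R * (B + B) ≡ 2 * (B * R)
      e₁ = solve-∀
      rs = proj₁ (normalise rs₀ d₀)
      dflt = proj₂ (normalise rs₀ d₀)
      vs = map proj₁ (take K rs)
      rej : Vec (Label μ) n → ℕ
      rej β = ∑ (RoundSpace n m m₂ ^ˢ suc M) (λ ρ → ind (not (eval (alg (β , ρ)) f)))
      collisions = ∑ (Buckets n μ) (λ β → ind (anyCollides vs β))
      length-vs : length vs ≤ K
      length-vs = ≤-trans (≤-reflexive (trans (length-map proj₁ (take K rs)) (length-take K rs))) (m⊓n≤m K (length rs))
      collisionsRare : 6 * collisions ≤ B
      collisionsRare = *-cancelˡ-≤ (K * K) ⦃ m*n≢0 K K ⦃ m^n≢0 2 κ ⦄ ⦃ m^n≢0 2 κ ⦄ ⦄ (begin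
        -- The 8 is the first power of two above the 6 that the error budget asks for.
        K * K * (6 * collisions)    ≤⟨ *-monoʳ-≤ (K * K) (*-monoˡ-≤ collisions (m≤m+n 6 2)) ⟩
        K * K * (8 * collisions)    ≡⟨ *-assoc (K * K) 8 collisions ⟨
        K * K * 8 * collisions      ≡⟨ cong (_* collisions) (trans (sym M≡8K²) (sym (∥cube∥ μ))) ⟩
        ∥ cube μ ∥ * collisions     ≤⟨ anyCollides-rare μ vs ⟩
        length vs * (length vs * B) ≤⟨ *-mono-≤ length-vs (*-monoˡ-≤ B length-vs) ⟩
        K * (K * B)                 ≡⟨ *-assoc K K B ⟨
        K * K * B                   ∎)
      perPartition : ∀ β → 6 * rej β ≤ R * (6 * ind (anyCollides vs β) + 1)
      perPartition β with anyCollides vs β in eq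
      ... | true  = begin
        6 * rej β                   ≤⟨ *-monoʳ-≤ 6 (∑-bound (RoundSpace n m m₂ ^ˢ suc M) λ ρ → ind≤1 (not (eval (alg (β , ρ)) f))) ⟩
        6 * (R * 1)                 ≡⟨ e₂ R ⟩
        R * 6                       ≤⟨ *-monoʳ-≤ R (m≤m+n 6 1) ⟩
        R * (6 * 1 + 1)             ∎
        where
        e₂ : ∀ R → 6 * (R * 1) ≡ R * 6
        e₂ = solve-∀
      ... | false = *-cancelˡ-≤ (suc M) (begin
        suc M * (6 * rej β)         ≡⟨ e₂ (suc M) (rej β) ⟩
        D * rej β                   ≤⟨ tester-complete (suc M) (λ _ → nothing) empty-good (s≤s (unfound≤M (λ _ → nothing))) ⟩
        suc M * R                   ≡⟨ cong (suc M *_) (sym (*-identityʳ R)) ⟩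
        suc M * (R * 1)             ∎)
        where
        open Completeness {n} μ K m m₂ D β rs dflt (normalise-distinct rs₀ d₀) f
          (λ x → trans (f≡₀ x) (sym (normalise-eval rs₀ d₀ x))) (separated vs β eq) fewQueries
        e₂ : ∀ s r → s * (6 * r) ≡ 6 * s * r
        e₂ = solve-∀

  -- The source of the exponent 7. The number of rounds, the length of a walk and the sample size
  -- `m` each contribute a factor of order `M`, the sample size a further `K`, and `M` is of order
  -- `K ^ 2`.
  cubic : ∀ c → c * (T * (K * (M * (M * M)))) ≡ c * 512 * (T * K ^ 7)
  cubic c = trans (cong (λ v → c * (T * (K * (v * (v * v))))) M≡8K²) (e c T K)
    where
    e : ∀ c T K → c * (T * (K * (K * K * 8 * (K * K * 8 * (K * K * 8))))) ≡ c * 512 * (T * (K * (K * (K * (K * (K * (K * (K * 1))))))))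
    e = solve-∀

  depth-bound : ∀ c → c ≡ 1248 * 512 → ∀ s → depth (A s) ≤ c * (T * K ^ 7)
  depth-bound c refl s = begin
    depth (A s)   ≡⟨ depth-toTree (alg (decode Seed s)) ⟩
    cost (alg (decode Seed s)) ≤⟨ Tester.cost-tester μ K m m₂ (proj₁ (decode Seed s)) (λ _ → nothing) (proj₂ (decode Seed s)) ⟩
    suc M * (m * suc M + (m * suc M + m₂ * 10))
      ≤⟨ *-mono-≤ sucM≤2M (+-mono-≤ mM (+-mono-≤ mM (*-monoˡ-≤ 10 (*-monoʳ-≤ (2 * N) (*-monoʳ-≤ 6 sucM≤2M))))) ⟩
    2 * M * (2 * T * (18 * (M * K)) * (2 * M) + (2 * T * (18 * (M * K)) * (2 * M) + 2 * (2 * T * M) * (6 * (2 * M)) * 10))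
      ≡⟨ e T K M ⟩
    288 * (T * (K * (M * (M * M)))) + 960 * (T * (1 * (M * (M * M))))
      ≤⟨ +-monoʳ-≤ (288 * (T * (K * (M * (M * M))))) (*-monoʳ-≤ 960 (*-monoʳ-≤ T (*-monoˡ-≤ (M * (M * M)) 1≤K))) ⟩
    288 * (T * (K * (M * (M * M)))) + 960 * (T * (K * (M * (M * M))))
      ≡⟨ *-distribʳ-+ (T * (K * (M * (M * M)))) 288 960 ⟨
    1248 * (T * (K * (M * (M * M))))
      ≡⟨ cubic 1248 ⟩
    1248 * 512 * (T * K ^ 7) ∎
    where
    open ≤-Reasoning
    mM : m * suc M ≤ 2 * T * (18 * (M * K)) * (2 * M)
    mM = *-mono-≤ (*-monoʳ-≤ (2 * T) j≤18MK) sucM≤2M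
    e : ∀ T K M → 2 * M * (2 * T * (18 * (M * K)) * (2 * M) + (2 * T * (18 * (M * K)) * (2 * M) + 2 * (2 * T * M) * (6 * (2 * M)) * 10))
        ≡ 288 * (T * (K * (M * (M * M)))) + 960 * (T * (1 * (M * (M * M))))
    e = solve-∀

  queries-bound : ∀ c → c ≡ 2 ^ 19 → D * (m * suc M) ≤ c * (T * K ^ 7)
  queries-bound c refl = begin
    D * (m * suc M) ≤⟨ *-mono-≤ (*-monoʳ-≤ 6 sucM≤2M) (*-mono-≤ (*-monoʳ-≤ (2 * T) j≤18MK) sucM≤2M) ⟩
    6 * (2 * M) * (2 * T * (18 * (M * K)) * (2 * M)) ≡⟨ e T K M ⟩
    -- Rounding up to 1024 turns the final constant into a power of two, which can join the exponent
    -- in `fewQueries`.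
    864 * (T * (K * (M * (M * M)))) ≤⟨ *-monoˡ-≤ (T * (K * (M * (M * M)))) (m≤m+n 864 160) ⟩
    1024 * (T * (K * (M * (M * M)))) ≡⟨ cubic 1024 ⟩
    2 ^ 19 * (T * K ^ 7) ∎
    where
    open ≤-Reasoning
    e : ∀ T K M → 6 * (2 * M) * (2 * T * (18 * (M * K)) * (2 * M)) ≡ 864 * (T * (K * (M * (M * M))))
    e = solve-∀

-- K = 128 L with L ≥ log T, so that T K^7 = 2^O(log T) is far below 2^K.
fewQueries : ∀ a c T lg κ → a ≡ 19 → c ≡ 2 ^ a → κ ≡ 7 + lg → T ≤ 2 ^ (2 ^ lg) → c * (T * (2 ^ κ) ^ 7) ≤ 2 ^ (2 ^ κ)
fewQueries a c T lg κ a≡ refl κ≡ T≤ = begin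
  2 ^ a * (T * (2 ^ κ) ^ 7)             ≤⟨ *-monoʳ-≤ (2 ^ a) (*-monoˡ-≤ ((2 ^ κ) ^ 7) T≤) ⟩
  2 ^ a * (2 ^ L * (2 ^ κ) ^ 7)         ≡⟨ cong (λ v → 2 ^ a * (2 ^ L * v)) (^-*-assoc 2 κ 7) ⟩
  2 ^ a * (2 ^ L * 2 ^ (κ * 7))         ≡⟨ cong (2 ^ a *_) (^-distribˡ-+-* 2 L (κ * 7)) ⟨
  2 ^ a * 2 ^ (L + κ * 7)               ≡⟨ ^-distribˡ-+-* 2 a (L + κ * 7) ⟨
  2 ^ (a + (L + κ * 7))                 ≤⟨ ^-monoʳ-≤ 2 exponent ⟩
  2 ^ (2 ^ κ)                            ∎
  where
  open ≤-Reasoning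
  L = 2 ^ lg
  e₁ : ∀ L lg → 19 + (L + (7 + lg) * 7) ≡ 68 * 1 + (L + 7 * lg)
  e₁ = solve-∀
  e₂ : ∀ L → 68 * L + (L + 7 * L) + 52 * L ≡ 128 * L
  e₂ = solve-∀
  exponent : a + (L + κ * 7) ≤ 2 ^ κ
  exponent = begin
    a + (L + κ * 7)                  ≡⟨ cong₂ (λ u v → u + (L + v * 7)) {x = a} {y = 19} {u = κ} {v = 7 + lg} a≡ κ≡ ⟩
    19 + (L + (7 + lg) * 7)          ≡⟨ e₁ L lg ⟩
    -- The exponent is at most `76 * L`; the 7 in `κ` is chosen because 128 is the next power of
    -- two.
    68 * 1 + (L + 7 * lg)            ≤⟨ +-mono-≤ (*-monoʳ-≤ 68 (m^n>0 2 lg)) (+-monoʳ-≤ L (*-monoʳ-≤ 7 (<⇒≤ (n<2^n lg)))) ⟩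
    68 * L + (L + 7 * L)             ≤⟨ m≤m+n _ (52 * L) ⟩
    68 * L + (L + 7 * L) + 52 * L    ≡⟨ e₂ L ⟩
    128 * L                          ≡⟨ ^-distribˡ-+-* 2 7 lg ⟨
    2 ^ (7 + lg)                     ≡⟨ cong (2 ^_) κ≡ ⟨
    2 ^ κ                            ∎

polylog : ∀ c C T lg κ l → C ≡ c * 256 ^ 7 → κ ≡ 7 + lg → 2 ^ lg ≤ 2 * l → c * (T * (2 ^ κ) ^ 7) ≤ C * (T * l ^ 7)
polylog c C T lg κ l refl κ≡ h = begin
  c * (T * (2 ^ κ) ^ 7)           ≤⟨ *-monoʳ-≤ c (*-monoʳ-≤ T (^-monoˡ-≤ 7 base)) ⟩
  c * (T * (256 * l) ^ 7)         ≡⟨ cong (λ v → c * (T * v)) (^-distribʳ-* 256 l 7) ⟩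
  c * (T * (256 ^ 7 * l ^ 7))     ≡⟨ e c T (256 ^ 7) (l ^ 7) ⟩
  c * 256 ^ 7 * (T * l ^ 7)       ∎
  where
  open ≤-Reasoning
  e : ∀ c T p q → c * (T * (p * q)) ≡ c * p * (T * q)
  e = solve-∀
  -- The factor 128 comes from `κ`, the factor 2 from rounding the logarithm to a power of two.
  base : 2 ^ κ ≤ 256 * l
  base = begin
    2 ^ κ           ≡⟨ cong (2 ^_) κ≡ ⟩
    2 ^ (7 + lg)    ≡⟨ ^-distribˡ-+-* 2 7 lg ⟩
    128 * 2 ^ lg    ≤⟨ *-monoʳ-≤ 128 h ⟩
    128 * (2 * l)   ≡⟨ *-assoc 128 2 l ⟨
    256 * l         ∎

-- The numerals are kept as variables: the type checker would unfold a product with a literal factor into a sum.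
tester-for : ∀ c c′ C κ n a b lg → c ≡ 1248 * 512 → c′ ≡ 2 ^ 19 → C ≡ c * 256 ^ 7 → κ ≡ 7 + lg →
  suc ⌊log₂ ceilInv a b ⌋ ≤ 2 ^ lg → 2 ^ lg ≤ 2 * suc ⌊log₂ ceilInv a b ⌋ →
  ∃ λ (r : ℕ) → Σ (RandAlg n r) λ A →
    (∀ (s : Vec Bool r) → depth (A s) ≤ C * (ceilInv a b * suc ⌊log₂ ceilInv a b ⌋ ^ 7))
    × (∀ (f : BoolFun n) → IsDecisionList f → 2 * 2 ^ r ≤ 3 * acceptCount A f)
    × (∀ (f : BoolFun n) → FarFromDL (suc a) (suc b) f → 2 * 2 ^ r ≤ 3 * rejectCount A f)
tester-for c c′ C κ n a b lg c≡ c′≡ C≡ κ≡ lower upper = r , A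
  , (λ s → ≤-trans (depth-bound c c≡ s) (polylog c C T₀ lg κ _ C≡ κ≡ upper))
  , complete (≤-trans (queries-bound c′ c′≡) (fewQueries 19 c′ T₀ lg κ refl c′≡ κ≡ (≤-trans (<⇒≤ (n<2^suc⌊log₂n⌋ T₀)) (^-monoʳ-≤ 2 lower))))
  , λ f far → sound f (far⇒⌈1/ε⌉-far a b f far)
  where
  T₀ = ceilInv a b
  open Assembly n T₀ κ ⦃ >-nonZero (ceilInv>0 a b) ⦄ (≤-trans (s≤s z≤n) (≤-reflexive (sym κ≡)))

theorem21 : ∃ λ (C : ℕ) → ∃ λ (k : ℕ) → ∀ (n a b : ℕ) →
    ∃ λ (r : ℕ) → Σ (RandAlg n r) λ A →
    (∀ (s : Vec Bool r) → depth (A s) ≤ C * (ceilInv a b * suc ⌊log₂ ceilInv a b ⌋ ^ k))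
    × (∀ (f : BoolFun n) → IsDecisionList f → 2 * 2 ^ r ≤ 3 * acceptCount A f)
    × (∀ (f : BoolFun n) → FarFromDL (suc a) (suc b) f → 2 * 2 ^ r ≤ 3 * rejectCount A f)
theorem21 = 1248 * 512 * 256 ^ 7 , 7 , λ n a b →
  let lg , lower , upper = power-between ⌊log₂ ceilInv a b ⌋
  in tester-for (1248 * 512) (2 ^ 19) _ (7 + lg) n a b lg refl refl refl refl lower upper
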